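{- Let $\mathbb{F}_q$ have prime characteristic $p$. Then: (i) $P(1,\mathbb{F}_q)=D(q-1)$. (ii) $P(2,\mathbb{F}_q)=D(q^2-1)\cup pD(q-1)$. (iii) $P(3,\mathbb{F}_q)=D(q^3-1)\cup D(q^2-1)\cup pD(q-1)$ if $p\ge 3$, and $P(3,\mathbb{F}_q)=D(q^3-1)\cup D(q^2-1)\cup \{2,4\}D(q-1)$ if $p=2$. (iv) $P(4,\mathbb{F}_q)=D(q^4-1)\cup D(q^3-1)\cup pD(q^2-1)$ if $p\ge 5$, and $P(4,\mathbb{F}_q)=D(q^4-1)\cup D(q^3-1)\cup pD(q^2-1)\cup p^2D(q-1)$ if $p\in\{2,3\}$. Equivalently, for $1\le k\le 4$, $P(k,\mathbb{F}_q)=\bigcup_{i=1}^k \{p^j : 0\le j\le t_i\}\, D(q^i-1)$ where $t_i=\min\{t\in\mathbb{Z}: p^t\ge \lfloor k/i\rfloor\}$.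
   Context: A sequence $\mathbf{a}=(a_n)_{n\ge 0}$ over $\mathbb{F}_q$ satisfies a linear recurrence of degree $k$ if there are $c_0,\dots,c_{k-1}\in\mathbb{F}_q$ with $c_0 \neq 0$ such that $a_{n+k}=\sum_{i=0}^{k-1}c_i a_{n+i}$ for all $n\ge 0$. Its period $\rho(\mathbf{a})$ is the least $m>0$ with $a_{n+m}=a_n$ for all sufficiently large $n$. $P(k,\mathbb{F}_q)$ denotes the set of periods of all sequences over $\mathbb{F}_q$ satisfying a linear recurrence of degree $k$. $D(n)$ is the set of positive divisors of $n$; for an integer $a$ and $S\subseteq\mathbb{Z}$, $aS=\{ax: x\in S\}$, and $S_1S_2=\{xy: x\in S_1,y\in S_2\}$. -}

module Defs where

open import Level using (0ℓ)
open import Data.Nat using (ℕ; _≤_; _<_)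
import Data.Nat as ℕ
open import Data.Nat.Divisibility using (_∣_)
open import Data.Fin using (Fin; toℕ)
open import Data.Product using (Σ; _,_) renaming (_×_ to _∧_)
open import Data.Sum using (_⊎_)
open import Relation.Nullary using (¬_)
open import Relation.Binary.PropositionalEquality using (_≡_)
import Relation.Binary.PropositionalEquality as ≡
open import Algebra.Bundles using (CommutativeRing)
open import Function.Bundles using (Inverse)
import Algebra.Definitions.RawMonoid as RawMonoidDefs

record FiniteField : Set₁ where
  field
    commRing : CommutativeRing 0ℓ 0ℓ
  open CommutativeRing commRing public
  field
    size        : ℕ
    enumeration : Inverse (≡.setoid (Fin size)) setoid
    1≉0         : ¬ (1# ≈ 0#)
    inverse     : ∀ x → ¬ (x ≈ 0#) → Σ Carrier λ y → x * y ≈ 1#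

module _ (F : FiniteField) where
  open FiniteField F
  open RawMonoidDefs +-rawMonoid using (sum) renaming (_×_ to _·_)

  natCast : ℕ → Carrier
  natCast n = n · 1#

  SatisfiesLinRec : ℕ → (ℕ → Carrier) → Set
  SatisfiesLinRec k a =
    Σ (Fin k → Carrier) λ c →
      (∀ (i : Fin k) → toℕ i ≡ 0 → ¬ (c i ≈ 0#)) ∧
      (∀ n → a (n ℕ.+ k) ≈ sum (λ i → c i * a (n ℕ.+ toℕ i)))

  IsEventualPeriod : (ℕ → Carrier) → ℕ → Set
  IsEventualPeriod a m =
    0 < m ∧ Σ ℕ λ N → ∀ n → N ≤ n → a (n ℕ.+ m) ≈ a n

  HasPeriod : (ℕ → Carrier) → ℕ → Set
  HasPeriod a m =
    IsEventualPeriod a m ∧ (∀ m' → m' < m → ¬ IsEventualPeriod a m')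

  InP : ℕ → ℕ → Set
  InP k m = Σ (ℕ → Carrier) λ a → SatisfiesLinRec k a ∧ HasPeriod a m

-- m ∈ D(n)  (positive divisors of n; n ≥ 1 in all uses)
InD : ℕ → ℕ → Set
InD n m = 0 < m ∧ m ∣ n

InMulD : (ℕ → Set) → ℕ → ℕ → Set
InMulD S n m = Σ ℕ λ s → Σ ℕ λ d → S s ∧ InD n d ∧ m ≡ s ℕ.* d

{-# OPTIONS --safe #-}
-- Let polynomials over F = F_q act on sequences with x as the shift; a sequence satisfies a recurrence
-- of degree k iff a monic f of degree k with f(0) ≠ 0 kills it, and its period divides N iff x^N − 1 kills it.
--
-- Upper bound: factor f (k ≤ 4).  If f is irreducible of degree j, then x is a unit of the field F[x]/(f),
-- so f divides x^(q^j−1) − 1.  Repeated factors are absorbed by (x^N − 1)^p = x^(Np) − 1, and a linear factor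
-- coprime to the rest costs nothing by Bézout.
--
-- Lower bound: for d ∣ q^j − 1 take β of order d in an extension K of degree j and a linear functional φ with
-- φ(1) = 1.  Then n ↦ φ(β^n) has period exactly d, because 1 is a combination of the elements β^n (β^m − 1)
-- whenever β^m ≠ 1.  It is killed by a polynomial w of degree j, and w^(t+1) kills C(n,t) φ(β^n); since
-- n ↦ C(n,1) and n ↦ C(n,p) have periods p and p² in F, this gives the periods p d and p² d.
module Submission where

open import Defs
open import Level using (0ℓ)
open import Data.Nat using (ℕ; zero; suc; _≤_; _<_; z≤n; s≤s)
open import Data.Nat.Divisibility using (_∣_; divides; _∣?_; ∣-refl; ∣-trans; m∣m*n; n∣m*n; *-cancelˡ-∣; *-monoˡ-∣; *-monoʳ-∣; 1∣_; _∣0; ∣⇒≤; ∣1⇒≡1; m%n≡0⇒n∣m)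
open import Data.Nat.DivMod using (_%_; _/_; m≡m%n+[m/n]*n; m%n<n)
open import Data.Nat.Primality using (Prime; euclidsLemma; prime⇒irreducible; prime⇒nonZero; prime⇒nonTrivial)
open import Data.Nat.Coprimality using (Coprime; coprime-divisor; coprime-Bézout)
open import Data.Fin using (Fin; toℕ)
open import Data.Product using (Σ; ∃; _×_; _,_; proj₁; proj₂)
open import Data.Sum using (_⊎_; inj₁; inj₂)
open import Data.Empty using (⊥-elim)
open import Data.List using (List; []; _∷_)
open import Data.Vec using (Vec; []; _∷_)
open import Relation.Nullary using (¬_; Dec; yes; no)
open import Relation.Binary.PropositionalEquality using (_≡_; _≢_)
open import Algebra.Bundles using (CommutativeRing; RawRing)
open import Function.Base using (_∘_)
open import Function.Bundles using (Inverse; _⇔_; mk⇔)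
import Data.Fin.Properties as Finₚ
import Data.Nat as ℕ
import Data.Nat.Coprimality as Coprimality
import Data.Nat.Properties as ℕₚ
import Relation.Binary.PropositionalEquality as ≡

-- A polynomial is known only through its action. Equality modulo f is equality of the actions on
-- the kernel of f, and inclusion of kernels takes the place of divisibility, so the ring laws
-- become identities between commuting operators. The price is that a nonzero kernel has to be
-- exhibited: the solution with initial values 1, 0, ..., 0 does this, and reading off its value at
-- index 0 also supplies φ.
--
-- Periods are eventual periods, so a candidate period has to divide every eventual period; in this
-- form it also passes to products. The periods p and p² of the binomial sequences are prime to d,
-- because an element of order divisible by p cannot exist in characteristic p; hence the two
-- periods multiply.
--
-- The exceptional primes come from two thresholds. Multiplicity t costs at most a factor p if t ≤
-- p, and at most p² if t ≤ p²; conversely C(n,p) needs multiplicity p + 1. Within degree 4 this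
-- fits only for p = 2 and p = 3.
--
-- Beyond x itself, the extensions need irreducible polynomials only of degrees 2 and 3, where
-- having no root suffices; degree 4 is reached by two quadratic steps.

-- Divisibility, coprimality and prime powers

module Arithmetic where
  open import Data.Nat using (_+_; _*_; _^_)
  open import Data.Nat.GCD using (module Bézout)
  open import Data.Nat.Primality.Factorisation using (factorise)
  open import Data.Nat.Induction using (<-rec)
  open import Data.Nat.Solver using (module +-*-Solver)
  open import Data.List.Relation.Unary.All using (_∷_)
  open ≡ using (refl; sym; trans; cong; subst)

  prime∤⇒coprime : ∀ {p m} → Prime p → ¬ p ∣ m → Coprime p m
  prime∤⇒coprime pr p∤m (i∣p , i∣m) with prime⇒irreducible pr i∣p
  ... | inj₁ i≡1 = i≡1
  ... | inj₂ refl = ⊥-elim (p∤m i∣m)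

  coprime-*ˡ : ∀ {m n k} → Coprime m k → Coprime n k → Coprime (m * n) k
  coprime-*ˡ {m} m⊥k n⊥k {i} (i∣mn , i∣k) = n⊥k (coprime-divisor i⊥m i∣mn , i∣k)
    where
    i⊥m : Coprime i m
    i⊥m (c∣i , c∣m) = m⊥k (c∣m , ∣-trans c∣i i∣k)

  coprime-^ˡ : ∀ {m k} a → Coprime m k → Coprime (m ^ a) k
  coprime-^ˡ zero    m⊥k = Coprimality.1-coprimeTo _
  coprime-^ˡ (suc a) m⊥k = coprime-*ˡ m⊥k (coprime-^ˡ a m⊥k)

  coprime-*-∣ : ∀ {m n k} → Coprime m n → m ∣ k → n ∣ k → m * n ∣ k
  coprime-*-∣ {m} {n} m⊥n m∣k (divides c refl) =
    *-monoˡ-∣ n (coprime-divisor m⊥n (subst (m ∣_) (ℕₚ.*-comm c n) m∣k))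

  ∣-prime-* : ∀ {p m n} → Prime p → m ∣ p * n → m ∣ n ⊎ ∃ λ m′ → m ≡ p * m′ × m′ ∣ n
  ∣-prime-* {p} {m} {n} pr m∣pn with p ∣? m
  ... | no p∤m = inj₁ (coprime-divisor (Coprimality.sym (prime∤⇒coprime pr p∤m)) m∣pn)
  ... | yes (divides k refl) =
    inj₂ (k , ℕₚ.*-comm k p ,
      *-cancelˡ-∣ p {{prime⇒nonZero pr}} (subst (_∣ p * n) (ℕₚ.*-comm k p) m∣pn))

  -- It makes `r ^ a` the only exponent to be tested when an order is to be shown equal to
  -- `r ^ suc a`.
  ∣-prime-^ : ∀ {r g} → Prime r → ∀ a → g ∣ r ^ suc a → g ≡ r ^ suc a ⊎ g ∣ r ^ a
  ∣-prime-^ {r} pr a g∣ with ∣-prime-* pr g∣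
  ∣-prime-^ {r} pr a g∣ | inj₁ g∣r^a = inj₂ g∣r^a
  ∣-prime-^ {r} pr zero g∣ | inj₂ (m′ , refl , m′∣1) = inj₁ (cong (r *_) (∣1⇒≡1 m′∣1))
  ∣-prime-^ {r} pr (suc a) g∣ | inj₂ (m′ , refl , m′∣) with ∣-prime-^ pr a m′∣
  ... | inj₁ m′≡ = inj₁ (cong (r *_) m′≡)
  ... | inj₂ m′∣r^a = inj₂ (*-monoʳ-∣ r m′∣r^a)

  -- The two sides are padded by multiples of d so that no subtraction occurs.
  inverse-mod : ∀ {P d} → Coprime P d → ∃ λ x → ∃ λ y → ∃ λ y′ → P * x + d * y′ ≡ 1 + d * y
  inverse-mod {P} {d} P⊥d with coprime-Bézout P⊥d
  ... | Bézout.+- x y eq = x , y , 0 , trans (cong (P * x +_) (ℕₚ.*-zeroʳ d))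
        (trans (ℕₚ.+-identityʳ _) (trans (ℕₚ.*-comm P x) (trans (sym eq) (cong suc (ℕₚ.*-comm y d)))))
  -- Here P x ≡ -1 mod d, so (P x)² ≡ 1 and the inverse of P is x (x P).
  ... | Bézout.-+ x y eq = x * (x * P) , y * (P * x) , y , (begin
        P * (x * (x * P)) + d * y  ≡⟨ cong (P * (x * (x * P)) +_) (trans (ℕₚ.*-comm d y) (sym eq)) ⟩
        P * (x * (x * P)) + (1 + x * P)
          ≡⟨ solve 2 (λ P x → P :* (x :* (x :* P)) :+ (con 1 :+ x :* P)
                            := con 1 :+ (con 1 :+ x :* P) :* (P :* x)) refl P x ⟩
        1 + (1 + x * P) * (P * x)  ≡⟨ cong (λ z → 1 + z * (P * x)) eq ⟩
        1 + y * d * (P * x)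
          ≡⟨ solve 3 (λ d y w → con 1 :+ y :* d :* w := con 1 :+ d :* (y :* w)) refl d y (P * x) ⟩
        1 + d * (y * (P * x))      ∎)
    where
    open +-*-Solver
    open ≡.≡-Reasoning

  prime-power-split : ∀ {r} → Prime r → ∀ d → 0 < d →
                      ∃ λ a → ∃ λ d′ → d ≡ r ^ a * d′ × ¬ r ∣ d′
  prime-power-split {r} pr = <-rec _ step
    where
    step : ∀ d → (∀ {e} → e < d → 0 < e → ∃ λ a → ∃ λ d′ → e ≡ r ^ a * d′ × ¬ r ∣ d′) →
           0 < d → ∃ λ a → ∃ λ d′ → d ≡ r ^ a * d′ × ¬ r ∣ d′
    step d rec 0<d with r ∣? d
    ... | no r∤d = 0 , d , sym (ℕₚ.+-identityʳ d) , r∤d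
    step d rec () | yes (divides zero refl)
    step d rec 0<d | yes (divides e@(suc _) refl)
      with rec (ℕₚ.m<m*n e r (ℕ.nonTrivial⇒n>1 r {{prime⇒nonTrivial pr}})) (s≤s z≤n)
    ... | a , d′ , eq , r∤d′ = suc a , d′ ,
          trans (ℕₚ.*-comm e r) (trans (cong (r *_) eq) (sym (ℕₚ.*-assoc r (r ^ a) d′))) , r∤d′

  prime-divisor : ∀ d → 1 < d → ∃ λ r → Prime r × r ∣ d
  prime-divisor d@(suc _) 1<d with factorise d
  ... | record { factors = [] ; isFactorisation = eq } = ⊥-elim (ℕₚ.<-irrefl (sym eq) 1<d)
  ... | record { factors = r ∷ rs ; isFactorisation = eq ; factorsPrime = pr ∷ _ } =
        r , pr , subst (r ∣_) (sym eq) (m∣m*n _)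

-- Binomial coefficients modulo a prime

module BinomialCoefficients where
  open import Data.Nat using (_+_; _*_)
  open import Data.Nat.Combinatorics public using (_C_; nCn≡1; nC1≡n) renaming (nCk+nC[k+1]≡[n+1]C[k+1] to pascal)
  open import Data.Nat.Solver using (module +-*-Solver)
  open ≡ using (refl; sym; trans; cong; cong₂; subst)

  absorption : ∀ n k → suc k * (suc n C suc k) ≡ suc n * (n C k)
  absorption zero    zero    = refl
  absorption zero    (suc k) = ℕₚ.*-zeroʳ (suc (suc k))
  absorption (suc n) zero    = trans (ℕₚ.+-identityʳ _) (trans (nC1≡n (suc (suc n))) (sym (ℕₚ.*-identityʳ _)))
  absorption (suc n) (suc k) = begin
    suc (suc k) * (suc (suc n) C suc (suc k))  ≡⟨ cong (suc (suc k) *_) (pascal (suc n) (suc k)) ⟨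
    suc (suc k) * (A + B)
      ≡⟨ solve 3 (λ k A B → (con 2 :+ k) :* (A :+ B) := A :+ ((con 1 :+ k) :* A :+ (con 2 :+ k) :* B)) refl k A B ⟩
    A + (suc k * A + suc (suc k) * B)          ≡⟨ cong (A +_) (cong₂ _+_ (absorption n k) (absorption n (suc k))) ⟩
    A + (suc n * (n C k) + suc n * (n C suc k)) ≡⟨ cong (A +_) (ℕₚ.*-distribˡ-+ (suc n) (n C k) (n C suc k)) ⟨
    A + suc n * (n C k + n C suc k)            ≡⟨ cong (λ z → A + suc n * z) (pascal n k) ⟩
    suc (suc n) * A                            ∎
    where
    open ≡.≡-Reasoning
    open +-*-Solver
    A = suc n C suc k
    B = suc n C suc (suc k)

  -- By `absorption` the prime divides (k + 1) C(n + 1, k + 1), and it is too large to divide k + 1.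
  prime∣C : ∀ {n k} → Prime (suc n) → k < n → suc n ∣ suc n C suc k
  prime∣C {n} {k} pr k<n with euclidsLemma (suc k) (suc n C suc k) pr (subst (suc n ∣_) (sym (absorption n k)) (m∣m*n (n C k)))
  ... | inj₁ n∣k = ⊥-elim (ℕₚ.<⇒≱ k<n (ℕₚ.≤-pred (∣⇒≤ n∣k)))
  ... | inj₂ ok  = ok

-- A ring solver with integer coefficients

-- The solver's coefficients are formal differences a − b of naturals, so that x − x is recognised as 0.
module IntegralSolver (R : CommutativeRing 0ℓ 0ℓ) where
  open CommutativeRing R hiding (zero)
  open import Algebra.Properties.Ring ring using (-‿distribˡ-*; -‿distribʳ-*; -0#≈0#; -‿involutive)
  open import Algebra.Properties.AbelianGroup +-abelianGroup using (⁻¹-∙-comm)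
  open import Algebra.Properties.Semiring.Mult semiring using (×-homo-+; ×1-homo-*) renaming (_×_ to _·_)
  open import Algebra.Properties.CommutativeSemigroup +-commutativeSemigroup using (interchange)
  open import Algebra.Solver.Ring.AlmostCommutativeRing using (fromCommutativeRing; _-Raw-AlmostCommutative⟶_)
  open import Data.Maybe using (Maybe; just; nothing)
  open import Relation.Binary.Reasoning.Setoid setoid

  cancel : ℕ × ℕ → ℕ × ℕ
  cancel (suc a , suc b) = cancel (a , b)
  cancel x               = x

  differences : RawRing 0ℓ 0ℓ
  differences = record
    { Carrier = ℕ × ℕ
    ; _≈_ = _≡_
    ; _+_ = λ (a , b) (c , d) → cancel (a ℕ.+ c , b ℕ.+ d)
    ; _*_ = λ (a , b) (c , d) → cancel (a ℕ.* c ℕ.+ b ℕ.* d , a ℕ.* d ℕ.+ b ℕ.* c)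
    ; -_ = λ (a , b) → b , a
    ; 0# = 0 , 0
    ; 1# = 1 , 0
    }

  private
    module D = RawRing differences

    cast : ℕ → Carrier
    cast n = n · 1#

    diff : D.Carrier → Carrier
    diff (a , b) = cast a - cast b

    diff-cancel : ∀ x → diff (cancel x) ≈ diff x
    diff-cancel (zero , _)      = refl
    diff-cancel (suc _ , zero)  = refl
    diff-cancel (suc a , suc b) = begin
      diff (cancel (a , b))          ≈⟨ diff-cancel (a , b) ⟩
      cast a - cast b                ≈⟨ +-identityˡ _ ⟨
      0# + (cast a - cast b)         ≈⟨ +-congʳ (-‿inverseʳ 1#) ⟨
      1# - 1# + (cast a - cast b)    ≈⟨ interchange _ _ _ _ ⟩
      1# + cast a + (- 1# - cast b)  ≈⟨ +-congˡ (⁻¹-∙-comm _ _) ⟩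
      1# + cast a - (1# + cast b)    ∎

    +-homo′ : ∀ x y → diff (x D.+ y) ≈ diff x + diff y
    +-homo′ (a , b) (c , d) = begin
      diff (cancel (a ℕ.+ c , b ℕ.+ d))        ≈⟨ diff-cancel (a ℕ.+ c , b ℕ.+ d) ⟩
      cast (a ℕ.+ c) - cast (b ℕ.+ d)          ≈⟨ +-cong (×-homo-+ 1# a c) (-‿cong (×-homo-+ 1# b d)) ⟩
      cast a + cast c - (cast b + cast d)      ≈⟨ +-congˡ (⁻¹-∙-comm _ _) ⟨
      cast a + cast c + (- cast b - cast d)    ≈⟨ interchange _ _ _ _ ⟩
      cast a - cast b + (cast c - cast d)      ∎

    product : ∀ a b c d → (a - b) * (c - d) ≈ (a * c + b * d) - (a * d + b * c)
    product a b c d = begin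
      (a - b) * (c - d)                                ≈⟨ distribʳ _ _ _ ⟩
      a * (c - d) + - b * (c - d)                      ≈⟨ +-cong (distribˡ _ _ _) (distribˡ _ _ _) ⟩
      (a * c + a * - d) + (- b * c + - b * - d)        ≈⟨ +-congˡ (+-comm _ _) ⟩
      (a * c + a * - d) + (- b * - d + - b * c)        ≈⟨ interchange _ _ _ _ ⟩
      (a * c + - b * - d) + (a * - d + - b * c)        ≈⟨ +-cong (+-congˡ bd) (+-cong (sym (-‿distribʳ-* a d)) (sym (-‿distribˡ-* b c))) ⟩
      (a * c + b * d) + (- (a * d) - b * c)            ≈⟨ +-congˡ (⁻¹-∙-comm _ _) ⟩
      (a * c + b * d) - (a * d + b * c)                ∎
      where
      bd : - b * - d ≈ b * d
      bd = trans (sym (-‿distribˡ-* b (- d))) (trans (-‿cong (sym (-‿distribʳ-* b d))) (-‿involutive _))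

    *-homo′ : ∀ x y → diff (x D.* y) ≈ diff x * diff y
    *-homo′ (a , b) (c , d) = begin
      diff ((a , b) D.* (c , d))
        ≈⟨ diff-cancel (a ℕ.* c ℕ.+ b ℕ.* d , a ℕ.* d ℕ.+ b ℕ.* c) ⟩
      cast (a ℕ.* c ℕ.+ b ℕ.* d) - cast (a ℕ.* d ℕ.+ b ℕ.* c)
        ≈⟨ +-cong (cast-homo a c b d) (-‿cong (cast-homo a d b c)) ⟩
      (cast a * cast c + cast b * cast d) - (cast a * cast d + cast b * cast c)
        ≈⟨ product _ _ _ _ ⟨
      (cast a - cast b) * (cast c - cast d) ∎
      where
      cast-homo : ∀ a c b d → cast (a ℕ.* c ℕ.+ b ℕ.* d) ≈ cast a * cast c + cast b * cast d
      cast-homo a c b d = trans (×-homo-+ 1# (a ℕ.* c) (b ℕ.* d)) (+-cong (×1-homo-* a c) (×1-homo-* b d))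

    -‿homo′ : ∀ x → diff (D.- x) ≈ - diff x
    -‿homo′ (a , b) = begin
      cast b - cast a        ≈⟨ +-comm _ _ ⟩
      - cast a + cast b      ≈⟨ +-congˡ (-‿involutive _) ⟨
      - cast a - (- cast b)  ≈⟨ ⁻¹-∙-comm _ _ ⟩
      - (cast a - cast b)    ∎

    0-homo : 0# - 0# ≈ 0#
    0-homo = -‿inverseʳ 0#

    1-homo : 1# + 0# - 0# ≈ 1#
    1-homo = trans (+-cong (+-identityʳ _) -0#≈0#) (+-identityʳ _)

    -- Kept equal to 0# and 1# on the nose, so that con (0 , 0) and con (1 , 0) can be used in goals.
    value : D.Carrier → Carrier
    value (0 , 0) = 0#
    value (1 , 0) = 1#
    value x       = diff x

    value≈diff : ∀ x → value x ≈ diff x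
    value≈diff (zero , zero)          = sym 0-homo
    value≈diff (zero , suc _)         = refl
    value≈diff (suc zero , zero)      = sym 1-homo
    value≈diff (suc zero , suc _)     = refl
    value≈diff (suc (suc _) , zero)   = refl
    value≈diff (suc (suc _) , suc _)  = refl

    +-homo : ∀ x y → value (x D.+ y) ≈ value x + value y
    +-homo x y = trans (value≈diff (x D.+ y))
      (trans (+-homo′ x y) (sym (+-cong (value≈diff x) (value≈diff y))))

    *-homo : ∀ x y → value (x D.* y) ≈ value x * value y
    *-homo x y = trans (value≈diff (x D.* y))
      (trans (*-homo′ x y) (sym (*-cong (value≈diff x) (value≈diff y))))

    -‿homo : ∀ x → value (D.- x) ≈ - value x
    -‿homo x = trans (value≈diff (D.- x)) (trans (-‿homo′ x) (-‿cong (sym (value≈diff x))))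

    morphism : differences -Raw-AlmostCommutative⟶ fromCommutativeRing R
    morphism = record
      { ⟦_⟧ = value ; +-homo = +-homo ; *-homo = *-homo
      ; -‿homo = -‿homo ; 0-homo = refl ; 1-homo = refl }

    same? : ∀ x y → Maybe (value x ≈ value y)
    same? (a , b) (c , d) with a ℕ.≟ c | b ℕ.≟ d
    ... | yes ≡.refl | yes ≡.refl = just refl
    ... | _          | _          = nothing

  open import Algebra.Solver.Ring differences (fromCommutativeRing R) morphism same? public
    using (solve; _:=_; _:+_; _:*_; _:-_; :-_; con)

-- The Frobenius map in prime characteristic

module Frobenius (R : CommutativeRing 0ℓ 0ℓ) where
  open CommutativeRing R hiding (zero)
  open import Algebra.Properties.Semiring.Mult semiring using (×-assoc-*; ×-assocˡ; ×-congʳ; ×-cong; ×-homo-1) renaming (_×_ to _·_)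
  open import Algebra.Properties.CommutativeSemiring.Exp commutativeSemiring using (_^_; ^-congˡ; ^-congʳ)
  open import Algebra.Properties.CommutativeSemiring.Binomial commutativeSemiring using (theorem; binomialTerm)
  open import Algebra.Properties.Semiring.Sum semiring using (sum; sum-cong-≋; sum-init-last; sum-replicate-zero)
  open import Data.Fin.Properties using (toℕ-fromℕ; toℕ-inject₁; toℕ<n)
  open import Data.Fin using (inject₁; fromℕ) renaming (suc to fsuc; zero to fzero)
  open IntegralSolver R
  open BinomialCoefficients
  open import Relation.Binary.Reasoning.Setoid setoid

  multiple·≈0 : ∀ {p n} → p · 1# ≈ 0# → p ∣ n → ∀ x → n · x ≈ 0#
  multiple·≈0 {p} p≈0 (divides k ≡.refl) x = begin
    (k ℕ.* p) · x     ≈⟨ ×-assocˡ x k p ⟨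
    k · (p · x)       ≈⟨ ×-congʳ k (×-congʳ p (*-identityˡ x)) ⟨
    k · (p · (1# * x)) ≈⟨ ×-congʳ k (×-assoc-* p 1# x) ⟨
    k · (p · 1# * x)  ≈⟨ ×-congʳ k (*-congʳ p≈0) ⟩
    k · (0# * x)      ≈⟨ ×-congʳ k (zeroˡ x) ⟩
    k · 0#            ≈⟨ k·0 k ⟩
    0#                ∎
    where
    k·0 : ∀ k → k · 0# ≈ 0#
    k·0 zero    = refl
    k·0 (suc k) = trans (+-identityˡ _) (k·0 k)

  module _ {p} (pr : Prime p) (p≈0 : p · 1# ≈ 0#) where

    frobenius-+ : ∀ x y → (x + y) ^ p ≈ x ^ p + y ^ p
    frobenius-+ x y = go p pr p≈0
      where
      -- The exponent is quantified anew in order to expose it as a successor; the sum then splits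
      -- into two extreme terms and a middle part divisible by p.
      go : ∀ p → Prime p → p · 1# ≈ 0# → (x + y) ^ p ≈ x ^ p + y ^ p
      go zero    pr _ = ⊥-elim (ℕ.≢-nonZero⁻¹ 0 {{prime⇒nonZero pr}} ≡.refl)
      go (suc n) pr p≈0 = begin
        (x + y) ^ suc n                                        ≈⟨ theorem (suc n) x y ⟩
        t fzero + sum (t ∘ fsuc)                                ≈⟨ +-congˡ (sum-init-last (t ∘ fsuc)) ⟩
        t fzero + (sum (λ i → t (fsuc (inject₁ i))) + t (fsuc (fromℕ n)))
          ≈⟨ +-cong first (+-cong middle (final (toℕ (fromℕ n)) (toℕ-fromℕ n))) ⟩
        y ^ suc n + (0# + x ^ suc n)                           ≈⟨ solve 2 (λ a b → b :+ (con (0 , 0) :+ a) := a :+ b) refl (x ^ suc n) (y ^ suc n) ⟩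
        x ^ suc n + y ^ suc n                                  ∎
        where
        t = binomialTerm x y (suc n)

        first : t fzero ≈ y ^ suc n
        first = trans (×-homo-1 _) (*-identityˡ _)

        term-zero : ∀ i → t (fsuc (inject₁ i)) ≈ 0#
        term-zero i = multiple·≈0 p≈0 (prime∣C pr (≡.subst (_< n) (≡.sym (toℕ-inject₁ i)) (toℕ<n i))) _

        middle : sum (λ i → t (fsuc (inject₁ i))) ≈ 0#
        middle = trans (sum-cong-≋ term-zero) (sum-replicate-zero n)

        -- The last index is `toℕ (fromℕ n)`, equal to n only propositionally, so it is abstracted
        -- to j.
        final : ∀ j → j ≡ n → (suc n C suc j) · (x ^ suc j * y ^ (n ℕ.∸ j)) ≈ x ^ suc n
        final j ≡.refl = begin
          (suc j C suc j) · (x ^ suc j * y ^ (j ℕ.∸ j))  ≈⟨ ×-cong (nCn≡1 (suc j)) (*-congˡ (^-congʳ y (ℕₚ.n∸n≡0 j))) ⟩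
          1 · (x ^ suc j * 1#)                           ≈⟨ ×-homo-1 _ ⟩
          x ^ suc j * 1#                                 ≈⟨ *-identityʳ _ ⟩
          x ^ suc j                                      ∎

    -- Additivity is applied to (x - 1) + 1, which avoids the sign (-1)^p and with it the parity of
    -- p.
    frobenius-‿1 : ∀ x → (x - 1#) ^ p ≈ x ^ p - 1#
    frobenius-‿1 x = begin
      (x - 1#) ^ p                    ≈⟨ solve 1 (λ a → a := a :+ con (1 , 0) :- con (1 , 0)) refl _ ⟩
      (x - 1#) ^ p + 1# - 1#          ≈⟨ +-congʳ (+-congˡ (1^ p)) ⟨
      (x - 1#) ^ p + 1# ^ p - 1#      ≈⟨ +-congʳ (frobenius-+ (x - 1#) 1#) ⟨
      (x - 1# + 1#) ^ p - 1#          ≈⟨ +-congʳ (^-congˡ p (solve 1 (λ a → a :- con (1 , 0) :+ con (1 , 0) := a) refl x)) ⟩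
      x ^ p - 1#                      ∎
      where
      1^ : ∀ n → 1# ^ n ≈ 1#
      1^ zero    = refl
      1^ (suc n) = trans (*-identityˡ _) (1^ n)

-- Polynomials as operators on sequences

-- A polynomial is its list of coefficients, constant term first; it acts on sequences with x as the shift.
module Polynomials (R : CommutativeRing 0ℓ 0ℓ) where
  open CommutativeRing R hiding (zero)
  open IntegralSolver R
  open import Algebra.Properties.Semiring.Exp semiring using (_^_)
  open import Data.List using (length)
  open import Data.Vec using (replicate; zipWith; toList)
  open import Data.Vec.Relation.Unary.All using (All; []; _∷_)
  open import Relation.Binary.Reasoning.Setoid setoid

  Poly : Set
  Poly = List Carrier

  Seq : Set
  Seq = ℕ → Carrier

  act : Poly → Seq → Seq
  act []      s n = 0#
  act (c ∷ g) s n = c * s n + act g s (suc n)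

  act-cong : ∀ g {s t} → (∀ n → s n ≈ t n) → ∀ n → act g s n ≈ act g t n
  act-cong []      e n = refl
  act-cong (c ∷ g) e n = +-cong (*-congˡ (e n)) (act-cong g e (suc n))

  act-+ : ∀ g s t n → act g (λ n → s n + t n) n ≈ act g s n + act g t n
  act-+ []      s t n = sym (+-identityˡ _)
  act-+ (c ∷ g) s t n = trans (+-congˡ (act-+ g s t (suc n)))
    (solve 5 (λ c a b x y → c :* (a :+ b) :+ (x :+ y) := (c :* a :+ x) :+ (c :* b :+ y)) refl c (s n) (t n) _ _)

  act-* : ∀ g a s n → act g (λ n → a * s n) n ≈ a * act g s n
  act-* []      a s n = sym (zeroʳ _)
  act-* (c ∷ g) a s n = trans (+-congˡ (act-* g a s (suc n)))
    (solve 4 (λ c a s x → c :* (a :* s) :+ a :* x := a :* (c :* s :+ x)) refl c a (s n) _)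

  act-shift : ∀ g s k n → act g (λ n → s (n ℕ.+ k)) n ≡ act g s (n ℕ.+ k)
  act-shift []      s k n = ≡.refl
  act-shift (c ∷ g) s k n = ≡.cong (c * s (n ℕ.+ k) +_) (act-shift g s k (suc n))

  act-suc : ∀ g s n → act g (s ∘ suc) n ≡ act g s (suc n)
  act-suc []      s n = ≡.refl
  act-suc (c ∷ g) s n = ≡.cong (c * s (suc n) +_) (act-suc g s (suc n))

  act-zero : ∀ g {s} → (∀ n → s n ≈ 0#) → ∀ n → act g s n ≈ 0#
  act-zero []      e n = refl
  act-zero (c ∷ g) e n = trans (+-cong (trans (*-congˡ (e n)) (zeroʳ c)) (act-zero g e (suc n))) (+-identityˡ 0#)

  -- Every operator is a linear combination of shifts, and `act h` is linear and commutes with the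
  -- shift. This is the source of commutativity in all the polynomial rings below.
  act-comm : ∀ g h s n → act g (act h s) n ≈ act h (act g s) n
  act-comm []      h s n = sym (act-zero h (λ _ → refl) n)
  act-comm (c ∷ g) h s n = begin
    c * act h s n + act g (act h s) (suc n)             ≈⟨ +-cong (sym (act-* h c s n)) (act-comm g h s (suc n)) ⟩
    act h (λ n → c * s n) n + act h (act g s) (suc n)   ≡⟨ ≡.cong (act h (λ n → c * s n) n +_) (act-suc h (act g s) n) ⟨
    act h (λ n → c * s n) n + act h (act g s ∘ suc) n   ≈⟨ act-+ h (λ n → c * s n) (act g s ∘ suc) n ⟨
    act h (λ n → c * s n + act g s (suc n)) n           ∎

  infixl 6 _⊕_
  infixl 7 _⊛_ _⊗_

  _⊕_ : Poly → Poly → Poly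
  []      ⊕ h       = h
  (c ∷ g) ⊕ []      = c ∷ g
  (c ∷ g) ⊕ (d ∷ h) = c + d ∷ (g ⊕ h)

  _⊛_ : Carrier → Poly → Poly
  a ⊛ []      = []
  a ⊛ (c ∷ g) = a * c ∷ (a ⊛ g)

  _⊗_ : Poly → Poly → Poly
  []      ⊗ h = []
  (c ∷ g) ⊗ h = (c ⊛ h) ⊕ (0# ∷ (g ⊗ h))

  act-⊕ : ∀ g h s n → act (g ⊕ h) s n ≈ act g s n + act h s n
  act-⊕ []      h       s n = sym (+-identityˡ _)
  act-⊕ (c ∷ g) []      s n = sym (+-identityʳ _)
  act-⊕ (c ∷ g) (d ∷ h) s n = trans (+-congˡ (act-⊕ g h s (suc n)))
    (solve 5 (λ c d s a b → (c :+ d) :* s :+ (a :+ b) := c :* s :+ a :+ (d :* s :+ b)) refl c d (s n) _ _)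

  act-⊛ : ∀ a g s n → act (a ⊛ g) s n ≈ a * act g s n
  act-⊛ a []      s n = sym (zeroʳ a)
  act-⊛ a (c ∷ g) s n = trans (+-congˡ (act-⊛ a g s (suc n)))
    (solve 4 (λ a c s x → a :* c :* s :+ a :* x := a :* (c :* s :+ x)) refl a c (s n) _)

  act-⊗ : ∀ g h s n → act (g ⊗ h) s n ≈ act g (act h s) n
  act-⊗ []      h s n = refl
  act-⊗ (c ∷ g) h s n = begin
    act ((c ⊛ h) ⊕ (0# ∷ (g ⊗ h))) s n              ≈⟨ act-⊕ (c ⊛ h) _ s n ⟩
    act (c ⊛ h) s n + (0# * s n + act (g ⊗ h) s (suc n))
      ≈⟨ +-cong (act-⊛ c h s n) (trans (+-cong (zeroˡ _) (act-⊗ g h s (suc n))) (+-identityˡ _)) ⟩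
    c * act h s n + act g (act h s) (suc n)         ∎

  -- The leading 1 is left implicit, so that the length of the vector is the degree and monicity
  -- needs no proof. The same vector read by `poly` has degree below j, which is the shape of a
  -- remainder.
  mon : ∀ {j} → Vec Carrier j → Poly
  mon []      = 1# ∷ []
  mon (c ∷ v) = c ∷ mon v

  poly : ∀ {j} → Vec Carrier j → Poly
  poly = toList

  act-mon : ∀ {j} (v : Vec Carrier j) s n → act (mon v) s n ≈ act (poly v) s n + s (n ℕ.+ j)
  act-mon []      s n = trans (+-comm _ _) (+-congˡ (trans (*-identityˡ _) (reflexive (≡.cong s (≡.sym (ℕₚ.+-identityʳ n))))))
  act-mon {suc j} (c ∷ v) s n = begin
    c * s n + act (mon v) s (suc n)                           ≈⟨ +-congˡ (act-mon v s (suc n)) ⟩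
    c * s n + (act (poly v) s (suc n) + s (suc n ℕ.+ j))      ≈⟨ +-assoc _ _ _ ⟨
    c * s n + act (poly v) s (suc n) + s (suc n ℕ.+ j)        ≡⟨ ≡.cong (λ k → c * s n + act (poly v) s (suc n) + s k) (ℕₚ.+-suc n j) ⟨
    c * s n + act (poly v) s (suc n) + s (n ℕ.+ suc j)        ∎

  subtract : ∀ {i} → Vec Carrier i → Carrier → Vec Carrier i → Vec Carrier i
  subtract r o h = zipWith (λ a b → a - o * b) r h

  act-subtract : ∀ {i} (r : Vec Carrier i) o h s n →
                 act (poly (subtract r o h)) s n ≈ act (poly r) s n - o * act (poly h) s n
  act-subtract []      o []      s n = solve 1 (λ o → con (0 , 0) := con (0 , 0) :- o :* con (0 , 0)) refl o
  act-subtract (a ∷ r) o (b ∷ h) s n = trans (+-congˡ (act-subtract r o h s (suc n)))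
    (solve 6 (λ a o b s x y → (a :- o :* b) :* s :+ (x :- o :* y) := a :* s :+ x :- o :* (b :* s :+ y)) refl a o b (s n) _ _)

  -- (r′ , o) with c + x r = r′ + o xⁱ
  shiftIn : ∀ {i} → Carrier → Vec Carrier i → Vec Carrier i × Carrier
  shiftIn c []      = [] , c
  shiftIn c (a ∷ r) = c ∷ proj₁ (shiftIn a r) , proj₂ (shiftIn a r)

  act-shiftIn : ∀ {i} c (r : Vec Carrier i) s n →
    c * s n + act (poly r) s (suc n) ≈ act (poly (proj₁ (shiftIn c r))) s n + proj₂ (shiftIn c r) * s (n ℕ.+ i)
  act-shiftIn c []      s n = trans (+-comm _ _) (+-congˡ (*-congˡ (reflexive (≡.cong s (≡.sym (ℕₚ.+-identityʳ n))))))
  act-shiftIn {suc i} c (a ∷ r) s n = begin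
    c * s n + (a * s (suc n) + act (poly r) s (suc (suc n)))  ≈⟨ +-congˡ (act-shiftIn a r s (suc n)) ⟩
    c * s n + (X + o * s (suc n ℕ.+ i))                       ≈⟨ +-assoc _ _ _ ⟨
    c * s n + X + o * s (suc n ℕ.+ i)                         ≡⟨ ≡.cong (λ k → c * s n + X + o * s k) (ℕₚ.+-suc n i) ⟨
    c * s n + X + o * s (n ℕ.+ suc i)                         ∎
    where
    X = act (poly (proj₁ (shiftIn a r))) s (suc n)
    o = proj₂ (shiftIn a r)

  -- The remainder of c + x r modulo the monic h: the overflow o xⁱ of `shiftIn` is removed by
  -- subtracting o times h.
  reduce : ∀ {i} → Vec Carrier i → Carrier → Vec Carrier i → Vec Carrier i
  reduce h c r = subtract (proj₁ (shiftIn c r)) (proj₂ (shiftIn c r)) h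

  act-reduce : ∀ {i} (h : Vec Carrier i) c r s n →
    c * s n + act (poly r) s (suc n) ≈ proj₂ (shiftIn c r) * act (mon h) s n + act (poly (reduce h c r)) s n
  act-reduce {i} h c r s n = begin
    c * s n + act (poly r) s (suc n)              ≈⟨ act-shiftIn c r s n ⟩
    X + o * s (n ℕ.+ i)
      ≈⟨ solve 4 (λ X o t H → X :+ o :* t := o :* (H :+ t) :+ (X :- o :* H)) refl X o (s (n ℕ.+ i)) H ⟩
    o * (H + s (n ℕ.+ i)) + (X - o * H)           ≈⟨ +-cong (*-congˡ (act-mon h s n)) (act-subtract (proj₁ (shiftIn c r)) o h s n) ⟨
    o * act (mon h) s n + act (poly (reduce h c r)) s n ∎
    where
    X = act (poly (proj₁ (shiftIn c r))) s n
    o = proj₂ (shiftIn c r)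
    H = act (poly h) s n

  -- Division in Horner form: if g = Q h + r, then c + x g = x Q h + (c + x r), and the bracket
  -- needs a single reduction.
  divMod : ∀ {i} → Poly → Vec Carrier i → Poly × Vec Carrier i
  divMod []      h = [] , replicate _ 0#
  divMod (c ∷ g) h = proj₂ (shiftIn c r) ∷ Q , reduce h c r
    where
    Q = proj₁ (divMod g h)
    r = proj₂ (divMod g h)

  act-replicate-0 : ∀ i s n → act (poly (replicate i 0#)) s n ≈ 0#
  act-replicate-0 zero    s n = refl
  act-replicate-0 (suc i) s n = trans (+-cong (zeroˡ _) (act-replicate-0 i s (suc n))) (+-identityˡ _)

  act-divMod : ∀ {i} g (h : Vec Carrier i) s n →
    act g s n ≈ act (proj₁ (divMod g h)) (act (mon h) s) n + act (poly (proj₂ (divMod g h))) s n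
  act-divMod {i} []      h s n = sym (trans (+-identityˡ _) (act-replicate-0 i s n))
  act-divMod (c ∷ g) h s n = begin
    c * s n + act g s (suc n)                       ≈⟨ +-congˡ (act-divMod g h s (suc n)) ⟩
    c * s n + (Q + r)                               ≈⟨ solve 3 (λ a b c → a :+ (b :+ c) := a :+ c :+ b) refl _ Q r ⟩
    c * s n + r + Q                                 ≈⟨ +-congʳ (act-reduce h c (proj₂ (divMod g h)) s n) ⟩
    o * act (mon h) s n + r′ + Q                    ≈⟨ solve 3 (λ a b c → a :+ b :+ c := a :+ c :+ b) refl _ r′ Q ⟩
    o * act (mon h) s n + Q + r′                    ∎
    where
    Q = act (proj₁ (divMod g h)) (act (mon h) s) (suc n)
    r = act (poly (proj₂ (divMod g h))) s (suc n)
    o = proj₂ (shiftIn c (proj₂ (divMod g h)))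
    r′ = act (poly (reduce h c (proj₂ (divMod g h)))) s n

  -- A separate version in which the quotient is again monic, with its degree in the type. The
  -- recursion stops at equal degrees, where the quotient is 1.
  monicDivMod : ∀ m {i} → Vec Carrier (m ℕ.+ i) → Vec Carrier i → Vec Carrier m × Vec Carrier i
  monicDivMod zero    v       h = [] , subtract v 1# h
  monicDivMod (suc m) (c ∷ v) h = proj₂ (shiftIn c r) ∷ Q , reduce h c r
    where
    Q = proj₁ (monicDivMod m v h)
    r = proj₂ (monicDivMod m v h)

  act-monicDivMod : ∀ m {i} (v : Vec Carrier (m ℕ.+ i)) (h : Vec Carrier i) s n →
    act (mon v) s n ≈ act (mon (proj₁ (monicDivMod m v h))) (act (mon h) s) n
                      + act (poly (proj₂ (monicDivMod m v h))) s n
  act-monicDivMod zero {i} v h s n = begin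
    act (mon v) s n                 ≈⟨ act-mon v s n ⟩
    V + s (n ℕ.+ i)
      ≈⟨ solve 3 (λ V t H → V :+ t := con (1 , 0) :* (H :+ t) :+ con (0 , 0) :+ (V :- con (1 , 0) :* H)) refl V (s (n ℕ.+ i)) H ⟩
    1# * (H + s (n ℕ.+ i)) + 0# + (V - 1# * H)
      ≈⟨ +-cong (+-congʳ (*-congˡ (act-mon h s n))) (act-subtract v 1# h s n) ⟨
    1# * act (mon h) s n + 0# + act (poly (subtract v 1# h)) s n ∎
    where
    V = act (poly v) s n
    H = act (poly h) s n
  act-monicDivMod (suc m) (c ∷ v) h s n = begin
    c * s n + act (mon v) s (suc n)                 ≈⟨ +-congˡ (act-monicDivMod m v h s (suc n)) ⟩
    c * s n + (Q + r)                               ≈⟨ solve 3 (λ a b c → a :+ (b :+ c) := a :+ c :+ b) refl _ Q r ⟩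
    c * s n + r + Q                                 ≈⟨ +-congʳ (act-reduce h c (proj₂ (monicDivMod m v h)) s n) ⟩
    o * act (mon h) s n + r′ + Q                    ≈⟨ solve 3 (λ a b c → a :+ b :+ c := a :+ c :+ b) refl _ r′ Q ⟩
    o * act (mon h) s n + Q + r′                    ∎
    where
    Q = act (mon (proj₁ (monicDivMod m v h))) (act (mon h) s) (suc n)
    r = act (poly (proj₂ (monicDivMod m v h))) s (suc n)
    o = proj₂ (shiftIn c (proj₂ (monicDivMod m v h)))
    r′ = act (poly (reduce h c (proj₂ (monicDivMod m v h)))) s n

  addLow : ∀ {n} → Vec Carrier n → Poly → Vec Carrier n
  addLow []      l       = []
  addLow (a ∷ v) []      = a ∷ v
  addLow (a ∷ v) (b ∷ l) = a + b ∷ addLow v l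

  act-addLow : ∀ {j} (v : Vec Carrier j) l → length l ≤ j → ∀ s n →
               act (mon (addLow v l)) s n ≈ act (mon v) s n + act l s n
  act-addLow []      []      _ s n = sym (+-identityʳ _)
  act-addLow (a ∷ v) []      _ s n = sym (+-identityʳ _)
  act-addLow (a ∷ v) (b ∷ l) (s≤s le) s n = trans (+-congˡ (act-addLow v l le s (suc n)))
    (solve 5 (λ a b s x y → (a :+ b) :* s :+ (x :+ y) := a :* s :+ x :+ (b :* s :+ y)) refl a b (s n) _ _)

  infixl 7 _⊠_

  -- (c + x v) w = x (v w) + c w, and c w has at most as many coefficients as the product has below
  -- its leading one, so `addLow` loses nothing.
  _⊠_ : ∀ {m i} → Vec Carrier m → Vec Carrier i → Vec Carrier (m ℕ.+ i)
  []      ⊠ w = w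
  (c ∷ v) ⊠ w = addLow (0# ∷ v ⊠ w) (c ⊛ mon w)

  length-⊛-mon : ∀ {i} c (w : Vec Carrier i) → length (c ⊛ mon w) ≡ suc i
  length-⊛-mon c []      = ≡.refl
  length-⊛-mon c (a ∷ w) = ≡.cong suc (length-⊛-mon c w)

  act-⊠ : ∀ {m i} (v : Vec Carrier m) (w : Vec Carrier i) s n → act (mon (v ⊠ w)) s n ≈ act (mon v) (act (mon w) s) n
  act-⊠ []      w s n = sym (trans (+-identityʳ _) (*-identityˡ _))
  act-⊠ {suc m} {i} (c ∷ v) w s n = begin
    act (mon (addLow (0# ∷ v ⊠ w) (c ⊛ mon w))) s n
      ≈⟨ act-addLow (0# ∷ v ⊠ w) (c ⊛ mon w) (ℕₚ.≤-trans (ℕₚ.≤-reflexive (length-⊛-mon c w)) (s≤s (ℕₚ.m≤n+m i m))) s n ⟩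
    0# * s n + act (mon (v ⊠ w)) s (suc n) + act (c ⊛ mon w) s n
      ≈⟨ +-cong (+-congˡ (act-⊠ v w s (suc n))) (act-⊛ c (mon w) s n) ⟩
    0# * s n + A + c * act (mon w) s n
      ≈⟨ solve 3 (λ s A b → con (0 , 0) :* s :+ A :+ b := b :+ A) refl (s n) A _ ⟩
    c * act (mon w) s n + A ∎
    where A = act (mon v) (act (mon w) s) (suc n)

  eval : Poly → Carrier → Carrier
  eval []      x = 0#
  eval (c ∷ g) x = c + x * eval g x

  -- Geometric sequences are eigenvectors of the shift. Evaluation thereby becomes an instance of
  -- the action, and operator identities can be evaluated without looking at coefficients.
  act-geometric : ∀ g x n → act g (x ^_) n ≈ eval g x * x ^ n
  act-geometric []      x n = sym (zeroˡ _)
  act-geometric (c ∷ g) x n = trans (+-congˡ (act-geometric g x (suc n)))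
    (solve 4 (λ c x e p → c :* p :+ e :* (x :* p) := (c :+ x :* e) :* p) refl c x (eval g x) (x ^ n))

  infix 4 _≅_∘_
  _≅_∘_ : Poly → Poly → Poly → Set
  f ≅ g ∘ h = ∀ s n → act f s n ≈ act g (act h s) n

  eval-∘ : ∀ f g h → f ≅ g ∘ h → ∀ x → eval f x ≈ eval g x * eval h x
  eval-∘ f g h e x = begin
    eval f x                             ≈⟨ *-identityʳ _ ⟨
    eval f x * 1#                        ≈⟨ act-geometric f x 0 ⟨
    act f (x ^_) 0                       ≈⟨ e (x ^_) 0 ⟩
    act g (act h (x ^_)) 0               ≈⟨ act-cong g (act-geometric h x) 0 ⟩
    act g (λ n → eval h x * x ^ n) 0     ≈⟨ act-* g (eval h x) (x ^_) 0 ⟩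
    eval h x * act g (x ^_) 0            ≈⟨ *-congˡ (act-geometric g x 0) ⟩
    eval h x * (eval g x * 1#)           ≈⟨ solve 2 (λ a b → a :* (b :* con (1 , 0)) := b :* a) refl _ _ ⟩
    eval g x * eval h x                  ∎

  IsZero : ∀ {n} → Vec Carrier n → Set
  IsZero = All (_≈ 0#)

  act-IsZero : ∀ {i} {r : Vec Carrier i} → IsZero r → ∀ s n → act (poly r) s n ≈ 0#
  act-IsZero []       s n = refl
  act-IsZero (e ∷ es) s n = trans (+-cong (trans (*-congʳ e) (zeroˡ _)) (act-IsZero es s (suc n))) (+-identityˡ _)

  private
    prepend0 : Seq → Seq
    prepend0 s zero    = 0#
    prepend0 s (suc n) = s n

  -- Test sequences that begin with 0 show that the tail kills everything as well; a test sequence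
  -- that begins with 1 then isolates the constant term.
  annihilates-all⇒IsZero : ∀ {i} (r : Vec Carrier i) → (∀ s → act (poly r) s 0 ≈ 0#) → IsZero r
  annihilates-all⇒IsZero []      e = []
  annihilates-all⇒IsZero (c ∷ r) e = c≈0 ∷ annihilates-all⇒IsZero r tail≈0
    where
    tail≈0 : ∀ s → act (poly r) s 0 ≈ 0#
    tail≈0 s = begin
      act (poly r) s 0                           ≡⟨ act-suc (poly r) (prepend0 s) 0 ⟩
      act (poly r) (prepend0 s) 1                ≈⟨ solve 2 (λ c x → x := c :* con (0 , 0) :+ x) refl c _ ⟩
      c * 0# + act (poly r) (prepend0 s) 1       ≈⟨ e (prepend0 s) ⟩
      0#                                         ∎

    ones : Seq
    ones _ = 1#

    c≈0 : c ≈ 0#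
    c≈0 = begin
      c                              ≈⟨ solve 1 (λ c → c := c :* con (1 , 0) :+ con (0 , 0)) refl c ⟩
      c * 1# + 0#                    ≈⟨ +-congˡ (tail≈0 ones) ⟨
      c * 1# + act (poly r) ones 0   ≡⟨ ≡.cong (c * 1# +_) (act-suc (poly r) ones 0) ⟩
      c * 1# + act (poly r) ones 1   ≈⟨ e ones ⟩
      0#                             ∎

  linear : Carrier → Vec Carrier 1
  linear r = - r ∷ []

  eval-linear : ∀ r x → eval (mon (linear r)) x ≈ x - r
  eval-linear r x = solve 2 (λ r x → :- r :+ x :* (con (1 , 0) :+ x :* con (0 , 0)) := x :- r) refl r x

-- Finite fields: Fermat, roots, and elements of prescribed order

module FieldProperties (F : FiniteField) where
  open FiniteField F hiding (zero)
  open IntegralSolver commRing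
  open Polynomials commRing
  open Arithmetic
  open import Algebra.Properties.CommutativeSemiring.Exp commutativeSemiring public
    using (_^_; ^-congˡ; ^-congʳ; ^-homo-*; ^-assocʳ; ^-distrib-*)
  open import Algebra.Properties.Semiring.Mult semiring using () renaming (_×_ to _·_)
  open import Algebra.Properties.Group +-group using (x∙y⁻¹≈ε⇒x≈y)
  open import Data.Fin using (zero; suc; inject≤; punchIn)
  open import Data.Nat.GCD using (gcd; gcd-GCD; gcd[m,n]∣m; gcd[m,n]∣n; module Bézout)
  open import Data.Nat.Induction using (<-rec)
  open import Data.Vec using (replicate; head)
  open import Relation.Nullary.Decidable using (map′; ¬?; _×-dec_; decidable-stable)
  open import Relation.Binary.Reasoning.Setoid setoid

  element : Fin size → Carrier
  element = Inverse.to enumeration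

  index : Carrier → Fin size
  index = Inverse.from enumeration

  element-index : ∀ x → element (index x) ≈ x
  element-index = Inverse.strictlyInverseˡ enumeration

  index-element : ∀ i → index (element i) ≡ i
  index-element = Inverse.strictlyInverseʳ enumeration

  index-cong : ∀ {x y} → x ≈ y → index x ≡ index y
  index-cong = Inverse.from-cong enumeration

  index-injective : ∀ {x y} → index x ≡ index y → x ≈ y
  index-injective {x} {y} eq = begin
    x                  ≈⟨ element-index x ⟨
    element (index x)  ≡⟨ ≡.cong element eq ⟩
    element (index y)  ≈⟨ element-index y ⟩
    y                  ∎

  infix 4 _≟_

  _≟_ : ∀ x y → Dec (x ≈ y)
  x ≟ y = map′ index-injective index-cong (index x Finₚ.≟ index y)

  x-y≈0⇒x≈y : ∀ {x y} → x - y ≈ 0# → x ≈ y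
  x-y≈0⇒x≈y = x∙y⁻¹≈ε⇒x≈y _ _

  *-cancelˡ : ∀ {x y z} → ¬ x ≈ 0# → x * y ≈ x * z → y ≈ z
  *-cancelˡ {x} {y} {z} x≉0 eq = begin
    y                ≈⟨ expand y ⟨
    x⁻¹ * (x * y)    ≈⟨ *-congˡ eq ⟩
    x⁻¹ * (x * z)    ≈⟨ expand z ⟩
    z                ∎
    where
    x⁻¹ = proj₁ (inverse x x≉0)
    expand : ∀ w → x⁻¹ * (x * w) ≈ w
    expand w = trans (sym (*-assoc _ _ _)) (trans (*-congʳ (trans (*-comm _ _) (proj₂ (inverse x x≉0)))) (*-identityˡ w))

  x*y≈0⇒y≈0 : ∀ {x y} → ¬ x ≈ 0# → x * y ≈ 0# → y ≈ 0#
  x*y≈0⇒y≈0 x≉0 eq = *-cancelˡ x≉0 (trans eq (sym (zeroʳ _)))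

  *-nonzero : ∀ {x y} → ¬ x ≈ 0# → ¬ y ≈ 0# → ¬ x * y ≈ 0#
  *-nonzero x≉0 y≉0 = y≉0 ∘ x*y≈0⇒y≈0 x≉0

  ^-nonzero : ∀ {x} → ¬ x ≈ 0# → ∀ n → ¬ x ^ n ≈ 0#
  ^-nonzero x≉0 zero    = 1≉0
  ^-nonzero x≉0 (suc n) = *-nonzero x≉0 (^-nonzero x≉0 n)

  1^n≈1 : ∀ n → 1# ^ n ≈ 1#
  1^n≈1 zero    = refl
  1^n≈1 (suc n) = trans (*-identityˡ _) (1^n≈1 n)

  size>1 : 1 < size
  size>1 = distinct (index 0#) (index 1#) (λ eq → 1≉0 (sym (index-injective eq)))
    where
    distinct : ∀ {n} (i j : Fin n) → i ≢ j → 1 < n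
    distinct {suc zero}    zero zero i≢j = ⊥-elim (i≢j ≡.refl)
    distinct {suc (suc n)} _    _    _   = s≤s (s≤s z≤n)

  private
    module ∏ where
      open import Algebra.Properties.CommutativeMonoid.Sum *-commutativeMonoid public

  -- ∏ x over x ≠ 0, written over all of the field with 0 replaced by 1, is unchanged under x ↦ u x.
  fermat : ∀ {u} → ¬ u ≈ 0# → u ^ (size ℕ.∸ 1) ≈ 1#
  fermat {u} u≉0 = trans (sym (∏-but-one (index 0#) g g-zero g-nonzero)) (*-cancelˡ ∏f≉0 (begin
    ∏.sum f * ∏.sum g                  ≈⟨ ∏.∑-distrib-+ f g ⟨
    ∏.sum (λ i → f i * g i)            ≈⟨ ∏.sum-cong-≋ f*g ⟩
    ∏.sum (λ i → f (scale i))          ≈⟨ ∏.sum-permute f π ⟨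
    ∏.sum f                            ≈⟨ *-identityʳ _ ⟨
    ∏.sum f * 1#                       ∎))
    where
    open import Data.Fin.Permutation using (Permutation; permutation)

    u⁻¹ = proj₁ (inverse u u≉0)

    unless0 : Carrier → Carrier → Carrier
    unless0 x y with x ≟ 0#
    ... | yes _ = 1#
    ... | no  _ = y

    f g : Fin size → Carrier
    f i = unless0 (element i) (element i)
    g i = unless0 (element i) u

    scale unscale : Fin size → Fin size
    scale i = index (u * element i)
    unscale i = index (u⁻¹ * element i)

    scale-unscale : ∀ a b → a * b ≈ 1# → ∀ i → index (a * element (index (b * element i))) ≡ i
    scale-unscale a b ab i = ≡.trans (index-cong (begin
      a * element (index (b * element i))  ≈⟨ *-congˡ (element-index _) ⟩
      a * (b * element i)                  ≈⟨ *-assoc _ _ _ ⟨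
      a * b * element i                    ≈⟨ *-congʳ ab ⟩
      1# * element i                       ≈⟨ *-identityˡ _ ⟩
      element i                            ∎)) (index-element i)

    uu⁻¹ : u * u⁻¹ ≈ 1#
    uu⁻¹ = proj₂ (inverse u u≉0)

    π : Permutation size size
    π = permutation scale unscale (scale-unscale u u⁻¹ uu⁻¹) (scale-unscale u⁻¹ u (trans (*-comm _ _) uu⁻¹))

    f*g : ∀ i → f i * g i ≈ f (scale i)
    f*g i with element i ≟ 0# | element (scale i) ≟ 0#
    ... | yes _   | yes _   = *-identityˡ _
    ... | yes x≈0 | no ux≉0 = ⊥-elim (ux≉0 (trans (element-index _) (trans (*-congˡ x≈0) (zeroʳ u))))
    ... | no x≉0  | yes ux≈0 = ⊥-elim (*-nonzero u≉0 x≉0 (trans (sym (element-index _)) ux≈0))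
    ... | no _    | no _    = trans (*-comm _ _) (sym (element-index _))

    g-zero : g (index 0#) ≈ 1#
    g-zero with element (index 0#) ≟ 0#
    ... | yes _ = refl
    ... | no ≉0 = ⊥-elim (≉0 (element-index 0#))

    g-nonzero : ∀ i → i ≢ index 0# → g i ≈ u
    g-nonzero i i≢ with element i ≟ 0#
    ... | yes ≈0 = ⊥-elim (i≢ (≡.trans (≡.sym (index-element i)) (index-cong ≈0)))
    ... | no _ = refl

    f≉0 : ∀ i → ¬ f i ≈ 0#
    f≉0 i with element i ≟ 0#
    ... | yes _ = 1≉0
    ... | no ≉0 = ≉0

    ∏≉0 : ∀ {n} (h : Fin n → Carrier) → (∀ i → ¬ h i ≈ 0#) → ¬ ∏.sum h ≈ 0#
    ∏≉0 {zero}  h h≉0 = 1≉0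
    ∏≉0 {suc n} h h≉0 = *-nonzero (h≉0 zero) (∏≉0 (h ∘ suc) (h≉0 ∘ suc))

    ∏f≉0 : ¬ ∏.sum f ≈ 0#
    ∏f≉0 = ∏≉0 f f≉0

    ∏-but-one : ∀ {n} (z : Fin n) (h : Fin n → Carrier) → h z ≈ 1# → (∀ i → i ≢ z → h i ≈ u) → ∏.sum h ≈ u ^ (n ℕ.∸ 1)
    ∏-but-one {suc n} z h hz hi = begin
      ∏.sum h                                   ≈⟨ ∏.sum-remove {i = z} h ⟩
      h z * ∏.sum (λ i → h (punchIn z i))       ≈⟨ *-cong hz (∏.sum-cong-≋ (λ i → hi (punchIn z i) (Finₚ.punchInᵢ≢i z i))) ⟩
      1# * ∏.sum {n} (λ _ → u)                  ≈⟨ *-identityˡ _ ⟩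
      ∏.sum {n} (λ _ → u)                       ≈⟨ ∏.sum-replicate n ⟩
      u ^ n                                     ∎

  mon-subst : ∀ {i j} (eq : i ≡ j) (v : Vec Carrier i) → mon (≡.subst (Vec Carrier) eq v) ≡ mon v
  mon-subst ≡.refl v = ≡.refl

  -- The remainder modulo x - r is a constant; testing on the sequence r^n, which x - r kills,
  -- identifies it with the value at r.
  divide-linear : ∀ {m} (v : Vec Carrier (suc m)) r → ∃ λ (Q : Vec Carrier m) →
    ∀ s n → act (mon v) s n ≈ act (mon Q) (act (mon (linear r)) s) n + eval (mon v) r * s n
  divide-linear {m} v r = Q , λ s n → trans (raw s n) (+-congˡ (*-congʳ (sym eval≈ρ)))
    where
    -- The degree `suc m` has to be presented as m + 1 to show the degree of the divisor.
    w = ≡.subst (Vec Carrier) (ℕₚ.+-comm 1 m) v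
    Q = proj₁ (monicDivMod m w (linear r))
    ρ = head (proj₂ (monicDivMod m w (linear r)))

    act-singleton : ∀ (ρ : Vec Carrier 1) s n → act (poly ρ) s n ≈ head ρ * s n
    act-singleton (a ∷ []) s n = +-identityʳ _

    raw : ∀ s n → act (mon v) s n ≈ act (mon Q) (act (mon (linear r)) s) n + ρ * s n
    raw s n = begin
      act (mon v) s n  ≡⟨ ≡.cong (λ g → act g s n) (mon-subst (ℕₚ.+-comm 1 m) v) ⟨
      act (mon w) s n  ≈⟨ act-monicDivMod m w (linear r) s n ⟩
      _                ≈⟨ +-congˡ (act-singleton (proj₂ (monicDivMod m w (linear r))) s n) ⟩
      act (mon Q) (act (mon (linear r)) s) n + ρ * s n ∎

    linear-kills : ∀ n → act (mon (linear r)) (r ^_) n ≈ 0#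
    linear-kills n = trans (act-geometric (mon (linear r)) r n)
      (trans (*-congʳ (trans (eval-linear r r) (-‿inverseʳ r))) (zeroˡ _))

    eval≈ρ : eval (mon v) r ≈ ρ
    eval≈ρ = begin
      eval (mon v) r       ≈⟨ *-identityʳ _ ⟨
      eval (mon v) r * 1#  ≈⟨ act-geometric (mon v) r 0 ⟨
      act (mon v) (r ^_) 0 ≈⟨ raw (r ^_) 0 ⟩
      act (mon Q) (act (mon (linear r)) (r ^_)) 0 + ρ * 1#  ≈⟨ +-cong (act-zero (mon Q) linear-kills 0) (*-identityʳ _) ⟩
      0# + ρ               ≈⟨ +-identityˡ _ ⟩
      ρ                    ∎

  factor-root : ∀ {m} (v : Vec Carrier (suc m)) r → eval (mon v) r ≈ 0# →
                ∃ λ (Q : Vec Carrier m) → mon v ≅ mon Q ∘ mon (linear r)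
  factor-root v r root = proj₁ (divide-linear v r) , λ s n → trans (proj₂ (divide-linear v r) s n) (trans (+-congˡ (trans (*-congʳ root) (zeroˡ _))) (+-identityʳ _))

  too-many-roots : ∀ {e} (v : Vec Carrier e) (ρ : Fin (suc e) → Carrier) → (∀ i j → ρ i ≈ ρ j → i ≡ j) →
                   ¬ (∀ i → eval (mon v) (ρ i) ≈ 0#)
  too-many-roots []        ρ inj roots = 1≉0 (trans (solve 1 (λ x → con (1 , 0) := con (1 , 0) :+ x :* con (0 , 0)) refl (ρ zero)) (roots zero))
  too-many-roots v@(_ ∷ _) ρ inj roots = too-many-roots Q (ρ ∘ suc) (λ i j eq → Finₚ.suc-injective (inj _ _ eq)) Q-roots
    where
    Q = proj₁ (factor-root v (ρ zero) (roots zero))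
    e = proj₂ (factor-root v (ρ zero) (roots zero))

    Q-roots : ∀ i → eval (mon Q) (ρ (suc i)) ≈ 0#
    Q-roots i = x*y≈0⇒y≈0 distinct (begin
      (ρ (suc i) - ρ zero) * eval (mon Q) (ρ (suc i))                         ≈⟨ *-comm _ _ ⟩
      eval (mon Q) (ρ (suc i)) * (ρ (suc i) - ρ zero)                         ≈⟨ *-congˡ (eval-linear _ _) ⟨
      eval (mon Q) (ρ (suc i)) * eval (mon (linear (ρ zero))) (ρ (suc i))     ≈⟨ eval-∘ (mon v) (mon Q) (mon (linear (ρ zero))) e (ρ (suc i)) ⟨
      eval (mon v) (ρ (suc i))                                                ≈⟨ roots (suc i) ⟩
      0#                                                                      ∎)
      where
      distinct : ¬ ρ (suc i) - ρ zero ≈ 0#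
      distinct eq with inj (suc i) zero (x-y≈0⇒x≈y eq)
      ... | ()

  eval-x^n : ∀ n x → eval (mon (replicate n 0#)) x ≈ x ^ n
  eval-x^n zero    x = trans (+-congˡ (zeroʳ x)) (+-identityʳ _)
  eval-x^n (suc n) x = trans (+-identityˡ _) (*-congˡ (eval-x^n n x))

  -- Otherwise x^(e+1) − x would vanish on the whole field.
  nonroot-of-unity : ∀ {e} → 0 < e → e < size ℕ.∸ 1 → ∃ λ x → ¬ x ≈ 0# × ¬ x ^ e ≈ 1#
  nonroot-of-unity {suc e} _ e<N
    with Finₚ.any? (λ i → ¬? (element i ≟ 0#) ×-dec ¬? (element i ^ suc e ≟ 1#))
  ... | yes (i , x≉0 , x^e≉1) = element i , x≉0 , x^e≉1
  ... | no none = ⊥-elim (too-many-roots (0# ∷ - 1# ∷ replicate e 0#) (λ i → element (inject≤ i bound))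
                            (λ i j eq → Finₚ.inject≤-injective bound bound i j (element-injective eq)) vanishes)
    where
    -- The exponent is `suc e` here, so the polynomial x^(e+2) - x needs e + 3 distinct roots for a
    -- contradiction.
    bound : suc (suc (suc e)) ≤ size
    bound = ≡.subst (suc (suc (suc e)) ≤_) (ℕₚ.m+[n∸m]≡n (ℕₚ.<⇒≤ size>1)) (s≤s e<N)

    element-injective : ∀ {i j} → element i ≈ element j → i ≡ j
    element-injective {i} {j} eq = ≡.trans (≡.sym (index-element i)) (≡.trans (index-cong eq) (index-element j))

    vanishes : ∀ i → eval (mon (0# ∷ - 1# ∷ replicate e 0#)) (element (inject≤ i bound)) ≈ 0#
    vanishes i with element (inject≤ i bound) ≟ 0#
    ... | yes x≈0 = trans (+-identityˡ _) (trans (*-congʳ x≈0) (zeroˡ _))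
    ... | no x≉0 = begin
      0# + x * (- 1# + x * eval (mon (replicate e 0#)) x)  ≈⟨ +-congˡ (*-congˡ (+-congˡ (*-congˡ (eval-x^n e x)))) ⟩
      0# + x * (- 1# + x ^ suc e)                          ≈⟨ +-congˡ (*-congˡ (+-congˡ x^e≈1)) ⟩
      0# + x * (- 1# + 1#)                                 ≈⟨ solve 1 (λ x → con (0 , 0) :+ x :* (:- con (1 , 0) :+ con (1 , 0)) := con (0 , 0)) refl x ⟩
      0#                                                   ∎
      where
      x = element (inject≤ i bound)
      x^e≈1 : x ^ suc e ≈ 1#
      x^e≈1 = decidable-stable (x ^ suc e ≟ 1#) (λ ≉1 → none (_ , x≉0 , ≉1))

  HasOrder : Carrier → ℕ → Set
  HasOrder β d = β ^ d ≈ 1# × (∀ m → β ^ m ≈ 1# → d ∣ m)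

  ^-∣ : ∀ y g {n} → y ^ g ≈ 1# → g ∣ n → y ^ n ≈ 1#
  ^-∣ y g e (divides k ≡.refl) = begin
    y ^ (k ℕ.* g)  ≈⟨ ^-congʳ y (ℕₚ.*-comm k g) ⟩
    y ^ (g ℕ.* k)  ≈⟨ ^-assocʳ y g k ⟨
    (y ^ g) ^ k    ≈⟨ ^-congˡ k e ⟩
    1# ^ k         ≈⟨ 1^n≈1 k ⟩
    1#             ∎

  ^-gcd : ∀ {y} m n → y ^ m ≈ 1# → y ^ n ≈ 1# → y ^ gcd m n ≈ 1#
  ^-gcd {y} m n em en with Bézout.identity (gcd-GCD m n)
  ... | Bézout.+- a b eq = begin
    y ^ gcd m n                      ≈⟨ *-identityʳ _ ⟨
    y ^ gcd m n * 1#                 ≈⟨ *-congˡ (^-∣ y n en (n∣m*n b)) ⟨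
    y ^ gcd m n * y ^ (b ℕ.* n)      ≈⟨ ^-homo-* y (gcd m n) (b ℕ.* n) ⟨
    y ^ (gcd m n ℕ.+ b ℕ.* n)        ≈⟨ ^-congʳ y eq ⟩
    y ^ (a ℕ.* m)                    ≈⟨ ^-∣ y m em (n∣m*n a) ⟩
    1#                               ∎
  ... | Bézout.-+ a b eq = begin
    y ^ gcd m n                      ≈⟨ *-identityʳ _ ⟨
    y ^ gcd m n * 1#                 ≈⟨ *-congˡ (^-∣ y m em (n∣m*n a)) ⟨
    y ^ gcd m n * y ^ (a ℕ.* m)      ≈⟨ ^-homo-* y (gcd m n) (a ℕ.* m) ⟨
    y ^ (gcd m n ℕ.+ a ℕ.* m)        ≈⟨ ^-congʳ y eq ⟩
    y ^ (b ℕ.* n)                    ≈⟨ ^-∣ y n en (n∣m*n b) ⟩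
    1#                               ∎

  -- With size - 1 = c r^(a+1), the exponent c r^a is too small to annihilate all units. If x^(c
  -- r^a) ≠ 1, then x^c has order exactly r^(a+1).
  order-prime-power : ∀ {r} a → Prime r → r ℕ.^ a ∣ size ℕ.∸ 1 → ∃ λ β → HasOrder β (r ℕ.^ a)
  order-prime-power zero    pr r^a∣N = 1# , *-identityˡ 1# , λ m _ → 1∣ m
  order-prime-power {r} (suc a) pr (divides c N≡) = y , y^r^a≈1 , minimal
    where
    N>0 : 0 < c ℕ.* r ℕ.^ suc a
    N>0 = ≡.subst (0 <_) N≡ (ℕₚ.m<n⇒0<n∸m size>1)

    e>0 : 0 < c ℕ.* r ℕ.^ a
    e>0 with c ℕ.* r ℕ.^ a in eq
    ... | suc _ = s≤s z≤n
    ... | zero  = ⊥-elim (ℕₚ.<-irrefl (≡.sym N≡0) N>0)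
      where
      N≡0 : c ℕ.* r ℕ.^ suc a ≡ 0
      N≡0 = ≡.trans (≡.cong (c ℕ.*_) (ℕₚ.*-comm r (r ℕ.^ a)))
             (≡.trans (≡.sym (ℕₚ.*-assoc c (r ℕ.^ a) r)) (≡.cong (ℕ._* r) eq))

    e<N : c ℕ.* r ℕ.^ a < size ℕ.∸ 1
    e<N = ≡.subst (c ℕ.* r ℕ.^ a <_)
      (≡.trans (ℕₚ.*-assoc c (r ℕ.^ a) r) (≡.trans (≡.cong (c ℕ.*_) (ℕₚ.*-comm (r ℕ.^ a) r)) (≡.sym N≡)))
      (ℕₚ.m<m*n (c ℕ.* r ℕ.^ a) r {{ℕ.>-nonZero e>0}} (ℕ.nonTrivial⇒n>1 r {{prime⇒nonTrivial pr}}))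

    x = proj₁ (nonroot-of-unity e>0 e<N)
    y = x ^ c

    y^r^a≈1 : y ^ (r ℕ.^ suc a) ≈ 1#
    y^r^a≈1 = begin
      (x ^ c) ^ (r ℕ.^ suc a)   ≈⟨ ^-assocʳ x c _ ⟩
      x ^ (c ℕ.* r ℕ.^ suc a)   ≈⟨ ^-congʳ x (≡.sym N≡) ⟩
      x ^ (size ℕ.∸ 1)          ≈⟨ fermat (proj₁ (proj₂ (nonroot-of-unity e>0 e<N))) ⟩
      1#                        ∎

    y^r^[a-1]≉1 : ¬ y ^ (r ℕ.^ a) ≈ 1#
    y^r^[a-1]≉1 eq = proj₂ (proj₂ (nonroot-of-unity e>0 e<N)) (trans (sym (^-assocʳ x c _)) eq)

    minimal : ∀ m → y ^ m ≈ 1# → r ℕ.^ suc a ∣ m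
    minimal m y^m≈1 with ∣-prime-^ pr a (gcd[m,n]∣n m (r ℕ.^ suc a))
    ... | inj₁ g≡ = ≡.subst (_∣ m) g≡ (gcd[m,n]∣m m (r ℕ.^ suc a))
    ... | inj₂ g∣ = ⊥-elim (y^r^[a-1]≉1 (^-∣ y (gcd m (r ℕ.^ suc a)) (^-gcd m (r ℕ.^ suc a) y^m≈1 y^r^a≈1) g∣))

  -- Raising (x y)^m = 1 to the power B leaves x^(B m) = 1, so A divides B m and hence m; likewise
  -- with the roles exchanged.
  order-coprime-product : ∀ {x y A B} → Coprime A B → HasOrder x A → HasOrder y B → HasOrder (x * y) (A ℕ.* B)
  order-coprime-product {x} {y} {A} {B} A⊥B (x^A , x-min) (y^B , y-min) =
    trans (^-distrib-* x y (A ℕ.* B)) (trans (*-cong (^-∣ x A x^A (m∣m*n B)) (^-∣ y B y^B (n∣m*n A))) (*-identityˡ _)) ,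
    λ m e → coprime-*-∣ A⊥B
      (coprime-divisor A⊥B (x-min (B ℕ.* m) (kill x y B y^B m e)))
      (coprime-divisor (Coprimality.sym A⊥B) (y-min (A ℕ.* m) (kill y x A x^A m (trans (^-congˡ m (*-comm y x)) e))))
    where
    kill : ∀ x y B → y ^ B ≈ 1# → ∀ m → (x * y) ^ m ≈ 1# → x ^ (B ℕ.* m) ≈ 1#
    kill x y B y^B m e = begin
      x ^ (B ℕ.* m)                    ≈⟨ *-identityʳ _ ⟨
      x ^ (B ℕ.* m) * 1#               ≈⟨ *-congˡ (^-∣ y B y^B (m∣m*n m)) ⟨
      x ^ (B ℕ.* m) * y ^ (B ℕ.* m)    ≈⟨ ^-distrib-* x y (B ℕ.* m) ⟨
      (x * y) ^ (B ℕ.* m)              ≈⟨ ^-∣ (x * y) m e (n∣m*n B) ⟩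
      1#                               ∎

  -- Strong induction peels off one full prime power at a time. The case d = size - 1 is the
  -- cyclicity of the multiplicative group.
  order-exists : ∀ d → 0 < d → d ∣ size ℕ.∸ 1 → ∃ λ β → HasOrder β d
  order-exists = <-rec _ step
    where
    step : ∀ d → (∀ {e} → e < d → 0 < e → e ∣ size ℕ.∸ 1 → ∃ λ β → HasOrder β e) →
           0 < d → d ∣ size ℕ.∸ 1 → ∃ λ β → HasOrder β d
    step (suc zero)        rec 0<d d∣N = 1# , *-identityˡ 1# , λ m _ → 1∣ m
    step d@(suc (suc _)) rec 0<d d∣N
      with r , pr , r∣d ← prime-divisor d (s≤s (s≤s z≤n))
      with prime-power-split pr d 0<d
    ... | zero  , d′ , d≡ , r∤d′ = ⊥-elim (r∤d′ (≡.subst (r ∣_) (≡.trans d≡ (ℕₚ.+-identityʳ d′)) r∣d))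
    ... | suc a , zero , d≡ , r∤d′ = ⊥-elim (r∤d′ (r ∣0))
    ... | suc a , d′@(suc _) , d≡ , r∤d′
      with order-prime-power (suc a) pr (∣-trans (≡.subst (r ℕ.^ suc a ∣_) (≡.sym d≡) (m∣m*n d′)) d∣N)
         | rec d′<d (s≤s z≤n) (∣-trans (≡.subst (d′ ∣_) (≡.sym d≡) (n∣m*n (r ℕ.^ suc a))) d∣N)
      where
      r^a>1 : 1 < r ℕ.^ suc a
      r^a>1 = ℕₚ.<-≤-trans (ℕ.nonTrivial⇒n>1 r {{prime⇒nonTrivial pr}})
                (ℕₚ.m≤m*n r (r ℕ.^ a) {{ℕₚ.m^n≢0 r a {{prime⇒nonZero pr}}}})
      d′<d : d′ < d
      d′<d = ≡.subst (d′ <_) (≡.trans (ℕₚ.*-comm d′ _) (≡.sym d≡)) (ℕₚ.m<m*n d′ (r ℕ.^ suc a) r^a>1)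
    ... | x , ox | y , oy = x * y ,
          ≡.subst (HasOrder (x * y)) (≡.sym d≡)
            (order-coprime-product (coprime-^ˡ (suc a) (prime∤⇒coprime pr r∤d′)) ox oy)

  -- If d = k p, then (β^k - 1)^p = β^d - 1 = 0 forces β^k = 1 with k < d.
  char∤order : ∀ {p β d} → Prime p → p · 1# ≈ 0# → 0 < d → HasOrder β d → ¬ p ∣ d
  char∤order {p} {β} pr p≈0 0<d (β^d , min) (divides zero ≡.refl) = ℕₚ.<-irrefl ≡.refl 0<d
  char∤order {p} {β} pr p≈0 0<d (β^d , min) (divides k@(suc _) ≡.refl) =
    ℕₚ.<⇒≱ (ℕₚ.m<m*n k p (ℕ.nonTrivial⇒n>1 p {{prime⇒nonTrivial pr}})) (∣⇒≤ (min k β^k≈1))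
    where
    open Frobenius commRing using (frobenius-‿1)

    power≈0 : (β ^ k - 1#) ^ p ≈ 0#
    power≈0 = begin
      (β ^ k - 1#) ^ p      ≈⟨ frobenius-‿1 pr p≈0 (β ^ k) ⟩
      (β ^ k) ^ p - 1#      ≈⟨ +-congʳ (trans (^-assocʳ β k p) β^d) ⟩
      1# - 1#               ≈⟨ -‿inverseʳ 1# ⟩
      0#                    ∎

    β^k≈1 : β ^ k ≈ 1#
    β^k≈1 with β ^ k ≟ 1#
    ... | yes eq = eq
    ... | no ≉1 = ⊥-elim (^-nonzero (≉1 ∘ x-y≈0⇒x≈y) p power≈0)

-- Polynomial rings and their quotients as rings of operators

-- With P = everything this is R[x]; with P = the kernel of f it is R[x]/(f).
module ActionRing (R : CommutativeRing 0ℓ 0ℓ) (P : (ℕ → CommutativeRing.Carrier R) → Set) where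
  open CommutativeRing R hiding (zero)
  open IntegralSolver R
  open Polynomials R
  open import Algebra.Properties.Ring ring using (-1*x≈-x)
  open import Relation.Binary.Reasoning.Setoid setoid

  infix 4 _≃_

  _≃_ : Poly → Poly → Set
  g ≃ h = ∀ s → P s → ∀ n → act g s n ≈ act h s n

  one : Poly
  one = 1# ∷ []

  neg : Poly → Poly
  neg g = - 1# ⊛ g

  act-one : ∀ s n → act one s n ≈ s n
  act-one s n = trans (+-identityʳ _) (*-identityˡ _)

  act-neg : ∀ g s n → act (neg g) s n ≈ - act g s n
  act-neg g s n = trans (act-⊛ (- 1#) g s n) (-1*x≈-x _)

  private
    ⊕-cong : ∀ {g g′ h h′} → g ≃ g′ → h ≃ h′ → g ⊕ h ≃ g′ ⊕ h′
    ⊕-cong {g} {g′} {h} {h′} e e′ s Ps n =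
      trans (act-⊕ g h s n) (trans (+-cong (e s Ps n) (e′ s Ps n)) (sym (act-⊕ g′ h′ s n)))

    ⊕-comm : ∀ g h → g ⊕ h ≃ h ⊕ g
    ⊕-comm g h s Ps n = trans (act-⊕ g h s n) (trans (+-comm _ _) (sym (act-⊕ h g s n)))

    ⊕-assoc : ∀ g h k → g ⊕ h ⊕ k ≃ g ⊕ (h ⊕ k)
    ⊕-assoc g h k s Ps n = begin
      act (g ⊕ h ⊕ k) s n                    ≈⟨ act-⊕ (g ⊕ h) k s n ⟩
      act (g ⊕ h) s n + act k s n            ≈⟨ +-congʳ (act-⊕ g h s n) ⟩
      act g s n + act h s n + act k s n      ≈⟨ +-assoc _ _ _ ⟩
      act g s n + (act h s n + act k s n)    ≈⟨ +-congˡ (act-⊕ h k s n) ⟨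
      act g s n + act (h ⊕ k) s n            ≈⟨ act-⊕ g (h ⊕ k) s n ⟨
      act (g ⊕ (h ⊕ k)) s n                  ∎

    ⊕-identityʳ : ∀ g → g ⊕ [] ≃ g
    ⊕-identityʳ g s Ps n = trans (act-⊕ g [] s n) (+-identityʳ _)

    neg-inverseˡ : ∀ g → neg g ⊕ g ≃ []
    neg-inverseˡ g s Ps n = trans (act-⊕ (neg g) g s n) (trans (+-congʳ (act-neg g s n)) (-‿inverseˡ _))

    neg-cong : ∀ {g h} → g ≃ h → neg g ≃ neg h
    neg-cong {g} {h} e s Ps n = trans (act-neg g s n) (trans (-‿cong (e s Ps n)) (sym (act-neg h s n)))

    ⊗-comm : ∀ g h → g ⊗ h ≃ h ⊗ g
    ⊗-comm g h s Ps n = trans (act-⊗ g h s n) (trans (act-comm g h s n) (sym (act-⊗ h g s n)))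

    ⊗-congˡ : ∀ g {h h′} → h ≃ h′ → g ⊗ h ≃ g ⊗ h′
    ⊗-congˡ g {h} {h′} e s Ps n = trans (act-⊗ g h s n) (trans (act-cong g (e s Ps) n) (sym (act-⊗ g h′ s n)))

    -- Only the factor that acts first meets a sequence known to satisfy `P`; commutativity brings
    -- the other factor into that place.
    ⊗-cong : ∀ {g g′ h h′} → g ≃ g′ → h ≃ h′ → g ⊗ h ≃ g′ ⊗ h′
    ⊗-cong {g} {g′} {h} {h′} e e′ s Ps n =
      trans (⊗-congˡ g e′ s Ps n) (trans (⊗-comm g h′ s Ps n) (trans (⊗-congˡ h′ e s Ps n) (⊗-comm h′ g′ s Ps n)))

    ⊗-assoc : ∀ g h k → g ⊗ h ⊗ k ≃ g ⊗ (h ⊗ k)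
    ⊗-assoc g h k s Ps n = begin
      act (g ⊗ h ⊗ k) s n            ≈⟨ act-⊗ (g ⊗ h) k s n ⟩
      act (g ⊗ h) (act k s) n        ≈⟨ act-⊗ g h (act k s) n ⟩
      act g (act h (act k s)) n      ≈⟨ act-cong g (act-⊗ h k s) n ⟨
      act g (act (h ⊗ k) s) n        ≈⟨ act-⊗ g (h ⊗ k) s n ⟨
      act (g ⊗ (h ⊗ k)) s n          ∎

    ⊗-identityˡ : ∀ g → one ⊗ g ≃ g
    ⊗-identityˡ g s Ps n = trans (act-⊗ one g s n) (act-one (act g s) n)

    ⊗-distribˡ : ∀ g h k → g ⊗ (h ⊕ k) ≃ g ⊗ h ⊕ g ⊗ k
    ⊗-distribˡ g h k s Ps n = begin
      act (g ⊗ (h ⊕ k)) s n                            ≈⟨ act-⊗ g (h ⊕ k) s n ⟩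
      act g (act (h ⊕ k) s) n                          ≈⟨ act-cong g (act-⊕ h k s) n ⟩
      act g (λ n → act h s n + act k s n) n            ≈⟨ act-+ g (act h s) (act k s) n ⟩
      act g (act h s) n + act g (act k s) n            ≈⟨ +-cong (act-⊗ g h s n) (act-⊗ g k s n) ⟨
      act (g ⊗ h) s n + act (g ⊗ k) s n                ≈⟨ act-⊕ (g ⊗ h) (g ⊗ k) s n ⟨
      act (g ⊗ h ⊕ g ⊗ k) s n                          ∎

    ⊗-distribʳ : ∀ k g h → (g ⊕ h) ⊗ k ≃ g ⊗ k ⊕ h ⊗ k
    ⊗-distribʳ k g h s Ps n = begin
      act ((g ⊕ h) ⊗ k) s n         ≈⟨ ⊗-comm (g ⊕ h) k s Ps n ⟩
      act (k ⊗ (g ⊕ h)) s n         ≈⟨ ⊗-distribˡ k g h s Ps n ⟩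
      act (k ⊗ g ⊕ k ⊗ h) s n       ≈⟨ ⊕-cong {k ⊗ g} {g ⊗ k} {k ⊗ h} {h ⊗ k} (⊗-comm k g) (⊗-comm k h) s Ps n ⟩
      act (g ⊗ k ⊕ h ⊗ k) s n       ∎

  commutativeRing : CommutativeRing 0ℓ 0ℓ
  commutativeRing = record
    { Carrier = Poly ; _≈_ = _≃_ ; _+_ = _⊕_ ; _*_ = _⊗_ ; -_ = neg ; 0# = [] ; 1# = one
    ; isCommutativeRing = record
      { isRing = record
        { +-isAbelianGroup = record
          { isGroup = record
            { isMonoid = record
              { isSemigroup = record
                { isMagma = record
                  { isEquivalence = record
                    { refl = λ _ _ _ → refl
                    ; sym = λ e s Ps n → sym (e s Ps n)
                    ; trans = λ e e′ s Ps n → trans (e s Ps n) (e′ s Ps n)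
                    }
                  ; ∙-cong = λ {g} {g′} {h} {h′} → ⊕-cong {g} {g′} {h} {h′}
                  }
                ; assoc = ⊕-assoc
                }
              ; identity = (λ g s Ps n → refl) , ⊕-identityʳ
              }
            ; inverse = neg-inverseˡ , (λ g s Ps n → trans (⊕-comm g (neg g) s Ps n) (neg-inverseˡ g s Ps n))
            ; ⁻¹-cong = λ {g} {h} → neg-cong {g} {h}
            }
          ; comm = ⊕-comm
          }
        ; *-cong = λ {g} {g′} {h} {h′} → ⊗-cong {g} {g′} {h} {h′}
        ; *-assoc = ⊗-assoc
        ; *-identity = ⊗-identityˡ , (λ g s Ps n → trans (⊗-comm g one s Ps n) (⊗-identityˡ g s Ps n))
        ; distrib = ⊗-distribˡ , ⊗-distribʳ
        }
      ; *-comm = ⊗-comm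
      }
    }

  open import Algebra.Properties.Semiring.Exp (CommutativeRing.semiring commutativeRing) using () renaming (_^_ to _^ᴾ_)
  open import Algebra.Properties.Semiring.Mult (CommutativeRing.semiring commutativeRing) using () renaming (_×_ to _·ᴾ_)
  open import Algebra.Properties.Semiring.Mult semiring using () renaming (_×_ to _·_)

  X : Poly
  X = 0# ∷ 1# ∷ []

  act-X : ∀ s n → act X s n ≈ s (suc n)
  act-X s n = solve 2 (λ a b → con (0 , 0) :* a :+ (con (1 , 0) :* b :+ con (0 , 0)) := b) refl (s n) (s (suc n))

  act-X^ : ∀ k s n → act (X ^ᴾ k) s n ≈ s (n ℕ.+ k)
  act-X^ zero    s n = trans (act-one s n) (reflexive (≡.cong s (≡.sym (ℕₚ.+-identityʳ n))))
  act-X^ (suc k) s n = begin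
    act (X ⊗ X ^ᴾ k) s n         ≈⟨ act-⊗ X (X ^ᴾ k) s n ⟩
    act X (act (X ^ᴾ k) s) n     ≈⟨ act-X (act (X ^ᴾ k) s) n ⟩
    act (X ^ᴾ k) s (suc n)       ≈⟨ act-X^ k s (suc n) ⟩
    s (suc n ℕ.+ k)              ≡⟨ ≡.cong s (ℕₚ.+-suc n k) ⟨
    s (n ℕ.+ suc k)              ∎

  natCastᴾ : ℕ → Poly
  natCastᴾ k = k ·ᴾ one

  act-cast : ∀ k s n → act (natCastᴾ k) s n ≈ (k · 1#) * s n
  act-cast zero    s n = sym (zeroˡ _)
  act-cast (suc k) s n = begin
    act (one ⊕ natCastᴾ k) s n               ≈⟨ act-⊕ one (natCastᴾ k) s n ⟩
    act one s n + act (natCastᴾ k) s n       ≈⟨ +-cong (act-one s n) (act-cast k s n) ⟩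
    s n + (k · 1#) * s n                     ≈⟨ +-congʳ (*-identityˡ _) ⟨
    1# * s n + (k · 1#) * s n                ≈⟨ distribʳ _ _ _ ⟨
    (1# + k · 1#) * s n                      ∎

-- Numbering the coefficient vectors of a given length

module Coding (F : FiniteField) where
  open FiniteField F hiding (zero)
  open Polynomials commRing
  open FieldProperties F
  open import Data.Fin using (zero; combine; remQuot)
  open import Data.Vec.Relation.Unary.All using ([]; _∷_)
  open import Relation.Binary.Reasoning.Setoid setoid

  encode : ∀ {j} → Vec Carrier j → Fin (size ℕ.^ j)
  encode []      = zero
  encode (c ∷ v) = combine (index c) (encode v)

  decode : ∀ j → Fin (size ℕ.^ j) → Vec Carrier j
  decode zero    i = []
  decode (suc j) i = element (proj₁ (remQuot {size} (size ℕ.^ j) i)) ∷ decode j (proj₂ (remQuot {size} (size ℕ.^ j) i))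

  encode-decode : ∀ j i → encode (decode j i) ≡ i
  encode-decode zero    zero = ≡.refl
  encode-decode (suc j) i    = ≡.trans
    (≡.cong₂ combine (index-element _) (encode-decode j _)) (Finₚ.combine-remQuot {size} (size ℕ.^ j) i)

  act-decode-encode : ∀ {j} (v : Vec Carrier j) s n → act (poly (decode j (encode v))) s n ≈ act (poly v) s n
  act-decode-encode []      s n = refl
  act-decode-encode {suc j} (c ∷ v) s n = begin
    act (poly (decode (suc j) (combine (index c) (encode v)))) s n
      ≡⟨ ≡.cong (λ (a , b) → element a * s n + act (poly (decode j b)) s (suc n)) (Finₚ.remQuot-combine (index c) (encode v)) ⟩
    element (index c) * s n + act (poly (decode j (encode v))) s (suc n)
      ≈⟨ +-cong (*-congʳ (element-index c)) (act-decode-encode v s (suc n)) ⟩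
    c * s n + act (poly v) s (suc n) ∎

  -- Equality is phrased as a vanishing difference because arguments about the action deliver it in
  -- terms of `subtract`.
  encode-cong : ∀ {j} (v w : Vec Carrier j) → IsZero (subtract v 1# w) → encode v ≡ encode w
  encode-cong []      []      []       = ≡.refl
  encode-cong (a ∷ v) (b ∷ w) (e ∷ es) =
    ≡.cong₂ combine (index-cong (x-y≈0⇒x≈y (trans (+-congˡ (-‿cong (sym (*-identityˡ b)))) e))) (encode-cong v w es)

-- Irreducible polynomials and inversion modulo them

module Irreducibility (F : FiniteField) where
  open FiniteField F hiding (zero)
  open IntegralSolver commRing
  open Polynomials commRing
  open FieldProperties F
  open import Data.Nat.Induction using (<-rec)
  open import Data.Vec.Relation.Unary.All using ([]; _∷_; all?)
  open import Relation.Binary.Reasoning.Setoid setoid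

  isZero? : ∀ {n} (r : Vec Carrier n) → Dec (IsZero r)
  isZero? = all? (_≟ 0#)

  remainder : ∀ {j} m i → j ≡ suc m ℕ.+ suc i → Vec Carrier j → Vec Carrier (suc i) → Vec Carrier (suc i)
  remainder m i eq f g = proj₂ (monicDivMod (suc m) (≡.subst (Vec Carrier) eq f) g)

  -- Both degrees are successors, so only proper factorisations are excluded. Nonvanishing of the
  -- remainder is the form in which the Euclidean algorithm consumes irreducibility.
  Irreducible : ∀ {j} → Vec Carrier j → Set
  Irreducible {j} f = ∀ m i (eq : j ≡ suc m ℕ.+ suc i) (g : Vec Carrier (suc i)) → ¬ IsZero (remainder m i eq f g)

  -- A nonzero remainder as a scalar times a monic polynomial of degree e, ready to serve as the
  -- next divisor.
  Leading : ∀ {n} → Vec Carrier n → Set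
  Leading {n} r = ∃ λ e → e < n × Σ (Vec Carrier e) λ v → ∃ λ c → ¬ c ≈ 0# ×
                  (∀ s k → act (poly r) s k ≈ c * act (mon v) s k)

  leading : ∀ {n} (r : Vec Carrier n) → ¬ IsZero r → Leading r
  leading []      r≉0 = ⊥-elim (r≉0 [])
  leading {suc n} (a ∷ r) ar≉0 = decide (isZero? r)
    where
    decide : Dec (IsZero r) → Leading (a ∷ r)
    decide (yes r≈0) = 0 , s≤s z≤n , [] , a , (λ a≈0 → ar≉0 (a≈0 ∷ r≈0)) , λ s k → begin
      a * s k + act (poly r) s (suc k)  ≈⟨ +-congˡ (act-IsZero r≈0 s (suc k)) ⟩
      a * s k + 0#                      ≈⟨ solve 2 (λ a s → a :* s :+ con (0 , 0) := a :* (con (1 , 0) :* s :+ con (0 , 0))) refl a (s k) ⟩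
      a * (1# * s k + 0#)               ∎
    decide (no r≉0) = extend (leading r r≉0)
      where
      extend : Leading r → Leading (a ∷ r)
      extend (e , e<n , v , c , c≉0 , spec) = suc e , s≤s e<n , c⁻¹ * a ∷ v , c , c≉0 , λ s k → begin
        a * s k + act (poly r) s (suc k)                    ≈⟨ +-cong (*-congʳ (sym (*-identityˡ a))) (spec s (suc k)) ⟩
        1# * a * s k + c * act (mon v) s (suc k)            ≈⟨ +-congʳ (*-congʳ (*-congʳ (proj₂ (inverse c c≉0)))) ⟨
        c * c⁻¹ * a * s k + c * act (mon v) s (suc k)
          ≈⟨ solve 5 (λ c d a s x → c :* d :* a :* s :+ c :* x := c :* (d :* a :* s :+ x)) refl c c⁻¹ a (s k) _ ⟩
        c * (c⁻¹ * a * s k + act (mon v) s (suc k))         ∎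
        where c⁻¹ = proj₁ (inverse c c≉0)

  Ker : Poly → Seq → Set
  Ker g s = ∀ n → act g s n ≈ 0#

  Invertible : Poly → Poly → Set
  Invertible f g = ∃ λ u → ∀ s → Ker f s → ∀ n → act u (act g s) n ≈ s n

  module _ {j} (f : Vec Carrier j) (irr : Irreducible f) where

    -- Euclid: if f = Q g + r then on ker f the inverse of g is −r⁻¹ Q.
    monic-invertible : ∀ e → e < j → (g : Vec Carrier e) → Invertible (mon f) (mon g)
    monic-invertible = <-rec _ step
      where
      step : ∀ e → (∀ {e′} → e′ < e → e′ < j → (g : Vec Carrier e′) → Invertible (mon f) (mon g)) →
             e < j → (g : Vec Carrier e) → Invertible (mon f) (mon g)
      step zero    rec e<j [] = 1# ∷ [] , λ s _ n →
        solve 1 (λ a → con (1 , 0) :* (con (1 , 0) :* a :+ con (0 , 0)) :+ con (0 , 0) := a) refl (s n)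
      step (suc i) rec e<j g = conclude (leading r (irr m i eq g))
        where
        -- The divisor has degree `suc i` < j, so the quotient has positive degree `suc m`.
        m = j ℕ.∸ suc (suc i)
        eq : j ≡ suc m ℕ.+ suc i
        eq = ≡.sym (≡.trans (≡.sym (ℕₚ.+-suc m (suc i))) (ℕₚ.m∸n+n≡m e<j))
        w = ≡.subst (Vec Carrier) eq f
        Q = proj₁ (monicDivMod (suc m) w g)
        r = remainder m i eq f g

        conclude : Leading r → Invertible (mon f) (mon g)
        conclude (e′ , e′<e , v , c , c≉0 , spec) = - c⁻¹ ⊛ (u′ ⊗ mon Q) , λ s fs n → begin
          act (- c⁻¹ ⊛ (u′ ⊗ mon Q)) (G s) n                      ≈⟨ act-⊛ (- c⁻¹) (u′ ⊗ mon Q) (G s) n ⟩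
          - c⁻¹ * act (u′ ⊗ mon Q) (G s) n                        ≈⟨ *-congˡ (act-⊗ u′ (mon Q) (G s) n) ⟩
          - c⁻¹ * act u′ (act (mon Q) (G s)) n                    ≈⟨ act-* u′ (- c⁻¹) (act (mon Q) (G s)) n ⟨
          act u′ (λ n → - c⁻¹ * act (mon Q) (G s) n) n            ≈⟨ act-cong u′ (solve-v s fs) n ⟨
          act u′ (act (mon v) s) n                                ≈⟨ proj₂ (rec e′<e (ℕₚ.<-trans e′<e e<j) v) s fs n ⟩
          s n                                                     ∎
          where
          c⁻¹ = proj₁ (inverse c c≉0)
          u′ = proj₁ (rec e′<e (ℕₚ.<-trans e′<e e<j) v)
          G : Seq → Seq
          G = act (mon g)

          solve-v : ∀ s → Ker (mon f) s → ∀ n → act (mon v) s n ≈ - c⁻¹ * act (mon Q) (G s) n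
          solve-v s fs n = begin
            V                                        ≈⟨ *-identityˡ V ⟨
            1# * V                                   ≈⟨ *-congʳ (proj₂ (inverse c c≉0)) ⟨
            c * c⁻¹ * V                              ≈⟨ solve 4 (λ c d q v → c :* d :* v := d :* (q :+ c :* v) :+ (:- d) :* q) refl c c⁻¹ Qg V ⟩
            c⁻¹ * (Qg + c * V) + - c⁻¹ * Qg          ≈⟨ +-congʳ (*-congˡ (begin
              Qg + c * V                 ≈⟨ +-congˡ (spec s n) ⟨
              Qg + act (poly r) s n      ≈⟨ act-monicDivMod (suc m) w g s n ⟨
              act (mon w) s n            ≡⟨ ≡.cong (λ h → act h s n) (mon-subst eq f) ⟩
              act (mon f) s n            ≈⟨ fs n ⟩
              0#                         ∎)) ⟩
            c⁻¹ * 0# + - c⁻¹ * Qg                    ≈⟨ solve 2 (λ d q → d :* con (0 , 0) :+ (:- d) :* q := (:- d) :* q) refl c⁻¹ Qg ⟩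
            - c⁻¹ * Qg                               ∎
            where
            V = act (mon v) s n
            Qg = act (mon Q) (G s) n

    nonzero-invertible : (g : Vec Carrier j) → ¬ IsZero g → Invertible (mon f) (poly g)
    nonzero-invertible g g≉0 = conclude (leading g g≉0)
      where
      conclude : Leading g → Invertible (mon f) (poly g)
      conclude (e , e<j , v , c , c≉0 , spec) = c⁻¹ ⊛ u , λ s fs n → begin
        act (c⁻¹ ⊛ u) (act (poly g) s) n                 ≈⟨ act-⊛ c⁻¹ u (act (poly g) s) n ⟩
        c⁻¹ * act u (act (poly g) s) n                   ≈⟨ *-congˡ (act-cong u (spec s) n) ⟩
        c⁻¹ * act u (λ n → c * act (mon v) s n) n        ≈⟨ *-congˡ (act-* u c (act (mon v) s) n) ⟩
        c⁻¹ * (c * act u (act (mon v) s) n)              ≈⟨ *-congˡ (*-congˡ (proj₂ (monic-invertible e e<j v) s fs n)) ⟩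
        c⁻¹ * (c * s n)                                  ≈⟨ solve 3 (λ d c s → d :* (c :* s) := c :* d :* s) refl c⁻¹ c (s n) ⟩
        c * c⁻¹ * s n                                    ≈⟨ *-congʳ (proj₂ (inverse c c≉0)) ⟩
        1# * s n                                         ≈⟨ *-identityˡ _ ⟩
        s n                                              ∎
        where
        c⁻¹ = proj₁ (inverse c c≉0)
        u = proj₁ (monic-invertible e e<j v)

-- A nonzero solution of a given recurrence

module RecurrenceSolution (F : FiniteField) where
  open FiniteField F hiding (zero)
  open Polynomials commRing
  open import Data.Vec using (head; replicate; _∷ʳ_)
  open import Data.Unit using (⊤; tt)
  open import Relation.Binary.Reasoning.Setoid setoid

  module _ {j} (f : Vec Carrier (suc j)) where

    private
      dot : ∀ {k} → Vec Carrier k → Vec Carrier k → Carrier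
      dot []      []      = 0#
      dot (c ∷ g) (x ∷ t) = c * x + dot g t

      next : Vec Carrier (suc j) → Vec Carrier (suc j)
      next (x ∷ t) = t ∷ʳ (- dot f (x ∷ t))

      state : ℕ → Vec Carrier (suc j)
      state zero    = 1# ∷ replicate j 0#
      state (suc n) = next (state n)

    -- The value 1 at index 0 is what matters later: it separates 1 from 0 modulo f and normalises
    -- the functional φ.
    solution : Seq
    solution n = head (state n)

    private
      -- One step of the register drops the head and keeps the rest as a prefix. Iterating this
      -- shows that the state at time n lists the terms of the solution from n on, which `Window`
      -- records.
      data Prefix : ∀ {k l} → Vec Carrier k → Vec Carrier l → Set where
        []  : ∀ {l} {t : Vec Carrier l} → Prefix [] t
        _∷_ : ∀ {k l} x {t : Vec Carrier k} {t′ : Vec Carrier l} → Prefix t t′ → Prefix (x ∷ t) (x ∷ t′)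

      prefix-refl : ∀ {k} (t : Vec Carrier k) → Prefix t t
      prefix-refl []      = []
      prefix-refl (x ∷ t) = x ∷ prefix-refl t

      prefix-∷ʳ : ∀ {k l y} {t : Vec Carrier k} {t′ : Vec Carrier l} → Prefix t t′ → Prefix t (t′ ∷ʳ y)
      prefix-∷ʳ []      = []
      prefix-∷ʳ (x ∷ p) = x ∷ prefix-∷ʳ p

      prefix-next : ∀ {k x} {t : Vec Carrier k} {t′} → Prefix (x ∷ t) t′ → x ≡ head t′ × Prefix t (next t′)
      prefix-next (x ∷ p) = ≡.refl , prefix-∷ʳ p

      Window : ∀ {k} → Vec Carrier k → ℕ → Set
      Window []      n = ⊤
      Window (x ∷ t) n = x ≡ solution n × Window t (suc n)

      prefix⇒window : ∀ {k} (t : Vec Carrier k) n → Prefix t (state n) → Window t n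
      prefix⇒window []      n p = tt
      prefix⇒window (x ∷ t) n p = proj₁ (prefix-next p) , prefix⇒window t (suc n) (proj₂ (prefix-next p))

      dot-window : ∀ {k} (g t : Vec Carrier k) n → Window t n → dot g t ≡ act (poly g) solution n
      dot-window []      []      n w = ≡.refl
      dot-window (c ∷ g) (x ∷ t) n (eq , w) = ≡.cong₂ (λ a b → c * a + b) eq (dot-window g t (suc n) w)

      window-last : ∀ {k} (t : Vec Carrier k) y n → Window (t ∷ʳ y) n → y ≡ solution (n ℕ.+ k)
      window-last []      y n (eq , _) = ≡.trans eq (≡.cong solution (≡.sym (ℕₚ.+-identityʳ n)))
      window-last {suc k} (x ∷ t) y n (_ , w) = ≡.trans (window-last t y (suc n) w) (≡.cong solution (≡.sym (ℕₚ.+-suc n k)))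

      next-last : ∀ t n → Window (next t) n → - dot f t ≡ solution (n ℕ.+ j)
      next-last (x ∷ t) n w = window-last t _ n w

      window-state : ∀ n → Window (state n) n
      window-state n = prefix⇒window (state n) n (prefix-refl (state n))

    solution-kernel : ∀ n → act (mon f) solution n ≈ 0#
    solution-kernel n = begin
      act (mon f) solution n                                      ≈⟨ act-mon f solution n ⟩
      act (poly f) solution n + solution (n ℕ.+ suc j)            ≡⟨ ≡.cong₂ _+_ (dot-window f (state n) n (window-state n))
          (≡.trans (next-last (state n) (suc n) (window-state (suc n))) (≡.cong solution (≡.sym (ℕₚ.+-suc n j)))) ⟨
      dot f (state n) - dot f (state n)                           ≈⟨ -‿inverseʳ _ ⟩
      0#                                                          ∎

-- The field F[x]/(f)

module QuotientField (F : FiniteField) {j : ℕ} (f : Vec (FiniteField.Carrier F) (suc j))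
                     (irr : Irreducibility.Irreducible F f) where
  open FiniteField F hiding (zero)
  open Polynomials commRing
  open Coding F
  open Irreducibility F
  open RecurrenceSolution F
  open ActionRing commRing (Ker (mon f)) public
  open import Relation.Binary.Reasoning.Setoid setoid

  private
    rem : Poly → Vec Carrier (suc j)
    rem g = proj₂ (divMod g f)

    act-rem : ∀ g → g ≃ poly (rem g)
    act-rem g s fs n = begin
      act g s n                                                              ≈⟨ act-divMod g f s n ⟩
      act (proj₁ (divMod g f)) (act (mon f) s) n + act (poly (rem g)) s n    ≈⟨ +-congʳ (act-zero (proj₁ (divMod g f)) fs n) ⟩
      0# + act (poly (rem g)) s n                                            ≈⟨ +-identityˡ _ ⟩
      act (poly (rem g)) s n                                                 ∎

    invertible-nonzero : ∀ {g} → Invertible (mon f) g → ¬ g ≃ []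
    invertible-nonzero {g} (u , inv) g≈0 = 1≉0 (begin
      1#                              ≈⟨ inv (solution f) (solution-kernel f) 0 ⟨
      act u (act g (solution f)) 0    ≈⟨ act-zero u (g≈0 (solution f) (solution-kernel f)) 0 ⟩
      0#                              ∎)

    -- A nonzero remainder is invertible on the kernel of f, which contains a nonzero sequence, so
    -- it cannot act as zero there. Remainders are therefore unique, and this gives the size of the
    -- quotient.
    kernel⇒IsZero : (v : Vec Carrier (suc j)) → poly v ≃ [] → IsZero v
    kernel⇒IsZero v v≈0 with isZero? v
    ... | yes z = z
    ... | no ¬z = ⊥-elim (invertible-nonzero {poly v} (nonzero-invertible f irr v ¬z) v≈0)

    encode-≃ : (v w : Vec Carrier (suc j)) → poly v ≃ poly w → encode v ≡ encode w
    encode-≃ v w v≈w = encode-cong v w (kernel⇒IsZero _ λ s fs n → begin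
      act (poly (subtract v 1# w)) s n                  ≈⟨ act-subtract v 1# w s n ⟩
      act (poly v) s n - 1# * act (poly w) s n          ≈⟨ +-cong (v≈w s fs n) (-‿cong (*-identityˡ _)) ⟩
      act (poly w) s n - act (poly w) s n               ≈⟨ -‿inverseʳ _ ⟩
      0#                                                ∎)

    from : Poly → Fin (size ℕ.^ suc j)
    from g = encode (rem g)

    to : Fin (size ℕ.^ suc j) → Poly
    to i = poly (decode (suc j) i)

    from-cong : ∀ {g h} → g ≃ h → from g ≡ from h
    from-cong {g} {h} e = encode-≃ (rem g) (rem h) λ s fs n →
      trans (sym (act-rem g s fs n)) (trans (e s fs n) (act-rem h s fs n))

    to-from : ∀ g → to (from g) ≃ g
    to-from g s fs n = trans (act-decode-encode (rem g) s n) (sym (act-rem g s fs n))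

    from-to : ∀ i → from (to i) ≡ i
    from-to i = ≡.trans (encode-≃ (rem (to i)) (decode (suc j) i) (λ s fs n → sym (act-rem (to i) s fs n)))
                        (encode-decode (suc j) i)

    module K = CommutativeRing commutativeRing

    inverseᴷ : ∀ g → ¬ g ≃ [] → Σ Poly λ u → g ⊗ u ≃ one
    inverseᴷ g g≉0 = proj₁ inv , λ s fs n → begin
      act (g ⊗ proj₁ inv) s n                       ≈⟨ K.*-comm g (proj₁ inv) s fs n ⟩
      act (proj₁ inv ⊗ g) s n                       ≈⟨ act-⊗ (proj₁ inv) g s n ⟩
      act (proj₁ inv) (act g s) n                   ≈⟨ act-cong (proj₁ inv) (act-rem g s fs) n ⟩
      act (proj₁ inv) (act (poly (rem g)) s) n      ≈⟨ proj₂ inv s fs n ⟩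
      s n                                           ≈⟨ act-one s n ⟨
      act one s n                                   ∎
      where
      inv = nonzero-invertible f irr (rem g)
              (λ z → g≉0 (λ s fs n → trans (act-rem g s fs n) (act-IsZero z s n)))

  quotientField : FiniteField
  quotientField = record
    { commRing = commutativeRing
    ; size = size ℕ.^ suc j
    ; enumeration = record
      { to = to
      ; from = from
      ; to-cong = λ { ≡.refl _ _ _ → refl }
      ; from-cong = λ {g} {h} → from-cong {g} {h}
      ; inverse = (λ { {g} ≡.refl → to-from g })
                , (λ {i} {g} e → ≡.trans (from-cong {g} {to i} e) (from-to i))
      }
    ; 1≉0 = invertible-nonzero {one} (one , λ s _ n → trans (act-one (act one s) n) (act-one s n))
    ; inverse = inverseᴷ
    }

module PolynomialRing (F : FiniteField) {p : ℕ} (pr : Prime p)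
                      (p≈0 : FiniteField._≈_ F (natCast F p) (FiniteField.0# F)) where
  open FiniteField F hiding (zero)
  open Polynomials commRing
  open import Data.Unit using (⊤; tt)

  private
    Everything : Seq → Set
    Everything _ = ⊤

  open ActionRing commRing Everything public
  open import Algebra.Properties.Semiring.Exp (CommutativeRing.semiring commutativeRing) public using (_^_; ^-assocʳ; ^-congˡ)

  act-frobenius : ∀ g s n → act ((g ⊕ neg one) ^ p) s n ≈ act (g ^ p ⊕ neg one) s n
  act-frobenius g s n = Frobenius.frobenius-‿1 commutativeRing pr char g s tt n
    where
    char : natCastᴾ p ≃ []
    char s _ n = trans (act-cast p s n) (trans (*-congʳ p≈0) (zeroˡ _))

-- Extensions with a linear functional

-- φ is a linear functional; neither ι nor φ is asked to be multiplicative, which makes towers immediate.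
record Extension (F : FiniteField) (j : ℕ) : Set₁ where
  private module F = FiniteField F
  field
    top : FiniteField
  private module K = FiniteField top
  field
    ι      : F.Carrier → K.Carrier
    φ      : K.Carrier → F.Carrier
    φ-cong : ∀ {x y} → x K.≈ y → φ x F.≈ φ y
    φ-+    : ∀ x y → φ (x K.+ y) F.≈ φ x F.+ φ y
    φ-ι    : ∀ c x → φ (ι c K.* x) F.≈ c F.* φ x
    φ-1    : φ K.1# F.≈ F.1#
    size-≡ : K.size ≡ F.size ℕ.^ j
    char   : ∀ p → natCast F p F.≈ F.0# → natCast top p K.≈ K.0#

tower : ∀ {F i j} (E : Extension F i) → Extension (Extension.top E) j → Extension F (i ℕ.* j)
tower {F} {i} {j} E E′ = record
  { top = E′.top
  ; ι = E′.ι ∘ E.ι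
  ; φ = E.φ ∘ E′.φ
  ; φ-cong = E.φ-cong ∘ E′.φ-cong
  ; φ-+ = λ x y → F.trans (E.φ-cong (E′.φ-+ x y)) (E.φ-+ _ _)
  ; φ-ι = λ c x → F.trans (E.φ-cong (E′.φ-ι (E.ι c) x)) (E.φ-ι c _)
  ; φ-1 = F.trans (E.φ-cong E′.φ-1) E.φ-1
  ; size-≡ = ≡.trans E′.size-≡ (≡.trans (≡.cong (ℕ._^ j) E.size-≡) (ℕₚ.^-*-assoc F.size i j))
  ; char = λ p → E′.char p ∘ E.char p
  }
  where
  module F = FiniteField F
  module E = Extension E
  module E′ = Extension E′

-- Extensions of degree at most 4

module Extensions (F : FiniteField) where
  open FiniteField F hiding (zero)
  open IntegralSolver commRing
  open Polynomials commRing
  open FieldProperties F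
  open Coding F
  open Irreducibility F
  open RecurrenceSolution F
  open import Data.Fin using (zero; suc)
  open import Data.Vec using (replicate)
  open import Relation.Nullary.Decidable using (map′)
  open import Relation.Binary.Reasoning.Setoid setoid

  quotientExtension : ∀ {j} (f : Vec Carrier (suc j)) → Irreducible f → Extension F (suc j)
  quotientExtension f irr = record
    { top = quotientField
    ; ι = λ c → c ∷ []
    -- Well defined because the solution lies in the kernel of f, and 1 goes to its initial value 1.
    ; φ = λ g → act g (solution f) 0
    ; φ-cong = λ e → e (solution f) (solution-kernel f) 0
    ; φ-+ = λ g h → act-⊕ g h (solution f) 0
    ; φ-ι = λ c g → trans (act-⊗ (c ∷ []) g (solution f) 0) (+-identityʳ _)
    ; φ-1 = act-one (solution f) 0
    ; size-≡ = ≡.refl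
    ; char = λ p p≈0 s _ n → trans (act-cast p s n) (trans (*-congʳ p≈0) (zeroˡ _))
    }
    where open QuotientField F f irr

  -- The class of x is a nonzero element of F[x]/(f), hence a (q^deg f − 1)-st root of unity.
  irreducible-period : ∀ {j} (f : Vec Carrier (suc j)) → Irreducible f → ¬ eval (mon f) 0# ≈ 0# →
    ∀ s → Ker (mon f) s → ∀ n → s (n ℕ.+ (size ℕ.^ suc j ℕ.∸ 1)) ≈ s n
  irreducible-period {j} f@(c ∷ v) irr f0≉0 s fs n = begin
    s (n ℕ.+ N)                 ≈⟨ act-X^ N s n ⟨
    act (X K.^ N) s n           ≈⟨ K.fermat X≉0 s fs n ⟩
    act one s n                 ≈⟨ act-one s n ⟩
    s n                         ∎
    where
    open QuotientField F f irr
    module K = FieldProperties quotientField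
    N = size ℕ.^ suc j ℕ.∸ 1

    -- If x acted as zero, the solution would be 1, 0, 0, ..., and f would send it to f(0) at index
    -- 0.
    X≉0 : ¬ X ≃ []
    X≉0 X≈0 = f0≉0 (begin
      c + 0# * eval (mon v) 0#                  ≈⟨ solve 2 (λ c e → c :+ con (0 , 0) :* e := c :* con (1 , 0) :+ con (0 , 0)) refl c _ ⟩
      c * 1# + 0#                               ≈⟨ +-congˡ (act-zero (mon v) shifted 0) ⟨
      c * 1# + act (mon v) (solution f ∘ ℕ.suc) 0 ≡⟨ ≡.cong (c * 1# +_) (act-suc (mon v) (solution f) 0) ⟩
      act (mon f) (solution f) 0                ≈⟨ solution-kernel f 0 ⟩
      0#                                        ∎)
      where
      shifted : ∀ n → solution f (ℕ.suc n) ≈ 0#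
      shifted n = trans (sym (act-X (solution f) n)) (X≈0 (solution f) (solution-kernel f) n)

  eval-cong : ∀ g {x y} → x ≈ y → eval g x ≈ eval g y
  eval-cong []      e = refl
  eval-cong (c ∷ g) e = +-congˡ (*-cong e (eval-cong g e))

  HasRoot : ∀ {j} → Vec Carrier j → Set
  HasRoot v = ∃ λ r → eval (mon v) r ≈ 0#

  hasRoot? : ∀ {j} (v : Vec Carrier j) → Dec (HasRoot v)
  hasRoot? v = map′ (λ (i , e) → element i , e)
                    (λ (r , e) → index r , trans (eval-cong (mon v) (element-index r)) e)
                    (Finₚ.any? (λ i → eval (mon v) (element i) ≟ 0#))

  divisor-root : ∀ {m i} (f : Poly) (Q : Vec Carrier m) (g : Vec Carrier i) → f ≅ mon Q ∘ mon g →
                 HasRoot Q ⊎ HasRoot g → ∃ λ r → eval f r ≈ 0#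
  divisor-root f Q g e (inj₁ (r , root)) = r , trans (eval-∘ f (mon Q) (mon g) e r) (trans (*-congʳ root) (zeroˡ _))
  divisor-root f Q g e (inj₂ (r , root)) = r , trans (eval-∘ f (mon Q) (mon g) e r) (trans (*-congˡ root) (zeroʳ _))

  linear-hasRoot : (v : Vec Carrier 1) → HasRoot v
  linear-hasRoot (a ∷ []) = - a , solve 1 (λ a → a :+ (:- a) :* (con (1 , 0) :+ (:- a) :* con (0 , 0)) := con (0 , 0)) refl a

  factor : ∀ m {i} (v : Vec Carrier (m ℕ.+ i)) (g : Vec Carrier i) → IsZero (proj₂ (monicDivMod m v g)) →
           mon v ≅ mon (proj₁ (monicDivMod m v g)) ∘ mon g
  factor m v g z s n = trans (act-monicDivMod m v g s n) (trans (+-congˡ (act-IsZero z s n)) (+-identityʳ _))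

  irreducible₁ : (f : Vec Carrier 1) → Irreducible f
  irreducible₁ f zero    i () g z
  irreducible₁ f (suc m) i () g z

  -- A proper factorisation in degree 2 or 3 contains a linear factor, hence a root. The absurd
  -- clauses discard pairs of degrees with the wrong sum.
  irreducible₂ : (f : Vec Carrier 2) → ¬ HasRoot f → Irreducible f
  irreducible₂ f ¬root zero zero ≡.refl g z =
    ¬root (divisor-root (mon f) (proj₁ (monicDivMod 1 f g)) g (factor 1 f g z) (inj₂ (linear-hasRoot g)))
  irreducible₂ f ¬root zero (suc i) () g z
  irreducible₂ f ¬root (suc zero) i () g z
  irreducible₂ f ¬root (suc (suc m)) i () g z

  irreducible₃ : (f : Vec Carrier 3) → ¬ HasRoot f → Irreducible f
  irreducible₃ f ¬root zero (suc zero) ≡.refl g z =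
    ¬root (divisor-root (mon f) (proj₁ (monicDivMod 1 f g)) g (factor 1 f g z) (inj₁ (linear-hasRoot (proj₁ (monicDivMod 1 f g)))))
  irreducible₃ f ¬root (suc zero) zero ≡.refl g z =
    ¬root (divisor-root (mon f) (proj₁ (monicDivMod 2 f g)) g (factor 2 f g z) (inj₂ (linear-hasRoot g)))
  irreducible₃ f ¬root zero zero () g z
  irreducible₃ f ¬root zero (suc (suc i)) () g z
  irreducible₃ f ¬root (suc zero) (suc i) () g z
  irreducible₃ f ¬root (suc (suc zero)) i () g z
  irreducible₃ f ¬root (suc (suc (suc m))) i () g z

  act-x^n : ∀ n s k → act (mon (replicate n 0#)) s k ≈ s (k ℕ.+ n)
  act-x^n n s k = trans (act-mon (replicate n 0#) s k) (trans (+-congʳ (act-replicate-0 n s k)) (+-identityˡ _))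

  mon-injective : ∀ {k} (v w : Vec Carrier k) → (∀ s n → act (mon v) s n ≈ act (mon w) s n) → IsZero (subtract v 1# w)
  mon-injective {k} v w e = annihilates-all⇒IsZero (subtract v 1# w) λ s → begin
    act (poly (subtract v 1# w)) s 0              ≈⟨ act-subtract v 1# w s 0 ⟩
    act (poly v) s 0 - 1# * act (poly w) s 0
      ≈⟨ solve 3 (λ a b t → a :- con (1 , 0) :* b := a :+ t :- (b :+ t)) refl _ _ (s k) ⟩
    act (poly v) s 0 + s k - (act (poly w) s 0 + s k)
      ≈⟨ +-cong (act-mon v s 0) (-‿cong (act-mon w s 0)) ⟨
    act (mon v) s 0 - act (mon w) s 0             ≈⟨ +-congʳ (e s 0) ⟩
    act (mon w) s 0 - act (mon w) s 0             ≈⟨ -‿inverseʳ _ ⟩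
    0#                                            ∎

  act-mon-decode-encode : ∀ {k} (v : Vec Carrier k) s n → act (mon (decode k (encode v))) s n ≈ act (mon v) s n
  act-mon-decode-encode {k} v s n = trans (act-mon (decode k (encode v)) s n)
    (trans (+-congʳ (act-decode-encode v s n)) (sym (act-mon v s n)))

  private
    encode-injective-mon : ∀ {k} (v w : Vec Carrier k) → encode v ≡ encode w → ∀ s n → act (mon v) s n ≈ act (mon w) s n
    encode-injective-mon {k} v w eq s n = trans (sym (act-mon-decode-encode v s n))
      (trans (reflexive (≡.cong (λ c → act (mon (decode k c)) s n) eq)) (act-mon-decode-encode w s n))

    -- Among the n + 1 values c, h 0, ..., h (n - 1) two coincide, and by injectivity one of them is
    -- the leading c.
    injective⇒surjective : ∀ {n} (h : Fin n → Fin n) → (∀ i j → h i ≡ h j → i ≡ j) → ∀ c → ∃ λ i → h i ≡ c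
    injective⇒surjective {n} h inj c with Finₚ.pigeonhole (ℕₚ.n<1+n n) g
      where
      g : Fin (ℕ.suc n) → Fin n
      g zero    = c
      g (suc i) = h i
    ... | zero  , suc j , _   , eq = j , ≡.sym eq
    ... | suc i , suc j , i<j , eq = ⊥-elim (ℕₚ.<-irrefl (≡.cong (ℕ.suc ∘ toℕ) (inj i j eq)) i<j)

  -- If every monic polynomial had a root, f ↦ (root of f, cofactor) would be an injection of a
  -- finite set into itself, hence onto; but x^{i+1}(x − 1) arises from two different pairs.
  module _ (i : ℕ) where

    private
      d = ℕ.suc (ℕ.suc i)

      -- A vector of length d is read as a root followed by the d - 1 lower coefficients of a
      -- cofactor, so such pairs and the monic polynomials of degree d share one finite set of
      -- codes.
      product : Vec Carrier d → Seq → Seq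
      product (r ∷ Q) s = act (mon Q) (act (mon (linear r)) s)

      product-injective : ∀ v w → encode v ≡ encode w → ∀ s n → product v s n ≈ product w s n
      product-injective (r ∷ Q) (r′ ∷ Q′) eq s n =
        trans (encode-injective-mon Q Q′ (proj₂ both) _ n)
              (act-cong (mon Q′) (λ n → +-congʳ (*-congʳ (-‿cong (index-injective (proj₁ both))))) n)
        where both = Finₚ.combine-injective (index r) (encode Q) (index r′) (encode Q′) eq

      mon-unique : ∀ k k′ → (∀ s n → act (mon (decode d k)) s n ≈ act (mon (decode d k′)) s n) → k ≡ k′
      mon-unique k k′ e = ≡.trans (≡.sym (encode-decode d k)) (≡.trans
        (encode-cong (decode d k) (decode d k′) (mon-injective (decode d k) (decode d k′) e)) (encode-decode d k′))

      pair₀ pair₁ : Vec Carrier d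
      pair₀ = 0# ∷ (linear 1# ⊠ replicate i 0#)
      pair₁ = 1# ∷ replicate (ℕ.suc i) 0#

      act-linear-0 : ∀ s n → act (mon (linear 0#)) s n ≈ s (ℕ.suc n)
      act-linear-0 s n = solve 2 (λ a b → (:- con (0 , 0)) :* a :+ (con (1 , 0) :* b :+ con (0 , 0)) := b) refl (s n) (s (ℕ.suc n))

      same-product : ∀ s n → product pair₀ s n ≈ product pair₁ s n
      same-product s n = begin
        act (mon (linear 1# ⊠ replicate i 0#)) (act (mon (linear 0#)) s) n
          ≈⟨ act-⊠ (linear 1#) (replicate i 0#) _ n ⟩
        act (mon (linear 1#)) (act (mon (replicate i 0#)) (act (mon (linear 0#)) s)) n
          ≈⟨ act-cong (mon (linear 1#)) (λ m → trans (act-x^n i _ m)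
               (trans (act-linear-0 s (m ℕ.+ i)) (reflexive (≡.cong s (≡.sym (ℕₚ.+-suc m i)))))) n ⟩
        act (mon (linear 1#)) (λ m → s (m ℕ.+ ℕ.suc i)) n
          ≡⟨ act-shift (mon (linear 1#)) s (ℕ.suc i) n ⟩
        act (mon (linear 1#)) s (n ℕ.+ ℕ.suc i)
          ≈⟨ act-x^n (ℕ.suc i) _ n ⟨
        act (mon (replicate (ℕ.suc i) 0#)) (act (mon (linear 1#)) s) n ∎

      not-all-rootful : ¬ (∀ k → HasRoot (decode d k))
      not-all-rootful roots = 1≉0 (sym (index-injective (Finₚ.combine-injectiveˡ (index 0#) _ (index 1#) _ pairs≡)))
        where
        cofactor : ∀ k → _
        cofactor k = factor-root (decode d k) (proj₁ (roots k)) (proj₂ (roots k))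

        pair : Fin (size ℕ.^ d) → Vec Carrier d
        pair k = proj₁ (roots k) ∷ proj₁ (cofactor k)

        pair-product : ∀ k s n → act (mon (decode d k)) s n ≈ product (pair k) s n
        pair-product k = proj₂ (cofactor k)

        code : Fin (size ℕ.^ d) → Fin (size ℕ.^ d)
        code k = encode (pair k)

        code-injective : ∀ k k′ → code k ≡ code k′ → k ≡ k′
        code-injective k k′ eq = mon-unique k k′ λ s n → trans (pair-product k s n)
          (trans (product-injective (pair k) (pair k′) eq s n) (sym (pair-product k′ s n)))

        -- Surjectivity gives a preimage of each pair. The equal products make both preimages the
        -- same polynomial, whose one code would then belong to two different pairs.
        hit₀ = injective⇒surjective code code-injective (encode pair₀)
        hit₁ = injective⇒surjective code code-injective (encode pair₁)

        hits≡ : proj₁ hit₀ ≡ proj₁ hit₁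
        hits≡ = mon-unique (proj₁ hit₀) (proj₁ hit₁) λ s n → begin
          act (mon (decode d (proj₁ hit₀))) s n   ≈⟨ pair-product (proj₁ hit₀) s n ⟩
          product (pair (proj₁ hit₀)) s n         ≈⟨ product-injective (pair (proj₁ hit₀)) pair₀ (proj₂ hit₀) s n ⟩
          product pair₀ s n                       ≈⟨ same-product s n ⟩
          product pair₁ s n                       ≈⟨ product-injective (pair (proj₁ hit₁)) pair₁ (proj₂ hit₁) s n ⟨
          product (pair (proj₁ hit₁)) s n         ≈⟨ pair-product (proj₁ hit₁) s n ⟨
          act (mon (decode d (proj₁ hit₁))) s n   ∎

        pairs≡ : encode pair₀ ≡ encode pair₁
        pairs≡ = ≡.trans (≡.sym (proj₂ hit₀)) (≡.trans (≡.cong code hits≡) (proj₂ hit₁))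

    rootless : Σ (Vec Carrier d) λ v → ¬ HasRoot v
    rootless = decode d (proj₁ found) , proj₂ found
      where
      found = Finₚ.¬∀⟶∃¬ (size ℕ.^ d) (λ k → HasRoot (decode d k)) (λ k → hasRoot? (decode d k)) not-all-rootful

  -- F itself, as F[x]/(x), so that degree one falls under the general construction.
  extension₁ : Extension F 1
  extension₁ = quotientExtension (0# ∷ []) (irreducible₁ (0# ∷ []))

  extension₂ : Extension F 2
  extension₂ = quotientExtension (proj₁ (rootless 0)) (irreducible₂ (proj₁ (rootless 0)) (proj₂ (rootless 0)))

  extension₃ : Extension F 3
  extension₃ = quotientExtension (proj₁ (rootless 1)) (irreducible₃ (proj₁ (rootless 1)) (proj₂ (rootless 1)))

-- A quartic without roots may still be a product of two quadratics, so two quadratic steps replace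
-- the search for an irreducible quartic.
extension₄ : ∀ F → Extension F 4
extension₄ F = tower (Extensions.extension₂ F) (Extensions.extension₂ (Extension.top (Extensions.extension₂ F)))

-- Periods, and products of sequences with coprime periods

module Periods (F : FiniteField) where
  open FiniteField F hiding (zero)
  open Polynomials commRing
  open FieldProperties F
  open Arithmetic
  open import Data.Nat.Solver using (module +-*-Solver)
  open import Relation.Binary.Reasoning.Setoid setoid

  Periodic : Seq → ℕ → Set
  Periodic a m = ∀ n → a (n ℕ.+ m) ≈ a n

  -- Stronger than minimality among eventual periods: divisibility can be combined over coprime
  -- factors, an inequality cannot.
  Exact : Seq → ℕ → Set
  Exact a m = 0 < m × Periodic a m × (∀ m′ → IsEventualPeriod F a m′ → m ∣ m′)

  exact⇒hasPeriod : ∀ {a m} → Exact a m → HasPeriod F a m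
  exact⇒hasPeriod (0<m , periodic , minimal) =
    (0<m , 0 , λ n _ → periodic n) ,
    λ m′ m′<m eventual → ℕₚ.<⇒≱ m′<m (∣⇒≤ {{ℕ.>-nonZero (proj₁ eventual)}} (minimal m′ eventual))

  multiple-eventual : ∀ (a : Seq) {m N} → (∀ n → N ≤ n → a (n ℕ.+ m) ≈ a n) → ∀ k n → N ≤ n → a (n ℕ.+ k ℕ.* m) ≈ a n
  multiple-eventual a e zero    n N≤n = reflexive (≡.cong a (ℕₚ.+-identityʳ n))
  multiple-eventual a {m} e (suc k) n N≤n = begin
    a (n ℕ.+ (m ℕ.+ k ℕ.* m))   ≡⟨ ≡.cong a (ℕₚ.+-assoc n m _) ⟨
    a (n ℕ.+ m ℕ.+ k ℕ.* m)     ≈⟨ multiple-eventual a e k (n ℕ.+ m) (ℕₚ.≤-trans N≤n (ℕₚ.m≤m+n n m)) ⟩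
    a (n ℕ.+ m)                 ≈⟨ e n N≤n ⟩
    a n                         ∎

  periodic-multiple : ∀ (a : Seq) {m} → Periodic a m → ∀ k n → a (n ℕ.+ m ℕ.* k) ≈ a n
  periodic-multiple a {m} e k n =
    trans (reflexive (≡.cong (λ z → a (n ℕ.+ z)) (ℕₚ.*-comm m k))) (multiple-eventual a (λ n _ → e n) k n z≤n)

  -- Otherwise the remainder `N % m` would be a smaller eventual period.
  period∣ : ∀ {a m N} → HasPeriod F a m → Periodic a N → m ∣ N
  period∣ {a} {m@(suc _)} {N} ((0<m , M , e) , minimal) periodic = m%n≡0⇒n∣m N m (rem≡0 (N % m) ≡.refl)
    where
    rem≡0 : ∀ r → r ≡ N % m → r ≡ 0
    rem≡0 zero    _    = ≡.refl
    rem≡0 (suc r) r≡ = ⊥-elim (minimal (suc r) (≡.subst (_< m) (≡.sym r≡) (m%n<n N m)) (s≤s z≤n , M , λ n M≤n → begin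
      a (n ℕ.+ suc r)                              ≈⟨ multiple-eventual a e (N / m) (n ℕ.+ suc r) (ℕₚ.≤-trans M≤n (ℕₚ.m≤m+n n _)) ⟨
      a (n ℕ.+ suc r ℕ.+ N / m ℕ.* m)              ≡⟨ ≡.cong a (≡.trans (ℕₚ.+-assoc n (suc r) _)
                                                       (≡.cong (n ℕ.+_) (≡.trans (≡.cong (ℕ._+ N / m ℕ.* m) r≡) (≡.sym (m≡m%n+[m/n]*n N m))))) ⟩
      a (n ℕ.+ N)                                  ≈⟨ periodic n ⟩
      a n                                          ∎))

  private
    -- By coprimality every residue class mod d meets i + P ℕ, where u does not vanish.
    cofactor-periodic : ∀ (u b : Seq) {P d m N i} → 0 < P → 0 < d → Coprime P d → Periodic u P → Periodic b d → ¬ u i ≈ 0# →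
      (∀ n → N ≤ n → u (n ℕ.+ m) * b (n ℕ.+ m) ≈ u n * b n) → Periodic b (P ℕ.* m)
    cofactor-periodic u b {P} {suc d′} {m} {N} {i} 0<P 0<d P⊥d u-per b-per u≉0 e n = begin
      b (n ℕ.+ P ℕ.* m)   ≈⟨ transfer (P ℕ.* m) ⟨
      b (n′ ℕ.+ P ℕ.* m)  ≈⟨ *-cancelˡ u≉0 u*b ⟩
      b n′                ≡⟨ ≡.cong b (ℕₚ.+-identityʳ n′) ⟨
      b (n′ ℕ.+ 0)        ≈⟨ transfer 0 ⟩
      b (n ℕ.+ 0)         ≡⟨ ≡.cong b (ℕₚ.+-identityʳ n) ⟩
      b n                 ∎
      where
      d = suc d′
      x = proj₁ (inverse-mod P⊥d)
      y = proj₁ (proj₂ (inverse-mod P⊥d))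
      y′ = proj₁ (proj₂ (proj₂ (inverse-mod P⊥d)))
      -- Since d′ ≡ -1 mod d, w stands for n - i. With P x ≡ 1 this gives n′ = i + P t ≡ n mod d,
      -- and the summand d N in t pushes n′ beyond the threshold N.
      w = n ℕ.+ d′ ℕ.* i
      t = x ℕ.* w ℕ.+ d ℕ.* N
      n′ = i ℕ.+ P ℕ.* t

      n′≡n : n′ ℕ.+ d ℕ.* (y′ ℕ.* w) ≡ n ℕ.+ d ℕ.* (i ℕ.+ y ℕ.* w ℕ.+ P ℕ.* N)
      n′≡n = ≡.trans
        (solveℕ 7 (λ i P x w d N y′ → i :+ℕ P :*ℕ (x :*ℕ w :+ℕ d :*ℕ N) :+ℕ d :*ℕ (y′ :*ℕ w)
                     :=ℕ i :+ℕ (P :*ℕ x :+ℕ d :*ℕ y′) :*ℕ w :+ℕ d :*ℕ (P :*ℕ N)) ≡.refl i P x w d N y′)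
        (≡.trans (≡.cong (λ z → i ℕ.+ z ℕ.* w ℕ.+ d ℕ.* (P ℕ.* N)) (proj₂ (proj₂ (proj₂ (inverse-mod P⊥d)))))
        (solveℕ 5 (λ i n d′ y PN →
            i :+ℕ (conℕ 1 :+ℕ (conℕ 1 :+ℕ d′) :*ℕ y) :*ℕ (n :+ℕ d′ :*ℕ i) :+ℕ (conℕ 1 :+ℕ d′) :*ℕ PN
            :=ℕ n :+ℕ (conℕ 1 :+ℕ d′) :*ℕ (i :+ℕ y :*ℕ (n :+ℕ d′ :*ℕ i) :+ℕ PN)) ≡.refl i n d′ y (P ℕ.* N)))
        where open +-*-Solver renaming (solve to solveℕ; _:+_ to _:+ℕ_; _:*_ to _:*ℕ_; _:=_ to _:=ℕ_; con to conℕ)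

      transfer : ∀ k → b (n′ ℕ.+ k) ≈ b (n ℕ.+ k)
      transfer k = begin
        b (n′ ℕ.+ k)                         ≈⟨ periodic-multiple b b-per (y′ ℕ.* w) (n′ ℕ.+ k) ⟨
        b (n′ ℕ.+ k ℕ.+ d ℕ.* (y′ ℕ.* w))    ≡⟨ ≡.cong b (≡.trans (swap n′ k _) (≡.trans (≡.cong (ℕ._+ k) n′≡n) (swap n _ k))) ⟩
        b (n ℕ.+ k ℕ.+ d ℕ.* (i ℕ.+ y ℕ.* w ℕ.+ P ℕ.* N))  ≈⟨ periodic-multiple b b-per (i ℕ.+ y ℕ.* w ℕ.+ P ℕ.* N) (n ℕ.+ k) ⟩
        b (n ℕ.+ k)                          ∎
        where
        swap : ∀ a b c → a ℕ.+ b ℕ.+ c ≡ a ℕ.+ c ℕ.+ b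
        swap a b c = ≡.trans (ℕₚ.+-assoc a b c) (≡.trans (≡.cong (a ℕ.+_) (ℕₚ.+-comm b c)) (≡.sym (ℕₚ.+-assoc a c b)))

      N≤n′ : N ≤ n′
      N≤n′ = ℕₚ.≤-trans (ℕₚ.m≤n*m N d) (ℕₚ.≤-trans (ℕₚ.m≤n+m (d ℕ.* N) (x ℕ.* w))
               (ℕₚ.≤-trans (ℕₚ.m≤n*m t P {{ℕ.>-nonZero 0<P}}) (ℕₚ.m≤n+m (P ℕ.* t) i)))

      -- Both indices are i plus a multiple of P, so the factor u has the nonzero value `u i` at
      -- both and can be cancelled.
      u*b : u i * b (n′ ℕ.+ P ℕ.* m) ≈ u i * b n′
      u*b = begin
        u i * b (n′ ℕ.+ P ℕ.* m)
          ≈⟨ *-congʳ (trans (sym (periodic-multiple u u-per t i)) (sym (periodic-multiple u u-per m n′))) ⟩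
        u (n′ ℕ.+ P ℕ.* m) * b (n′ ℕ.+ P ℕ.* m)  ≈⟨ multiple-eventual (λ n → u n * b n) e P n′ N≤n′ ⟩
        u n′ * b n′                              ≈⟨ *-congʳ (periodic-multiple u u-per t i) ⟩
        u i * b n′                               ∎

  -- An eventual period m of the product makes P m a period of b, so d divides P m and hence m;
  -- exchanging u and b gives P.
  exact-product : ∀ {u b : Seq} {P d i k} → Coprime P d → Exact u P → Exact b d → ¬ u i ≈ 0# → ¬ b k ≈ 0# →
                  Exact (λ n → u n * b n) (P ℕ.* d)
  exact-product {u} {b} {P} {d} P⊥d (0<P , u-per , u-min) (0<d , b-per , b-min) u≉0 b≉0 =
    ℕₚ.*-mono-< 0<P 0<d ,
    (λ n → *-cong (periodic-multiple u u-per d n)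
                  (trans (reflexive (≡.cong (λ z → b (n ℕ.+ z)) (ℕₚ.*-comm P d))) (periodic-multiple b b-per P n))) ,
    λ { m (0<m , N , e) → coprime-*-∣ P⊥d
      (coprime-divisor P⊥d (u-min (d ℕ.* m) (ℕₚ.*-mono-< 0<d 0<m , 0 ,
         λ n _ → cofactor-periodic b u 0<d 0<P (Coprimality.sym P⊥d) b-per u-per b≉0
                   (λ n N≤n → trans (*-comm _ _) (trans (e n N≤n) (*-comm _ _))) n)))
      (coprime-divisor (Coprimality.sym P⊥d) (b-min (P ℕ.* m) (ℕₚ.*-mono-< 0<P 0<m , 0 ,
         λ n _ → cofactor-periodic u b 0<P 0<d P⊥d u-per b-per u≉0 e n))) }

-- Linear recurrences and multiplication by binomial coefficients

module Recurrences (F : FiniteField) where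
  open FiniteField F hiding (zero)
  open IntegralSolver commRing
  open Polynomials commRing
  open FieldProperties F
  open Irreducibility F
  open import Algebra.Properties.Semiring.Sum semiring using (sum; sum-cong-≋)
  open import Algebra.Properties.Semiring.Mult semiring using (×-homo-+) renaming (_×_ to _·_)
  open import Algebra.Properties.Ring ring using (-0#≈0#; -‿involutive)
  open import Algebra.Properties.Group +-group using (inverseʳ-unique)
  open import Data.Fin using (zero; suc)
  open import Data.Vec using (tabulate; lookup)
  open import Data.Vec.Properties using (tabulate∘lookup)
  open import Relation.Binary.Reasoning.Setoid setoid
  open BinomialCoefficients

  Rec : ℕ → Seq → Set
  Rec k a = Σ (Vec Carrier k) λ v → ¬ eval (mon v) 0# ≈ 0# × Ker (mon v) a

  eval-at-0 : ∀ c g → eval (c ∷ g) 0# ≈ c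
  eval-at-0 c g = trans (+-congˡ (zeroˡ _)) (+-identityʳ c)

  private
    act-tabulate : ∀ {k} (g : Fin k → Carrier) a n → act (poly (tabulate g)) a n ≈ sum (λ i → g i * a (n ℕ.+ toℕ i))
    act-tabulate {ℕ.zero}  g a n = refl
    act-tabulate {ℕ.suc k} g a n = +-cong (*-congˡ (reflexive (≡.cong a (≡.sym (ℕₚ.+-identityʳ n)))))
      (trans (act-tabulate (g ∘ suc) a (ℕ.suc n))
             (sum-cong-≋ {k} {λ i → g (suc i) * a (ℕ.suc n ℕ.+ toℕ i)} (λ i → *-congˡ (reflexive (≡.cong a (≡.sym (ℕₚ.+-suc n (toℕ i))))))))

    sum-neg : ∀ {k} (g x : Fin k → Carrier) → sum (λ i → - g i * x i) ≈ - sum (λ i → g i * x i)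
    sum-neg {ℕ.zero}  g x = sym -0#≈0#
    sum-neg {ℕ.suc k} g x = trans (+-congˡ (sum-neg (g ∘ suc) (x ∘ suc)))
      (solve 3 (λ g x s → (:- g) :* x :+ (:- s) := :- (g :* x :+ s)) refl (g zero) (x zero) _)

  linRec⇒rec : ∀ {k a} → SatisfiesLinRec F (ℕ.suc k) a → Rec (ℕ.suc k) a
  linRec⇒rec {k} {a} (c , c₀≉0 , e) = v , v₀≉0 , kernel
    where
    v = tabulate (λ i → - c i)

    v₀≉0 : ¬ eval (mon v) 0# ≈ 0#
    v₀≉0 eq = c₀≉0 zero ≡.refl (trans (sym (-‿involutive _))
      (trans (-‿cong (trans (sym (eval-at-0 (- c zero) (mon (tabulate (λ i → - c (suc i)))))) eq)) -0#≈0#))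

    kernel : Ker (mon v) a
    kernel n = begin
      act (mon v) a n                              ≈⟨ act-mon v a n ⟩
      act (poly v) a n + a (n ℕ.+ ℕ.suc k)         ≈⟨ +-cong (trans (act-tabulate (λ i → - c i) a n) (sum-neg c (λ i → a (n ℕ.+ toℕ i)))) (e n) ⟩
      - S + S                                      ≈⟨ -‿inverseˡ _ ⟩
      0#                                           ∎
      where S = sum (λ i → c i * a (n ℕ.+ toℕ i))

  rec⇒linRec : ∀ {k a} → Rec (ℕ.suc k) a → SatisfiesLinRec F (ℕ.suc k) a
  rec⇒linRec {k} {a} (v@(c ∷ g) , v₀≉0 , kernel) = (λ i → - lookup v i) , nonzero , recurrence
    where
    nonzero : ∀ i → toℕ i ≡ 0 → ¬ - lookup v i ≈ 0#
    nonzero zero _ eq = v₀≉0 (trans (eval-at-0 c (mon g)) (trans (sym (-‿involutive c)) (trans (-‿cong eq) -0#≈0#)))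

    recurrence : ∀ n → a (n ℕ.+ ℕ.suc k) ≈ sum (λ i → - lookup v i * a (n ℕ.+ toℕ i))
    recurrence n = begin
      a (n ℕ.+ ℕ.suc k)                                     ≈⟨ inverseʳ-unique _ _ (trans (sym (act-mon v a n)) (kernel n)) ⟩
      - act (poly v) a n                                    ≡⟨ ≡.cong (λ z → - act (poly z) a n) (tabulate∘lookup v) ⟨
      - act (poly (tabulate (lookup v))) a n                ≈⟨ -‿cong (act-tabulate (lookup v) a n) ⟩
      - sum (λ i → lookup v i * a (n ℕ.+ toℕ i))            ≈⟨ sum-neg (lookup v) (λ i → a (n ℕ.+ toℕ i)) ⟨
      sum (λ i → - lookup v i * a (n ℕ.+ toℕ i))            ∎

  eval-⊠-nonzero : ∀ {m i} (v : Vec Carrier m) (w : Vec Carrier i) →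
    ¬ eval (mon v) 0# ≈ 0# → ¬ eval (mon w) 0# ≈ 0# → ¬ eval (mon (v ⊠ w)) 0# ≈ 0#
  eval-⊠-nonzero v w v≉0 w≉0 eq =
    *-nonzero v≉0 w≉0 (trans (sym (eval-∘ (mon (v ⊠ w)) (mon v) (mon w) (act-⊠ v w) 0#)) eq)

  -- The annihilator is multiplied by x - 1: a factor x would raise the degree too, but would spoil
  -- the nonzero constant term.
  rec-suc : ∀ {k a} → Rec k a → Rec (ℕ.suc k) a
  rec-suc (v , v₀≉0 , kernel) = linear 1# ⊠ v , eval-⊠-nonzero (linear 1#) v lin≉0 v₀≉0 ,
    λ n → trans (act-⊠ (linear 1#) v _ n) (act-zero (mon (linear 1#)) kernel n)
    where
    lin≉0 : ¬ eval (mon (linear 1#)) 0# ≈ 0#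
    lin≉0 eq = 1≉0 (sym (x-y≈0⇒x≈y (trans (sym (eval-linear 1# 0#)) eq)))

  rec-≤ : ∀ {k l a} → k ≤ l → Rec k a → Rec l a
  rec-≤ {k} {l} {a} k≤l = go (ℕₚ.≤⇒≤′ k≤l)
    where
    go : ∀ {l} → k ℕ.≤′ l → Rec k a → Rec l a
    go ℕ.≤′-refl       r = r
    go (ℕ.≤′-step k≤l) r = rec-suc (go k≤l r)

  power : ∀ {k} t → Vec Carrier k → Vec Carrier (t ℕ.* k)
  power ℕ.zero    w = []
  power (ℕ.suc t) w = w ⊠ power t w

  eval-power-nonzero : ∀ {k} t (w : Vec Carrier k) → ¬ eval (mon w) 0# ≈ 0# → ¬ eval (mon (power t w)) 0# ≈ 0#
  eval-power-nonzero ℕ.zero    w w≉0 eq = 1≉0 (trans (sym (eval-at-0 1# [])) eq)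
  eval-power-nonzero (ℕ.suc t) w w≉0 = eval-⊠-nonzero w (power t w) w≉0 (eval-power-nonzero t w w≉0)

  binom : ℕ → Seq
  binom t n = (n C t) · 1#

  binom-suc : ∀ t n → binom (ℕ.suc t) (ℕ.suc n) ≈ binom t n + binom (ℕ.suc t) n
  binom-suc t n = trans (reflexive (≡.cong (_· 1#) (≡.sym (pascal n t)))) (×-homo-+ 1# (n C t) (n C ℕ.suc t))

  binom-0 : ∀ n → binom 0 n ≈ 1#
  binom-0 n = +-identityʳ 1#

  module _ {k} (w : Vec Carrier k) where

    private
      ker-+ : ∀ g {s t} → Ker g s → Ker g t → Ker g (λ n → s n + t n)
      ker-+ g {s} {t} es et n = trans (act-+ g s t n) (trans (+-cong (es n) (et n)) (+-identityˡ _))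

      ker-cong : ∀ g {s t} → (∀ n → s n ≈ t n) → Ker g s → Ker g t
      ker-cong g e es n = trans (act-cong g (λ n → sym (e n)) n) (es n)

      ker-suc : ∀ g {s} → Ker g s → Ker g (s ∘ ℕ.suc)
      ker-suc g {s} es n = trans (reflexive (act-suc g s n)) (es (ℕ.suc n))

      ker-act : ∀ g h {s} → Ker g s → Ker g (act h s)
      ker-act g h {s} es n = trans (act-comm g h s n) (act-zero h es n)

      ker-zero : ∀ g {s} → (∀ n → s n ≈ 0#) → Ker g s
      ker-zero g = act-zero g

    -- Commuting a polynomial past multiplication by C(n,t) costs terms involving only C(n,t′), t′ < t.
    binom-kernel : ∀ t b → Ker (mon w) b → Ker (mon (power (ℕ.suc t) w)) (λ n → binom t n * b n)
    binom-commutator : ∀ t g b → Ker (mon w) b →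
      Ker (mon (power t w)) (λ n → act g (λ n → binom t n * b n) n - binom t n * act g b n)

    binom-kernel t b wb n = begin
      act (mon (w ⊠ power t w)) B n                ≈⟨ act-⊠ w (power t w) B n ⟩
      act (mon w) (act (mon (power t w)) B) n      ≈⟨ act-comm (mon w) (mon (power t w)) B n ⟩
      -- Because w kills b, the sequence w B coincides with the commutator, which is killed by one
      -- power of w less.
      act (mon (power t w)) (act (mon w) B) n      ≈⟨ ker-cong (mon (power t w)) (λ n → begin
          act (mon w) B n - binom t n * act (mon w) b n  ≈⟨ +-congˡ (-‿cong (trans (*-congˡ (wb n)) (zeroʳ _))) ⟩
          act (mon w) B n - 0#                           ≈⟨ solve 1 (λ a → a :- con (0 , 0) := a) refl _ ⟩
          act (mon w) B n                                ∎) (binom-commutator t (mon w) b wb) n ⟩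
      0#                                           ∎
      where
      B : Seq
      B n = binom t n * b n

    binom-commutator t [] b wb = ker-zero (mon (power t w)) (λ n → solve 1 (λ c → con (0 , 0) :- c :* con (0 , 0) := con (0 , 0)) refl (binom t n))
    binom-commutator ℕ.zero g@(_ ∷ _) b wb = ker-zero (mon []) λ n → begin
      act g (λ n → binom 0 n * b n) n - binom 0 n * act g b n
        ≈⟨ +-cong (act-cong g (λ n → trans (*-congʳ (binom-0 n)) (*-identityˡ _)) n)
                  (-‿cong (trans (*-congʳ (binom-0 n)) (*-identityˡ _))) ⟩
      act g b n - act g b n  ≈⟨ -‿inverseʳ _ ⟩
      0#                     ∎
    -- Pascal's rule C(n+1,t+1) = C(n,t) + C(n,t+1) splits the commutator of c + x g into the
    -- shifted commutator of g and C(n,t) times the shift of g b. Induction on g handles the former,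
    -- `binom-kernel` at t the latter.
    binom-commutator (ℕ.suc t) (c ∷ g) b wb = ker-cong W split
      (ker-+ W {λ n → D (ℕ.suc n)} (ker-suc W {D} (binom-commutator (ℕ.suc t) g b wb))
             (binom-kernel t (act g b ∘ ℕ.suc) (ker-suc (mon w) {act g b} (ker-act (mon w) g wb))))
      where
      W = mon (power (ℕ.suc t) w)
      B : Seq
      B n = binom (ℕ.suc t) n * b n

      D : Seq
      D n = act g B n - binom (ℕ.suc t) n * act g b n

      split : ∀ n → D (ℕ.suc n) + binom t n * act g b (ℕ.suc n)
                    ≈ act (c ∷ g) B n - binom (ℕ.suc t) n * act (c ∷ g) b n
      split n = trans (+-congʳ (+-congˡ (-‿cong (*-congʳ (binom-suc t n)))))
        (solve 6 (λ G x y z c β → G :- (x :+ y) :* z :+ x :* z := (c :* (y :* β) :+ G) :- y :* (c :* β :+ z)) refl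
          (act g B (ℕ.suc n)) (binom t n) (binom (ℕ.suc t) n) (act g b (ℕ.suc n)) c (b n))

  rec-binom : ∀ {k b} t → Rec k b → Rec (ℕ.suc t ℕ.* k) (λ n → binom t n * b n)
  rec-binom {b = b} t (w , w≉0 , kernel) =
    power (ℕ.suc t) w , eval-power-nonzero (ℕ.suc t) w w≉0 , binom-kernel w t b kernel

-- Periods of binomial sequences in characteristic p

module BinomialPeriods (F : FiniteField) {p : ℕ} (pr : Prime p)
                       (p≈0 : FiniteField._≈_ F (natCast F p) (FiniteField.0# F)) where
  open FiniteField F hiding (zero)
  open IntegralSolver commRing
  open Polynomials commRing
  open Periods F
  open Recurrences F
  open Arithmetic
  open BinomialCoefficients
  open Frobenius commRing using (multiple·≈0)
  open import Data.Nat.GCD using (module Bézout)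
  open import Algebra.Properties.Semiring.Mult semiring using (×-homo-+) renaming (_×_ to _·_)
  open import Relation.Binary.Reasoning.Setoid setoid

  -- Otherwise m is prime to p, and a Bézout relation between two multiples that vanish in F gives 1
  -- = 0.
  char-∣ : ∀ m → m · 1# ≈ 0# → p ∣ m
  char-∣ m m≈0 with p ∣? m
  ... | yes p∣m = p∣m
  ... | no p∤m = ⊥-elim (1≉0 (absurd (coprime-Bézout (prime∤⇒coprime pr p∤m))))
    where
    combine : ∀ k l x y → l · 1# ≈ 0# → k · 1# ≈ 0# → 1 ℕ.+ y ℕ.* l ≡ x ℕ.* k → 1# ≈ 0#
    combine k l x y l≈0 k≈0 eq = begin
      1#                       ≈⟨ +-identityʳ 1# ⟨
      1# + 0#                  ≈⟨ +-congˡ (multiple·≈0 l≈0 (n∣m*n y) 1#) ⟨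
      (1 ℕ.+ y ℕ.* l) · 1#     ≡⟨ ≡.cong (_· 1#) eq ⟩
      (x ℕ.* k) · 1#           ≈⟨ multiple·≈0 k≈0 (n∣m*n x) 1# ⟩
      0#                       ∎

    absurd : Bézout.Identity 1 p m → 1# ≈ 0#
    absurd (Bézout.+- x y eq) = combine p m x y m≈0 p≈0 eq
    absurd (Bézout.-+ x y eq) = combine m p y x p≈0 m≈0 eq

  private
    a+b≈a⇒b≈0 : ∀ {a b} → a + b ≈ a → b ≈ 0#
    a+b≈a⇒b≈0 {a} {b} eq = begin
      b              ≈⟨ solve 2 (λ a b → b := a :+ b :- a) refl a b ⟩
      a + b - a      ≈⟨ +-congʳ eq ⟩
      a - a          ≈⟨ -‿inverseʳ a ⟩
      0#             ∎

    0<p : 0 < p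
    0<p = ℕₚ.<⇒≤ (ℕ.nonTrivial⇒n>1 p {{prime⇒nonTrivial pr}})

  binom-diagonal : ∀ t → ¬ binom t t ≈ 0#
  binom-diagonal t eq = 1≉0 (trans (sym (+-identityʳ 1#)) (trans (reflexive (≡.cong (_· 1#) (≡.sym (nCn≡1 t)))) eq))

  binom₁-exact : Exact (binom 1) p
  binom₁-exact = 0<p , periodic , minimal
    where
    additive : ∀ n m → binom 1 (n ℕ.+ m) ≈ binom 1 n + m · 1#
    additive n m = trans (reflexive (≡.cong (_· 1#) (nC1≡n (n ℕ.+ m))))
      (trans (×-homo-+ 1# n m) (+-congʳ (reflexive (≡.cong (_· 1#) (≡.sym (nC1≡n n))))))

    periodic : Periodic (binom 1) p
    periodic n = trans (additive n p) (trans (+-congˡ p≈0) (+-identityʳ _))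

    minimal : ∀ m → IsEventualPeriod F (binom 1) m → p ∣ m
    minimal m (_ , N , e) = char-∣ m (a+b≈a⇒b≈0 (trans (sym (additive N m)) (e N ℕₚ.≤-refl)))

  private
    module R = PolynomialRing F pr p≈0

    Δ : Poly
    Δ = R.X ⊕ R.neg R.one

    act-difference : ∀ g s n → act (g ⊕ R.neg R.one) s n ≈ act g s n - s n
    act-difference g s n = trans (act-⊕ g (R.neg R.one) s n)
      (+-congˡ (trans (R.act-neg R.one s n) (-‿cong (R.act-one s n))))

    -- Pascal's rule in operator form: `Δ` is x - 1, the forward difference.
    Δ-binom : ∀ t n → act Δ (binom (suc t)) n ≈ binom t n
    Δ-binom t n = begin
      act Δ (binom (suc t)) n                        ≈⟨ act-difference R.X (binom (suc t)) n ⟩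
      act R.X (binom (suc t)) n - binom (suc t) n    ≈⟨ +-congʳ (trans (R.act-X (binom (suc t)) n) (binom-suc t n)) ⟩
      binom t n + binom (suc t) n - binom (suc t) n  ≈⟨ solve 2 (λ a b → a :+ b :- b := a) refl _ _ ⟩
      binom t n                                      ∎

    Δ^k-binom : ∀ k t n → act (Δ R.^ k) (binom (t ℕ.+ k)) n ≈ binom t n
    Δ^k-binom zero    t n = trans (R.act-one (binom (t ℕ.+ 0)) n) (reflexive (≡.cong (λ z → binom z n) (ℕₚ.+-identityʳ t)))
    Δ^k-binom (suc k) t n = begin
      act (Δ ⊗ (Δ R.^ k)) (binom (t ℕ.+ suc k)) n          ≈⟨ act-⊗ Δ (Δ R.^ k) (binom (t ℕ.+ suc k)) n ⟩
      act Δ (act (Δ R.^ k) (binom (t ℕ.+ suc k))) n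
        ≈⟨ act-cong Δ (λ n → trans (reflexive (≡.cong (λ z → act (Δ R.^ k) (binom z) n) (ℕₚ.+-suc t k))) (Δ^k-binom k (suc t) n)) n ⟩
      act Δ (binom (suc t)) n                           ≈⟨ Δ-binom t n ⟩
      binom t n                                         ∎

  -- (x − 1)^p = x^p − 1, applied to n ↦ C(n,p).
  binom-p-step : ∀ n → binom p (n ℕ.+ p) ≈ binom p n + 1#
  binom-p-step n = begin
    binom p (n ℕ.+ p)                              ≈⟨ R.act-X^ p (binom p) n ⟨
    act (R.X R.^ p) (binom p) n                     ≈⟨ solve 2 (λ a b → a := b :+ (a :- b)) refl _ (binom p n) ⟩
    binom p n + (act (R.X R.^ p) (binom p) n - binom p n)
      ≈⟨ +-congˡ (act-difference (R.X R.^ p) (binom p) n) ⟨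
    binom p n + act ((R.X R.^ p) ⊕ R.neg R.one) (binom p) n
      ≈⟨ +-congˡ (R.act-frobenius R.X (binom p) n) ⟨
    binom p n + act (Δ R.^ p) (binom p) n           ≈⟨ +-congˡ (Δ^k-binom p 0 n) ⟩
    binom p n + binom 0 n                          ≈⟨ +-congˡ (binom-0 n) ⟩
    binom p n + 1#                                 ∎

  binom-p-exact : Exact (binom p) (p ℕ.* p)
  binom-p-exact = ℕₚ.*-mono-< 0<p 0<p , periodic , minimal
    where
    steps : ∀ k n → binom p (n ℕ.+ k ℕ.* p) ≈ binom p n + k · 1#
    steps zero    n = trans (reflexive (≡.cong (binom p) (ℕₚ.+-identityʳ n))) (sym (+-identityʳ _))
    steps (suc k) n = begin
      binom p (n ℕ.+ (p ℕ.+ k ℕ.* p))  ≡⟨ ≡.cong (binom p) (ℕₚ.+-assoc n p _) ⟨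
      binom p (n ℕ.+ p ℕ.+ k ℕ.* p)    ≈⟨ steps k (n ℕ.+ p) ⟩
      binom p (n ℕ.+ p) + k · 1#       ≈⟨ +-congʳ (binom-p-step n) ⟩
      binom p n + 1# + k · 1#          ≈⟨ +-assoc _ _ _ ⟩
      binom p n + (1# + k · 1#)        ∎

    periodic : Periodic (binom p) (p ℕ.* p)
    periodic n = trans (steps p n) (trans (+-congˡ p≈0) (+-identityʳ _))

    -- Each step of length p adds 1. The period m p consists of m such steps, so p divides m; then m
    -- itself consists of m / p steps, so p divides m / p.
    minimal : ∀ m → IsEventualPeriod F (binom p) m → p ℕ.* p ∣ m
    minimal m (_ , N , e) = once (char-∣ m (a+b≈a⇒b≈0 (trans (sym (steps m N))
        (trans (reflexive (≡.cong (λ z → binom p (N ℕ.+ z)) (ℕₚ.*-comm m p))) (multiple-eventual (binom p) e p N ℕₚ.≤-refl)))))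
      where
      once : p ∣ m → p ℕ.* p ∣ m
      once (divides k ≡.refl) = *-monoˡ-∣ p (char-∣ k (a+b≈a⇒b≈0 (trans (sym (steps k N)) (e N ℕₚ.≤-refl))))

-- Sequences obtained from roots of unity

module RootOfUnitySequences (F : FiniteField) {j : ℕ} (E : Extension F j) where
  open FiniteField F hiding (zero)
  open IntegralSolver commRing
  open Polynomials commRing
  open FieldProperties F
  open Coding F
  open Irreducibility F
  open Periods F
  open Recurrences F
  open Extension E
  open import Relation.Binary.Reasoning.Setoid setoid
  open import Data.Vec.Relation.Unary.All using ([]; _∷_)
  private
    module K where
      open FiniteField top public
      open FieldProperties top public
      open IntegralSolver (FiniteField.commRing top) public

  module _ {β : K.Carrier} {d : ℕ} (0<d : 0 < d) (order : K.HasOrder β d) where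

    trace : Seq
    trace n = φ (β K.^ n)

    private
      φ-0 : φ K.0# ≈ 0#
      φ-0 = begin
        φ K.0#                        ≈⟨ solve 1 (λ a → a := a :+ a :- a) refl _ ⟩
        φ K.0# + φ K.0# - φ K.0#      ≈⟨ +-congʳ (trans (sym (φ-+ K.0# K.0#)) (φ-cong (K.+-identityˡ K.0#))) ⟩
        φ K.0# - φ K.0#               ≈⟨ -‿inverseʳ _ ⟩
        0#                            ∎

    trace-0 : ¬ trace 0 ≈ 0#
    trace-0 eq = 1≉0 (trans (sym φ-1) eq)

    trace-periodic : Periodic trace d
    trace-periodic n = φ-cong (K.trans (K.^-homo-* β n d) (K.trans (K.*-congˡ (proj₁ order)) (K.*-identityʳ _)))

    -- If δ = β^m − 1 were nonzero, φ would kill β^n δ^t for all t ≥ 1 and large n, among them 1.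
    trace-exact : Exact trace d
    trace-exact = 0<d , trace-periodic , minimal
      where
      minimal : ∀ m → IsEventualPeriod F trace m → d ∣ m
      minimal m (_ , N , e) = decide (β K.^ m K.≟ K.1#)
        where
        δ = β K.^ m K.- K.1#

        y : ℕ → Seq
        y t n = φ (β K.^ n K.* δ K.^ t)

        y-suc : ∀ t n → y (suc t) n + y t n ≈ y t (n ℕ.+ m)
        y-suc t n = trans (sym (φ-+ _ _)) (φ-cong (K.trans
          (K.solve 3 (λ b μ D → b K.:* ((μ K.:- K.con (1 , 0)) K.:* D) K.:+ b K.:* D K.:= b K.:* μ K.:* D) K.refl
            (β K.^ n) (β K.^ m) (δ K.^ t))
          (K.*-congʳ (K.sym (K.^-homo-* β n m)))))

        y≈0 : ∀ t n → N ≤ n → y (suc t) n ≈ 0#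
        y-period : ∀ t n → N ≤ n → y t (n ℕ.+ m) ≈ y t n
        y≈0 t n N≤n = begin
          y (suc t) n                   ≈⟨ solve 2 (λ a b → a := a :+ b :- b) refl _ (y t n) ⟩
          y (suc t) n + y t n - y t n   ≈⟨ +-congʳ (trans (y-suc t n) (y-period t n N≤n)) ⟩
          y t n - y t n                 ≈⟨ -‿inverseʳ _ ⟩
          0#                            ∎
        y-period zero    n N≤n = trans (φ-cong (K.*-identityʳ _)) (trans (e n N≤n) (φ-cong (K.sym (K.*-identityʳ _))))
        y-period (suc t) n N≤n = trans (y≈0 t (n ℕ.+ m) (ℕₚ.≤-trans N≤n (ℕₚ.m≤m+n n m))) (sym (y≈0 t n N≤n))

        decide : Dec (β K.^ m K.≈ K.1#) → d ∣ m
        decide (yes β^m≈1) = proj₂ order m β^m≈1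
        -- 1 is written as β^(N d) δ^(size - 1): the first power is 1 with exponent at least N, the
        -- second is 1 by Fermat. The exponent of δ is put as a successor so that `y≈0` applies.
        decide (no β^m≉1) = ⊥-elim (1≉0 (begin
          1#                                              ≈⟨ φ-1 ⟨
          φ K.1#                                          ≈⟨ φ-cong (K.trans (K.sym (K.*-identityˡ K.1#))
                                                              (K.*-cong (K.sym (K.^-∣ β d (proj₁ order) (n∣m*n N))) (K.sym δ^≈1))) ⟩
          y (suc (K.size ℕ.∸ 2)) (N ℕ.* d)                ≈⟨ y≈0 (K.size ℕ.∸ 2) (N ℕ.* d) (ℕₚ.m≤m*n N d {{ℕ.>-nonZero 0<d}}) ⟩
          0#                                              ∎))
          where
          δ^≈1 : δ K.^ suc (K.size ℕ.∸ 2) K.≈ K.1#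
          δ^≈1 = K.trans (K.^-congʳ δ (≡.sym (ℕₚ.+-∸-assoc 1 K.size>1))) (K.fermat (β^m≉1 ∘ K.x-y≈0⇒x≈y))

    private
      evalK : Poly → K.Carrier
      evalK []      = K.0#
      evalK (c ∷ g) = ι c K.+ β K.* evalK g

      φ-evalK : ∀ g n → φ (evalK g K.* β K.^ n) ≈ act g trace n
      φ-evalK []      n = trans (φ-cong (K.zeroˡ _)) φ-0
      φ-evalK (c ∷ g) n = begin
        φ ((ι c K.+ β K.* evalK g) K.* β K.^ n)
          ≈⟨ φ-cong (K.solve 4 (λ c b g B → (c K.:+ b K.:* g) K.:* B K.:= c K.:* B K.:+ g K.:* (b K.:* B)) K.refl (ι c) β (evalK g) (β K.^ n)) ⟩
        φ (ι c K.* β K.^ n K.+ evalK g K.* β K.^ suc n)        ≈⟨ φ-+ _ _ ⟩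
        φ (ι c K.* β K.^ n) + φ (evalK g K.* β K.^ suc n)      ≈⟨ +-cong (φ-ι c _) (φ-evalK g (suc n)) ⟩
        c * trace n + act g trace (suc n)                      ∎

      -- There are q^(j+1) polynomials of degree at most j but only q^j values at β, so two of them
      -- agree at β, and their difference is the annihilator.
      annihilator : Σ (Vec Carrier (suc j)) λ w → ¬ IsZero w × Ker (poly w) trace
      annihilator = subtract v 1# v′ , nonzero , kernel
        where
        value : Fin (size ℕ.^ suc j) → Fin (size ℕ.^ j)
        value k = ≡.subst Fin size-≡ (K.index (evalK (poly (decode (suc j) k))))

        bound : size ℕ.^ j < size ℕ.^ suc j
        bound = ℕₚ.^-monoʳ-< size size>1 (ℕₚ.n<1+n j)

        collision = Finₚ.pigeonhole bound value
        k = proj₁ collision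
        k′ = proj₁ (proj₂ collision)
        v = decode (suc j) k
        v′ = decode (suc j) k′

        same : evalK (poly v) K.≈ evalK (poly v′)
        same = K.index-injective (≡.subst-injective size-≡ (proj₂ (proj₂ (proj₂ collision))))

        nonzero : ¬ IsZero (subtract v 1# v′)
        nonzero z = ℕₚ.<-irrefl (≡.cong toℕ k≡k′) (proj₁ (proj₂ (proj₂ collision)))
          where
          k≡k′ : k ≡ k′
          k≡k′ = ≡.trans (≡.sym (encode-decode (suc j) k)) (≡.trans (encode-cong v v′ z) (encode-decode (suc j) k′))

        -- The subtraction takes place in F, after φ, since ι is not known to be additive.
        kernel : Ker (poly (subtract v 1# v′)) trace
        kernel n = begin
          act (poly (subtract v 1# v′)) trace n                ≈⟨ act-subtract v 1# v′ trace n ⟩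
          act (poly v) trace n - 1# * act (poly v′) trace n    ≈⟨ +-congˡ (-‿cong (*-identityˡ _)) ⟩
          act (poly v) trace n - act (poly v′) trace n         ≈⟨ +-cong (φ-evalK (poly v) n) (-‿cong (φ-evalK (poly v′) n)) ⟨
          φ (evalK (poly v) K.* B) - φ (evalK (poly v′) K.* B) ≈⟨ +-congʳ (φ-cong (K.*-congʳ same)) ⟩
          φ (evalK (poly v′) K.* B) - φ (evalK (poly v′) K.* B) ≈⟨ -‿inverseʳ _ ⟩
          0#                                                   ∎
          where B = β K.^ n

    -- The annihilator may be divisible by x and need not be monic. Factors x are stripped, which is
    -- harmless because the shift is invertible on a periodic sequence; then the leading coefficient
    -- is divided out and the degree is padded to j.
    trace-rec : Rec j trace
    trace-rec = strip (proj₁ annihilator) (proj₁ (proj₂ annihilator)) (proj₂ (proj₂ annihilator)) ℕₚ.≤-refl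
      where
      strip : ∀ {n} (w : Vec Carrier n) → ¬ IsZero w → Ker (poly w) trace → n ≤ suc j → Rec j trace
      normalise : ∀ {n} a (w : Vec Carrier n) → ¬ a ≈ 0# → Ker (poly (a ∷ w)) trace → suc n ≤ suc j → Leading (a ∷ w) → Rec j trace

      strip []      nonzero _ _ = ⊥-elim (nonzero [])
      strip (a ∷ w) nonzero kernel n≤ = decide (a ≟ 0#)
        where
        decide : Dec (a ≈ 0#) → Rec j trace
        decide (no a≉0) = normalise a w a≉0 kernel n≤ (leading (a ∷ w) nonzero)
        decide (yes a≈0) = strip w (nonzero ∘ (a≈0 ∷_)) tail-kernel (ℕₚ.≤-trans (ℕₚ.n≤1+n _) n≤)
          where
          shifted : ∀ n → act (poly w) trace (suc n) ≈ 0#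
          shifted n = begin
            act (poly w) trace (suc n)                  ≈⟨ +-identityˡ _ ⟨
            0# + act (poly w) trace (suc n)             ≈⟨ +-congʳ (trans (*-congʳ a≈0) (zeroˡ _)) ⟨
            a * trace n + act (poly w) trace (suc n)    ≈⟨ kernel n ⟩
            0#                                          ∎

          tail-kernel : Ker (poly w) trace
          tail-kernel n = begin
            act (poly w) trace n                          ≈⟨ act-cong (poly w) trace-periodic n ⟨
            act (poly w) (λ n → trace (n ℕ.+ d)) n        ≡⟨ act-shift (poly w) trace d n ⟩
            act (poly w) trace (n ℕ.+ d)                  ≡⟨ ≡.cong (act (poly w) trace) (≡.trans (≡.cong (n ℕ.+_) (≡.sym (ℕₚ.m+[n∸m]≡n 0<d))) (ℕₚ.+-suc n _)) ⟩
            act (poly w) trace (suc (n ℕ.+ (d ℕ.∸ 1)))    ≈⟨ shifted _ ⟩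
            0#                                            ∎

      normalise a w a≉0 kernel n≤ (e , e<n , v , c , c≉0 , spec) = rec-≤ (ℕₚ.≤-pred (ℕₚ.≤-trans e<n n≤)) (v , v₀≉0 , v-kernel)
        where
        -- The constant term survives the normalisation: evaluation at 0 is the action on the
        -- sequence 0^n = 1, 0, 0, ....
        v₀≉0 : ¬ eval (mon v) 0# ≈ 0#
        v₀≉0 eq = a≉0 (begin
          a                                   ≈⟨ eval-at-0 a (poly w) ⟨
          eval (poly (a ∷ w)) 0#              ≈⟨ *-identityʳ _ ⟨
          eval (poly (a ∷ w)) 0# * 1#         ≈⟨ act-geometric (poly (a ∷ w)) 0# 0 ⟨
          act (poly (a ∷ w)) (0# ^_) 0        ≈⟨ spec (0# ^_) 0 ⟩
          c * act (mon v) (0# ^_) 0           ≈⟨ *-congˡ (act-geometric (mon v) 0# 0) ⟩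
          c * (eval (mon v) 0# * 1#)          ≈⟨ *-congˡ (trans (*-congʳ eq) (zeroˡ _)) ⟩
          c * 0#                              ≈⟨ zeroʳ c ⟩
          0#                                  ∎)

        v-kernel : Ker (mon v) trace
        v-kernel n = x*y≈0⇒y≈0 c≉0 (trans (sym (spec trace n)) (kernel n))

-- Lower bounds: realising the periods

module LowerBounds (F : FiniteField) {p : ℕ} (pr : Prime p)
                   (p≈0 : FiniteField._≈_ F (natCast F p) (FiniteField.0# F)) where
  open FiniteField F hiding (zero)
  open Periods F
  open Recurrences F
  open BinomialPeriods F pr p≈0
  open Arithmetic

  inP : ∀ {k a m} → Rec (suc k) a → Exact a m → InP F (suc k) m
  inP {a = a} rec exact = a , rec⇒linRec rec , exact⇒hasPeriod exact

  inP-≤ : ∀ {k l m} → suc k ≤ suc l → InP F (suc k) m → InP F (suc l) m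
  inP-≤ k≤l (a , lin , per) = a , rec⇒linRec (rec-≤ k≤l (linRec⇒rec {a = a} lin)) , per

  module _ {j} (E : Extension F (suc j)) where
    private
      module K = FieldProperties (Extension.top E)

      root : ∀ {d} → InD (size ℕ.^ suc j ℕ.∸ 1) d → ∃ λ β → K.HasOrder β d
      root {d} (0<d , d∣N) = K.order-exists d 0<d (≡.subst (λ z → d ∣ z ℕ.∸ 1) (≡.sym (Extension.size-≡ E)) d∣N)

      p⊥d : ∀ {d} → InD (size ℕ.^ suc j ℕ.∸ 1) d → Coprime p d
      p⊥d D@(0<d , _) = prime∤⇒coprime pr (K.char∤order pr (Extension.char E p p≈0) 0<d (proj₂ (root D)))

    D⊆P : ∀ {m} → InD (size ℕ.^ suc j ℕ.∸ 1) m → InP F (suc j) m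
    D⊆P D@(0<d , _) = inP (trace-rec 0<d (proj₂ (root D))) (trace-exact 0<d (proj₂ (root D)))
      where open RootOfUnitySequences F E

    pD⊆P : ∀ {m} → InMulD (λ s → s ≡ p) (size ℕ.^ suc j ℕ.∸ 1) m → InP F (2 ℕ.* suc j) m
    pD⊆P (_ , d , ≡.refl , D@(0<d , _) , ≡.refl) = inP
      (rec-binom 1 (trace-rec 0<d (proj₂ (root D))))
      (exact-product {i = 1} {k = 0} (p⊥d D) binom₁-exact (trace-exact 0<d (proj₂ (root D))) (binom-diagonal 1) (trace-0 0<d (proj₂ (root D))))
      where open RootOfUnitySequences F E

    -- Multiplication by C(n,p) requires the power p + 1 of the annihilator. Over F itself the
    -- degree is p + 1, which is 3 for p = 2 and 4 for p = 3.
    ppD⊆P : ∀ {m} → InMulD (λ s → s ≡ p ℕ.* p) (size ℕ.^ suc j ℕ.∸ 1) m → InP F (suc p ℕ.* suc j) m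
    ppD⊆P (_ , d , ≡.refl , D@(0<d , _) , ≡.refl) = inP
      (rec-binom p (trace-rec 0<d (proj₂ (root D))))
      (exact-product {i = p} {k = 0} (coprime-*ˡ (p⊥d D) (p⊥d D)) binom-p-exact (trace-exact 0<d (proj₂ (root D))) (binom-diagonal p) (trace-0 0<d (proj₂ (root D))))
      where open RootOfUnitySequences F E

-- Upper bounds: factoring the characteristic polynomial

module UpperBounds (F : FiniteField) {p : ℕ} (pr : Prime p)
                   (p≈0 : FiniteField._≈_ F (natCast F p) (FiniteField.0# F)) where
  open FiniteField F hiding (zero)
  open Polynomials commRing
  open FieldProperties F
  open Coding F
  open Irreducibility F
  open Extensions F
  open Periods F
  open import Data.Unit using (tt)
  open import Relation.Binary.Reasoning.Setoid setoid

  module R = PolynomialRing F pr p≈0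

  infix 4 _⊑_
  _⊑_ : Poly → Poly → Set
  f ⊑ g = ∀ s → Ker f s → Ker g s

  xᴺ-1 : ℕ → Poly
  xᴺ-1 N = (R.X R.^ N) ⊕ R.neg R.one

  private
    act-xᴺ-1 : ∀ N s n → act (xᴺ-1 N) s n ≈ s (n ℕ.+ N) - s n
    act-xᴺ-1 N s n = trans (act-⊕ (R.X R.^ N) (R.neg R.one) s n)
      (+-cong (R.act-X^ N s n) (trans (R.act-neg R.one s n) (-‿cong (R.act-one s n))))

  periodic⇒ker : ∀ {N s} → Periodic s N → Ker (xᴺ-1 N) s
  periodic⇒ker {N} {s} per n = trans (act-xᴺ-1 N s n) (trans (+-congʳ (per n)) (-‿inverseʳ _))

  ker⇒periodic : ∀ {N s} → Ker (xᴺ-1 N) s → Periodic s N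
  ker⇒periodic {N} {s} ker n = x-y≈0⇒x≈y (trans (sym (act-xᴺ-1 N s n)) (ker n))

  ⊑-∣ : ∀ {M N} → M ∣ N → xᴺ-1 M ⊑ xᴺ-1 N
  ⊑-∣ {M} (divides k ≡.refl) s ker = periodic⇒ker {s = s} λ n →
    trans (reflexive (≡.cong (λ z → s (n ℕ.+ z)) (ℕₚ.*-comm k M))) (periodic-multiple s {M} (ker⇒periodic {M} {s} ker) k n)

  ⊑-trans : ∀ {f g h} → f ⊑ g → g ⊑ h → f ⊑ h
  ⊑-trans f⊑g g⊑h s = g⊑h s ∘ f⊑g s

  ⊑-^1 : ∀ g → g ⊑ g R.^ 1
  ⊑-^1 g s ker n = trans (act-⊗ g R.one s n) (trans (act-cong g (R.act-one s) n) (ker n))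

  -- If g h kills s, then g kills h s and so does A; after commuting, h kills A s and so does B.
  ⊑-⊗ : ∀ f g h {A B} → f ≅ g ∘ h → g ⊑ A → h ⊑ B → f ⊑ B ⊗ A
  ⊑-⊗ f g h {A} {B} e g⊑A h⊑B s ker n = trans (act-⊗ B A s n) (h⊑B (act A s) (λ n → trans (act-comm h A s n)
    (g⊑A (act h s) (λ n → trans (sym (e s n)) (ker n)) n)) n)

  private
    ker-^-≤ : ∀ g {t u s} → t ≤ u → Ker (g R.^ t) s → Ker (g R.^ u) s
    ker-^-≤ g {t} {s = s} t≤u = go (ℕₚ.≤⇒≤′ t≤u)
      where
      go : ∀ {u} → t ℕ.≤′ u → Ker (g R.^ t) s → Ker (g R.^ u) s
      go ℕ.≤′-refl ker = ker
      go (ℕ.≤′-step {n = u} t≤u) ker n = trans (act-⊗ g (g R.^ u) s n) (act-zero g (go t≤u ker) n)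

    xᴺ-1^p : ∀ N → R._≃_ (xᴺ-1 N R.^ p) (xᴺ-1 (N ℕ.* p))
    xᴺ-1^p N s _ n = begin
      act (xᴺ-1 N R.^ p) s n                                ≈⟨ R.act-frobenius (R.X R.^ N) s n ⟩
      act (((R.X R.^ N) R.^ p) ⊕ R.neg R.one) s n        ≈⟨ act-⊕ ((R.X R.^ N) R.^ p) (R.neg R.one) s n ⟩
      act ((R.X R.^ N) R.^ p) s n + act (R.neg R.one) s n ≈⟨ +-congʳ (R.^-assocʳ R.X N p s tt n) ⟩
      act (R.X R.^ (N ℕ.* p)) s n + act (R.neg R.one) s n ≈⟨ act-⊕ (R.X R.^ (N ℕ.* p)) (R.neg R.one) s n ⟨
      act (xᴺ-1 (N ℕ.* p)) s n                              ∎

  power-periodic : ∀ {N t s} → t ≤ p → Ker (xᴺ-1 N R.^ t) s → Periodic s (N ℕ.* p)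
  power-periodic {N} {t} {s} t≤p ker = ker⇒periodic {s = s} λ n →
    trans (sym (xᴺ-1^p N s tt n)) (ker-^-≤ (xᴺ-1 N) {s = s} t≤p ker n)

  power-periodic² : ∀ {N t s} → t ≤ p ℕ.* p → Ker (xᴺ-1 N R.^ t) s → Periodic s (N ℕ.* p ℕ.* p)
  power-periodic² {N} {t} {s} t≤pp ker = ker⇒periodic {s = s} λ n → begin
    act (xᴺ-1 (N ℕ.* p ℕ.* p)) s n      ≈⟨ xᴺ-1^p (N ℕ.* p) s tt n ⟨
    act (xᴺ-1 (N ℕ.* p) R.^ p) s n      ≈⟨ R.^-congˡ p {xᴺ-1 N R.^ p} {xᴺ-1 (N ℕ.* p)} (xᴺ-1^p N) s tt n ⟨
    act ((xᴺ-1 N R.^ p) R.^ p) s n      ≈⟨ R.^-assocʳ (xᴺ-1 N) p p s tt n ⟩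
    act (xᴺ-1 N R.^ (p ℕ.* p)) s n      ≈⟨ ker-^-≤ (xᴺ-1 N) {s = s} t≤pp ker n ⟩
    0#                               ∎

  N : ℕ → ℕ
  N j = size ℕ.^ j ℕ.∸ 1

  N₁∣N : ∀ q j → q ℕ.^ 1 ℕ.∸ 1 ∣ q ℕ.^ j ℕ.∸ 1
  N₁∣N zero    zero    = ∣-refl
  N₁∣N zero    (suc j) = ∣-refl
  N₁∣N (suc n) j rewrite ℕₚ.*-identityʳ n = divides (proj₁ (geometric j)) (≡.cong (ℕ._∸ 1) (proj₂ (geometric j)))
    where
    -- With q = n + 1 the power stays in the form 1 + k n, so the truncated subtraction only removes
    -- that 1.
    geometric : ∀ j → ∃ λ k → suc n ℕ.^ j ≡ 1 ℕ.+ k ℕ.* n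
    geometric zero    = 0 , ≡.refl
    geometric (suc j) = proj₁ (geometric j) ℕ.+ (1 ℕ.+ proj₁ (geometric j) ℕ.* n) , ≡.trans (≡.cong (λ z → z ℕ.+ n ℕ.* z) (proj₂ (geometric j))) (rearrange n (proj₁ (geometric j)))
      where
      open import Data.Nat.Solver using (module +-*-Solver)
      open +-*-Solver renaming (solve to solveℕ; _:+_ to _:+ℕ_; _:*_ to _:*ℕ_; _:=_ to _:=ℕ_; con to conℕ)
      rearrange : ∀ n k → 1 ℕ.+ k ℕ.* n ℕ.+ n ℕ.* (1 ℕ.+ k ℕ.* n) ≡ 1 ℕ.+ (k ℕ.+ (1 ℕ.+ k ℕ.* n)) ℕ.* n
      rearrange = solveℕ 2 (λ n k → conℕ 1 :+ℕ k :*ℕ n :+ℕ n :*ℕ (conℕ 1 :+ℕ k :*ℕ n)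
                                    :=ℕ conℕ 1 :+ℕ (k :+ℕ (conℕ 1 :+ℕ k :*ℕ n)) :*ℕ n) ≡.refl

  N₂∣N₄ : N 2 ∣ N 4
  N₂∣N₄ = ≡.subst₂ (λ a b → a ℕ.∸ 1 ∣ b ℕ.∸ 1) (ℕₚ.^-identityʳ (size ℕ.^ 2)) (ℕₚ.^-*-assoc size 2 2) (N₁∣N (size ℕ.^ 2) 2)

  Nonzero₀ : ∀ {j} → Vec Carrier j → Set
  Nonzero₀ v = ¬ eval (mon v) 0# ≈ 0#

  factors-nonzero₀ : ∀ {m i j} (v : Vec Carrier j) (Q : Vec Carrier m) (g : Vec Carrier i) →
    mon v ≅ mon Q ∘ mon g → Nonzero₀ v → Nonzero₀ Q × Nonzero₀ g
  factors-nonzero₀ v Q g e v≉0 =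
    (λ Q≈0 → v≉0 (trans ev (trans (*-congʳ Q≈0) (zeroˡ _)))) , (λ g≈0 → v≉0 (trans ev (trans (*-congˡ g≈0) (zeroʳ _))))
    where ev = eval-∘ (mon v) (mon Q) (mon g) e 0#

  irreducible-⊑ : ∀ {j} (v : Vec Carrier (suc j)) → Irreducible v → Nonzero₀ v → mon v ⊑ xᴺ-1 (N (suc j))
  irreducible-⊑ v irr v≉0 s ker = periodic⇒ker {s = s} (irreducible-period v irr v≉0 s ker)

  -- The free j lets a linear factor merge with factors of any degree.
  linear-⊑ : ∀ j (v : Vec Carrier 1) → Nonzero₀ v → mon v ⊑ xᴺ-1 (N j)
  linear-⊑ j v v≉0 = ⊑-trans {mon v} {xᴺ-1 (N 1)} {xᴺ-1 (N j)} (irreducible-⊑ v (irreducible₁ v) v≉0) (⊑-∣ (N₁∣N size j))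

  -- Q ≡ Q(r) ≠ 0 mod x − r is a Bézout relation.
  coprime-linear-⊑ : ∀ {m j} (v : Vec Carrier j) (Q : Vec Carrier (suc m)) r A → mon v ≅ mon Q ∘ mon (linear r) →
    ¬ eval (mon Q) r ≈ 0# → mon Q ⊑ A → mon (linear r) ⊑ A → mon v ⊑ A
  coprime-linear-⊑ v Q r A e Qr≉0 Q⊑A lin⊑A s ker n = x*y≈0⇒y≈0 Qr≉0 (begin
    ρ * act A s n                              ≈⟨ +-identityˡ _ ⟨
    0# + ρ * act A s n                         ≈⟨ +-cong (trans (act-comm A Q′ (L s) n) (act-zero Q′ A-lin n)) (act-* A ρ s n) ⟨
    act A (act Q′ (L s)) n + act A (λ n → ρ * s n) n   ≈⟨ act-+ A (act Q′ (L s)) (λ n → ρ * s n) n ⟨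
    act A (λ n → act Q′ (L s) n + ρ * s n) n   ≈⟨ act-cong A (proj₂ (divide-linear Q r) s) n ⟨
    act A (act (mon Q) s) n                    ≈⟨ lin⊑A (act (mon Q) s) (λ n → trans (act-comm (mon (linear r)) (mon Q) s n) (trans (sym (e s n)) (ker n))) n ⟩
    0#                                         ∎)
    where
    ρ = eval (mon Q) r
    Q′ = mon (proj₁ (divide-linear Q r))
    L : Seq → Seq
    L = act (mon (linear r))
    A-lin : ∀ n → act A (L s) n ≈ 0#
    A-lin = Q⊑A (L s) (λ n → trans (sym (e s n)) (ker n))

  module Root {m} (v : Vec Carrier (suc m)) (v≉0 : Nonzero₀ v) (root : HasRoot v) where
    r = proj₁ root
    Q = proj₁ (factor-root v r (proj₂ root))

    factorisation : mon v ≅ mon Q ∘ mon (linear r)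
    factorisation = proj₂ (factor-root v r (proj₂ root))

    Q≉0 : Nonzero₀ Q
    Q≉0 = proj₁ (factors-nonzero₀ v Q (linear r) factorisation v≉0)

    r≉0 : Nonzero₀ (linear r)
    r≉0 = proj₂ (factors-nonzero₀ v Q (linear r) factorisation v≉0)

    step : ∀ j t → mon Q ⊑ xᴺ-1 (N j) R.^ t → mon v ⊑ xᴺ-1 (N j) R.^ suc t
    step j t Q⊑ = ⊑-⊗ (mon v) (mon Q) (mon (linear r)) {xᴺ-1 (N j) R.^ t} {xᴺ-1 (N j)} factorisation Q⊑ (linear-⊑ j (linear r) r≉0)

  rooted₂ : (v : Vec Carrier 2) → Nonzero₀ v → HasRoot v → mon v ⊑ xᴺ-1 (N 1) R.^ 2
  rooted₂ v v≉0 root = step 1 1 (⊑-trans {mon Q} {xᴺ-1 (N 1)} {xᴺ-1 (N 1) R.^ 1} (linear-⊑ 1 Q Q≉0) (⊑-^1 (xᴺ-1 (N 1))))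
    where open Root v v≉0 root

  upper₂ : (v : Vec Carrier 2) → Nonzero₀ v → mon v ⊑ xᴺ-1 (N 2) ⊎ mon v ⊑ xᴺ-1 (N 1) R.^ 2
  upper₂ v v≉0 = decide (hasRoot? v)
    where
    decide : Dec (HasRoot v) → mon v ⊑ xᴺ-1 (N 2) ⊎ mon v ⊑ xᴺ-1 (N 1) R.^ 2
    decide (no ¬root) = inj₁ (irreducible-⊑ v (irreducible₂ v ¬root) v≉0)
    decide (yes root) = inj₂ (rooted₂ v v≉0 root)

  -- The absence of roots is kept in the first case because a further linear factor of a quartic can
  -- be absorbed by the cubic only if it is coprime to it.
  upper₃ : (v : Vec Carrier 3) → Nonzero₀ v →
    (¬ HasRoot v × mon v ⊑ xᴺ-1 (N 3)) ⊎ mon v ⊑ xᴺ-1 (N 2) ⊎ mon v ⊑ xᴺ-1 (N 1) R.^ 3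
  upper₃ v v≉0 = decide (hasRoot? v)
    where
    Result : Set
    Result = (¬ HasRoot v × mon v ⊑ xᴺ-1 (N 3)) ⊎ mon v ⊑ xᴺ-1 (N 2) ⊎ mon v ⊑ xᴺ-1 (N 1) R.^ 3

    decide : Dec (HasRoot v) → Result
    decide (no ¬root) = inj₁ (¬root , irreducible-⊑ v (irreducible₃ v ¬root) v≉0)
    decide (yes root) = inj₂ (decideQ (hasRoot? Q))
      where
      open Root v v≉0 root
      decideQ : Dec (HasRoot Q) → mon v ⊑ xᴺ-1 (N 2) ⊎ mon v ⊑ xᴺ-1 (N 1) R.^ 3
      decideQ (no ¬root) = inj₁ (coprime-linear-⊑ v Q r (xᴺ-1 (N 2)) factorisation (λ e → ¬root (r , e))
        (irreducible-⊑ Q (irreducible₂ Q ¬root) Q≉0) (linear-⊑ 2 (linear r) r≉0))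
      decideQ (yes rootQ) = inj₂ (step 1 2 (rooted₂ Q Q≉0 rootQ))

  QuadraticFactors : Vec Carrier 4 → Set
  QuadraticFactors v = Σ (Vec Carrier 2) λ Q → Σ (Vec Carrier 2) λ g → mon v ≅ mon Q ∘ mon g

  -- In degree 4 a missing root no longer implies irreducibility; the finitely many pairs of monic
  -- quadratics are searched.
  quadraticFactors? : (v : Vec Carrier 4) → Dec (QuadraticFactors v)
  quadraticFactors? v = map′ sound complete
    (Finₚ.any? λ k → Finₚ.any? λ l → isZero? (subtract v 1# (decode 2 k ⊠ decode 2 l)))
    where
    open import Relation.Nullary.Decidable using (map′)

    sound : (∃ λ k → ∃ λ l → IsZero (subtract v 1# (decode 2 k ⊠ decode 2 l))) → QuadraticFactors v
    sound (k , l , z) = Q , g , λ s n → begin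
      act (mon v) s n                                    ≈⟨ act-mon v s n ⟩
      act (poly v) s n + s (n ℕ.+ 4)                     ≈⟨ +-congʳ (x-y≈0⇒x≈y (trans (+-congˡ (-‿cong (sym (*-identityˡ _))))
                                                              (trans (sym (act-subtract v 1# (Q ⊠ g) s n)) (act-IsZero z s n)))) ⟩
      act (poly (Q ⊠ g)) s n + s (n ℕ.+ 4)               ≈⟨ act-mon (Q ⊠ g) s n ⟨
      act (mon (Q ⊠ g)) s n                              ≈⟨ act-⊠ Q g s n ⟩
      act (mon Q) (act (mon g) s) n                      ∎
      where
      Q = decode 2 k
      g = decode 2 l

    complete : QuadraticFactors v → ∃ λ k → ∃ λ l → IsZero (subtract v 1# (decode 2 k ⊠ decode 2 l))
    complete (Q , g , e) = encode Q , encode g , mon-injective v (Q′ ⊠ g′) λ s n → begin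
      act (mon v) s n                     ≈⟨ e s n ⟩
      act (mon Q) (act (mon g) s) n       ≈⟨ act-cong (mon Q) (act-mon-decode-encode g s) n ⟨
      act (mon Q) (act (mon g′) s) n      ≈⟨ act-mon-decode-encode Q (act (mon g′) s) n ⟨
      act (mon Q′) (act (mon g′) s) n     ≈⟨ act-⊠ Q′ g′ s n ⟨
      act (mon (Q′ ⊠ g′)) s n             ∎
      where
      Q′ = decode 2 (encode Q)
      g′ = decode 2 (encode g)

  irreducible₄ : (f : Vec Carrier 4) → ¬ HasRoot f → ¬ QuadraticFactors f → Irreducible f
  irreducible₄ f ¬root ¬quad zero (suc (suc zero)) ≡.refl g z =
    ¬root (divisor-root (mon f) (proj₁ (monicDivMod 1 f g)) g (factor 1 f g z) (inj₁ (linear-hasRoot (proj₁ (monicDivMod 1 f g)))))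
  irreducible₄ f ¬root ¬quad (suc zero) (suc zero) ≡.refl g z =
    ¬quad (proj₁ (monicDivMod 2 f g) , g , factor 2 f g z)
  irreducible₄ f ¬root ¬quad (suc (suc zero)) zero ≡.refl g z =
    ¬root (divisor-root (mon f) (proj₁ (monicDivMod 3 f g)) g (factor 3 f g z) (inj₂ (linear-hasRoot g)))
  irreducible₄ f ¬root ¬quad zero zero () g z
  irreducible₄ f ¬root ¬quad zero (suc zero) () g z
  irreducible₄ f ¬root ¬quad zero (suc (suc (suc i))) () g z
  irreducible₄ f ¬root ¬quad (suc zero) zero () g z
  irreducible₄ f ¬root ¬quad (suc zero) (suc (suc i)) () g z
  irreducible₄ f ¬root ¬quad (suc (suc zero)) (suc i) () g z
  irreducible₄ f ¬root ¬quad (suc (suc (suc zero))) i () g z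
  irreducible₄ f ¬root ¬quad (suc (suc (suc (suc m)))) i () g z

  Upper₄ : Vec Carrier 4 → Set
  Upper₄ v = mon v ⊑ xᴺ-1 (N 4) ⊎ mon v ⊑ xᴺ-1 (N 3) ⊎ mon v ⊑ xᴺ-1 (N 2) R.^ 2 ⊎ mon v ⊑ xᴺ-1 (N 1) R.^ 4

  upper₄ : (v : Vec Carrier 4) → Nonzero₀ v → Upper₄ v
  upper₄ v v≉0 = decide (hasRoot? v)
    where
    decide : Dec (HasRoot v) → Upper₄ v
    decide (yes root) = cubic (upper₃ Q Q≉0)
      where
      open Root v v≉0 root
      cubic : (¬ HasRoot Q × mon Q ⊑ xᴺ-1 (N 3)) ⊎ mon Q ⊑ xᴺ-1 (N 2) ⊎ mon Q ⊑ xᴺ-1 (N 1) R.^ 3 → Upper₄ v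
      cubic (inj₁ (¬rootQ , Q⊑)) = inj₂ (inj₁ (coprime-linear-⊑ v Q r (xᴺ-1 (N 3)) factorisation (λ e → ¬rootQ (r , e)) Q⊑ (linear-⊑ 3 (linear r) r≉0)))
      -- The root r may also be a root of the cubic, so the square cannot be avoided here.
      cubic (inj₂ (inj₁ Q⊑)) = inj₂ (inj₂ (inj₁ (step 2 1 (⊑-trans {mon Q} {xᴺ-1 (N 2)} {xᴺ-1 (N 2) R.^ 1} Q⊑ (⊑-^1 (xᴺ-1 (N 2)))))))
      cubic (inj₂ (inj₂ Q⊑)) = inj₂ (inj₂ (inj₂ (step 1 3 Q⊑)))
    decide (no ¬root) = quartic (quadraticFactors? v)
      where
      quartic : Dec (QuadraticFactors v) → Upper₄ v
      quartic (no ¬quad) = inj₁ (irreducible-⊑ v (irreducible₄ v ¬root ¬quad) v≉0)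
      -- The two irreducible quadratics may be equal, whence again the square.
      quartic (yes (Q , g , e)) = inj₂ (inj₂ (inj₁ (⊑-⊗ (mon v) (mon Q) (mon g) {xᴺ-1 (N 2) R.^ 1} {xᴺ-1 (N 2)} e
          (⊑-trans {mon Q} {xᴺ-1 (N 2)} {xᴺ-1 (N 2) R.^ 1} (quadratic Q (¬root ∘ divisor-root (mon v) Q g e ∘ inj₁) (proj₁ both)) (⊑-^1 (xᴺ-1 (N 2))))
          (quadratic g (¬root ∘ divisor-root (mon v) Q g e ∘ inj₂) (proj₂ both)))))
        where
        both = factors-nonzero₀ v Q g e v≉0
        quadratic : (w : Vec Carrier 2) → ¬ HasRoot w → Nonzero₀ w → mon w ⊑ xᴺ-1 (N 2)
        quadratic w ¬rootw = irreducible-⊑ w (irreducible₂ w ¬rootw)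

-- The period sets for degrees 1 to 4

module PeriodSets (F : FiniteField) {p : ℕ} (pr : Prime p)
                  (p≈0 : FiniteField._≈_ F (natCast F p) (FiniteField.0# F)) where
  open FiniteField F using (size)
  open Arithmetic
  open Extensions F
  open Polynomials (FiniteField.commRing F) using (mon)
  open Periods F
  open Recurrences F
  open LowerBounds F pr p≈0
  open UpperBounds F pr p≈0

  private
    N₁≡ : N 1 ≡ size ℕ.∸ 1
    N₁≡ = ≡.cong (ℕ._∸ 1) (ℕₚ.^-identityʳ size)

    toN₁ : ∀ {m} → InD (size ℕ.∸ 1) m → InD (N 1) m
    toN₁ {m} = ≡.subst (λ n → InD n m) (≡.sym N₁≡)

    toN₁′ : ∀ {S m} → InMulD S (size ℕ.∸ 1) m → InMulD S (N 1) m
    toN₁′ {S} {m} = ≡.subst (λ n → InMulD S n m) (≡.sym N₁≡)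

    fromN₁ : ∀ {S m} → InMulD S (N 1) m → InMulD S (size ℕ.∸ 1) m
    fromN₁ {S} {m} = ≡.subst (λ n → InMulD S n m) N₁≡

    positive : ∀ {k m} → InP F k m → 0 < m
    positive (_ , _ , (0<m , _) , _) = 0<m

    0<*⇒0< : ∀ a {b} → 0 < a ℕ.* b → 0 < b
    0<*⇒0< a {zero}  0<ab = ⊥-elim (ℕₚ.<-irrefl (≡.sym (ℕₚ.*-zeroʳ a)) 0<ab)
    0<*⇒0< a {suc b} _    = s≤s z≤n

    D-∣ : ∀ {m n n′} → n ∣ n′ → InD n m → InD n′ m
    D-∣ n∣n′ (0<m , m∣n) = 0<m , ∣-trans m∣n n∣n′

    MulD-∣ : ∀ {S m n n′} → n ∣ n′ → InMulD S n m → InMulD S n′ m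
    MulD-∣ n∣n′ (s , d , Ss , D , eq) = s , d , Ss , D-∣ n∣n′ D , eq

    split : ∀ {m n} → 0 < m → m ∣ n ℕ.* p → InD n m ⊎ InMulD (λ s → s ≡ p) n m
    split {m} {n} 0<m m∣np with ∣-prime-* pr (≡.subst (m ∣_) (ℕₚ.*-comm n p) m∣np)
    ... | inj₁ m∣n = inj₁ (0<m , m∣n)
    ... | inj₂ (m′ , ≡.refl , m′∣n) = inj₂ (p , m′ , ≡.refl , (0<*⇒0< p 0<m , m′∣n) , ≡.refl)

    split² : ∀ {m n} → 0 < m → m ∣ n ℕ.* p ℕ.* p → InD n m ⊎ InMulD (λ s → s ≡ p) n m ⊎ InMulD (λ s → s ≡ p ℕ.* p) n m
    split² {m} {n} 0<m m∣ with split 0<m m∣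
    ... | inj₁ (_ , m∣np) with split 0<m m∣np
    ...   | inj₁ D = inj₁ D
    ...   | inj₂ pD = inj₂ (inj₁ pD)
    split² {m} {n} 0<m m∣ | inj₂ (_ , m′ , ≡.refl , (0<m′ , m′∣np) , ≡.refl) with split 0<m′ m′∣np
    ...   | inj₁ D = inj₂ (inj₁ (p , m′ , ≡.refl , D , ≡.refl))
    ...   | inj₂ (_ , m″ , ≡.refl , D , ≡.refl) = inj₂ (inj₂ (p ℕ.* p , m″ , ≡.refl , D , ≡.sym (ℕₚ.*-assoc p p m″)))

    1<p : 1 < p
    1<p = ℕ.nonTrivial⇒n>1 p {{prime⇒nonTrivial pr}}

    module Annihilator {k m} (P : InP F (suc k) m) where
      a = proj₁ P
      rec = linRec⇒rec {a = a} (proj₁ (proj₂ P))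
      v = proj₁ rec
      v≉0 = proj₁ (proj₂ rec)

      inD : ∀ n → mon v ⊑ xᴺ-1 n → InD n m
      inD n v⊑ = positive P , period∣ (proj₂ (proj₂ P)) (ker⇒periodic {n} {a} (v⊑ a (proj₂ (proj₂ rec))))

      inD∪pD : ∀ n t → t ≤ p → mon v ⊑ xᴺ-1 n R.^ t → InD n m ⊎ InMulD (λ s → s ≡ p) n m
      inD∪pD n t t≤p v⊑ = split (positive P)
        (period∣ (proj₂ (proj₂ P)) (power-periodic {n} {t} {a} t≤p (v⊑ a (proj₂ (proj₂ rec)))))

      inD∪pD∪ppD : ∀ n t → t ≤ p ℕ.* p → mon v ⊑ xᴺ-1 n R.^ t →
                   InD n m ⊎ InMulD (λ s → s ≡ p) n m ⊎ InMulD (λ s → s ≡ p ℕ.* p) n m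
      inD∪pD∪ppD n t t≤pp v⊑ = split² (positive P)
        (period∣ (proj₂ (proj₂ P)) (power-periodic² {n} {t} {a} t≤pp (v⊑ a (proj₂ (proj₂ rec)))))

  P₁ : ∀ m → InP F 1 m ⇔ InD (size ℕ.∸ 1) m
  P₁ m = mk⇔ to (D⊆P extension₁ ∘ toN₁)
    where
    to : InP F 1 m → InD (size ℕ.∸ 1) m
    to P = ≡.subst (λ n → InD n m) N₁≡ (inD (N 1) (linear-⊑ 1 v v≉0))
      where open Annihilator P

  P₂ : ∀ m → InP F 2 m ⇔ (InD (N 2) m ⊎ InMulD (λ s → s ≡ p) (size ℕ.∸ 1) m)
  P₂ m = mk⇔ to from
    where
    Goal = InD (N 2) m ⊎ InMulD (λ s → s ≡ p) (size ℕ.∸ 1) m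

    to : InP F 2 m → Goal
    to P = cases (upper₂ v v≉0)
      where
      open Annihilator P

      repeated : InD (N 1) m ⊎ InMulD (λ s → s ≡ p) (N 1) m → Goal
      repeated (inj₁ D)  = inj₁ (D-∣ (N₁∣N size 2) D)
      repeated (inj₂ pD) = inj₂ (fromN₁ pD)

      cases : mon v ⊑ xᴺ-1 (N 2) ⊎ mon v ⊑ xᴺ-1 (N 1) R.^ 2 → Goal
      cases (inj₁ h) = inj₁ (inD (N 2) h)
      cases (inj₂ h) = repeated (inD∪pD (N 1) 2 1<p h)

    from : Goal → InP F 2 m
    from (inj₁ D)  = D⊆P extension₂ D
    from (inj₂ pD) = pD⊆P extension₁ (toN₁′ pD)

  private
    P₃-from : ∀ {m} → InD (N 3) m ⊎ InD (N 2) m ⊎ InMulD (λ s → s ≡ p) (size ℕ.∸ 1) m → InP F 3 m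
    P₃-from (inj₁ D)         = D⊆P extension₃ D
    P₃-from (inj₂ (inj₁ D))  = inP-≤ (ℕₚ.n≤1+n 2) (D⊆P extension₂ D)
    P₃-from (inj₂ (inj₂ pD)) = inP-≤ (ℕₚ.n≤1+n 2) (pD⊆P extension₁ (toN₁′ pD))

  P₃ : 3 ≤ p → ∀ m → InP F 3 m ⇔ (InD (N 3) m ⊎ InD (N 2) m ⊎ InMulD (λ s → s ≡ p) (size ℕ.∸ 1) m)
  P₃ 3≤p m = mk⇔ to P₃-from
    where
    Goal = InD (N 3) m ⊎ InD (N 2) m ⊎ InMulD (λ s → s ≡ p) (size ℕ.∸ 1) m

    to : InP F 3 m → Goal
    to P = cases (upper₃ v v≉0)
      where
      open Annihilator P

      repeated : InD (N 1) m ⊎ InMulD (λ s → s ≡ p) (N 1) m → Goal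
      repeated (inj₁ D)  = inj₂ (inj₁ (D-∣ (N₁∣N size 2) D))
      repeated (inj₂ pD) = inj₂ (inj₂ (fromN₁ pD))

      cases : _ → Goal
      cases (inj₁ (_ , h))  = inj₁ (inD (N 3) h)
      cases (inj₂ (inj₁ h)) = inj₂ (inj₁ (inD (N 2) h))
      -- For p ≥ 3 even a triple root stays within the exponent p.
      cases (inj₂ (inj₂ h)) = repeated (inD∪pD (N 1) 3 3≤p h)

  P₃′ : p ≡ 2 → ∀ m → InP F 3 m ⇔ (InD (N 3) m ⊎ InD (N 2) m ⊎ InMulD (λ s → s ≡ 2 ⊎ s ≡ 4) (size ℕ.∸ 1) m)
  P₃′ ≡.refl m = mk⇔ to from
    where
    Goal = InD (N 3) m ⊎ InD (N 2) m ⊎ InMulD (λ s → s ≡ 2 ⊎ s ≡ 4) (size ℕ.∸ 1) m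

    to : InP F 3 m → Goal
    to P = cases (upper₃ v v≉0)
      where
      open Annihilator P

      repeated : InD (N 1) m ⊎ InMulD (λ s → s ≡ 2) (N 1) m ⊎ InMulD (λ s → s ≡ 4) (N 1) m → Goal
      repeated (inj₁ D) = inj₂ (inj₁ (D-∣ (N₁∣N size 2) D))
      repeated (inj₂ (inj₁ (s , d , e , D))) = inj₂ (inj₂ (fromN₁ (s , d , inj₁ e , D)))
      repeated (inj₂ (inj₂ (s , d , e , D))) = inj₂ (inj₂ (fromN₁ (s , d , inj₂ e , D)))

      cases : _ → Goal
      cases (inj₁ (_ , h))  = inj₁ (inD (N 3) h)
      cases (inj₂ (inj₁ h)) = inj₂ (inj₁ (inD (N 2) h))
      -- For p = 2 a triple root exceeds p and is covered only by p² = 4.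
      cases (inj₂ (inj₂ h)) = repeated (inD∪pD∪ppD (N 1) 3 (ℕₚ.n≤1+n 3) h)

    from : Goal → InP F 3 m
    from (inj₁ D)        = P₃-from (inj₁ D)
    from (inj₂ (inj₁ D)) = P₃-from (inj₂ (inj₁ D))
    from (inj₂ (inj₂ (s , d , inj₁ e , D))) = P₃-from (inj₂ (inj₂ (s , d , e , D)))
    from (inj₂ (inj₂ (s , d , inj₂ e , D))) = ppD⊆P extension₁ (toN₁′ (s , d , e , D))

  private
    P₄-from : ∀ {m} → InD (N 4) m ⊎ InD (N 3) m ⊎ InMulD (λ s → s ≡ p) (N 2) m → InP F 4 m
    P₄-from (inj₁ D)         = D⊆P (extension₄ F) D
    P₄-from (inj₂ (inj₁ D))  = inP-≤ (ℕₚ.n≤1+n 3) (D⊆P extension₃ D)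
    P₄-from (inj₂ (inj₂ pD)) = pD⊆P extension₂ pD

  P₄ : 5 ≤ p → ∀ m → InP F 4 m ⇔ (InD (N 4) m ⊎ InD (N 3) m ⊎ InMulD (λ s → s ≡ p) (N 2) m)
  P₄ 5≤p m = mk⇔ to P₄-from
    where
    Goal = InD (N 4) m ⊎ InD (N 3) m ⊎ InMulD (λ s → s ≡ p) (N 2) m

    to : InP F 4 m → Goal
    to P = cases (upper₄ v v≉0)
      where
      open Annihilator P

      repeated : ∀ n → n ∣ N 2 → InD n m ⊎ InMulD (λ s → s ≡ p) n m → Goal
      repeated n n∣N₂ (inj₁ D)  = inj₁ (D-∣ (∣-trans n∣N₂ N₂∣N₄) D)
      repeated n n∣N₂ (inj₂ pD) = inj₂ (inj₂ (MulD-∣ n∣N₂ pD))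

      cases : Upper₄ v → Goal
      cases (inj₁ h)               = inj₁ (inD (N 4) h)
      cases (inj₂ (inj₁ h))        = inj₂ (inj₁ (inD (N 3) h))
      cases (inj₂ (inj₂ (inj₁ h))) = repeated (N 2) ∣-refl (inD∪pD (N 2) 2 1<p h)
      cases (inj₂ (inj₂ (inj₂ h))) = repeated (N 1) (N₁∣N size 2) (inD∪pD (N 1) 4 (ℕₚ.<⇒≤ 5≤p) h)

  P₄′ : p ≡ 2 ⊎ p ≡ 3 → ∀ m → InP F 4 m ⇔
    (InD (N 4) m ⊎ InD (N 3) m ⊎ InMulD (λ s → s ≡ p) (N 2) m ⊎ InMulD (λ s → s ≡ p ℕ.* p) (size ℕ.∸ 1) m)
  P₄′ small m = mk⇔ to from
    where
    Goal = InD (N 4) m ⊎ InD (N 3) m ⊎ InMulD (λ s → s ≡ p) (N 2) m ⊎ InMulD (λ s → s ≡ p ℕ.* p) (size ℕ.∸ 1) m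

    to : InP F 4 m → Goal
    to P = cases (upper₄ v v≉0)
      where
      open Annihilator P

      repeated₂ : InD (N 2) m ⊎ InMulD (λ s → s ≡ p) (N 2) m → Goal
      repeated₂ (inj₁ D)  = inj₁ (D-∣ N₂∣N₄ D)
      repeated₂ (inj₂ pD) = inj₂ (inj₂ (inj₁ pD))

      -- D(q - 1) and p D(q - 1) disappear into D(q⁴ - 1) and p D(q² - 1); only p² D(q - 1) has to
      -- be listed.
      repeated₁ : InD (N 1) m ⊎ InMulD (λ s → s ≡ p) (N 1) m ⊎ InMulD (λ s → s ≡ p ℕ.* p) (N 1) m → Goal
      repeated₁ (inj₁ D)          = inj₁ (D-∣ (N₁∣N size 4) D)
      repeated₁ (inj₂ (inj₁ pD))  = inj₂ (inj₂ (inj₁ (MulD-∣ (N₁∣N size 2) pD)))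
      repeated₁ (inj₂ (inj₂ ppD)) = inj₂ (inj₂ (inj₂ (fromN₁ ppD)))

      cases : Upper₄ v → Goal
      cases (inj₁ h)               = inj₁ (inD (N 4) h)
      cases (inj₂ (inj₁ h))        = inj₂ (inj₁ (inD (N 3) h))
      cases (inj₂ (inj₂ (inj₁ h))) = repeated₂ (inD∪pD (N 2) 2 1<p h)
      cases (inj₂ (inj₂ (inj₂ h))) = repeated₁ (inD∪pD∪ppD (N 1) 4 (ℕₚ.*-mono-≤ 1<p 1<p) h)

    ppD⊆P₄ : p ≡ 2 ⊎ p ≡ 3 → InMulD (λ s → s ≡ p ℕ.* p) (size ℕ.∸ 1) m → InP F 4 m
    -- The degree p + 1 is 3 here and is raised to 4; for p = 3 it is 4 already.
    ppD⊆P₄ (inj₁ ≡.refl) D = inP-≤ (ℕₚ.n≤1+n 3) (ppD⊆P extension₁ (toN₁′ D))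
    ppD⊆P₄ (inj₂ ≡.refl) D = ppD⊆P extension₁ (toN₁′ D)

    from : Goal → InP F 4 m
    from (inj₁ D)                = P₄-from (inj₁ D)
    from (inj₂ (inj₁ D))         = P₄-from (inj₂ (inj₁ D))
    from (inj₂ (inj₂ (inj₁ D)))  = P₄-from (inj₂ (inj₂ D))
    from (inj₂ (inj₂ (inj₂ D)))  = ppD⊆P₄ small D

open import Data.Nat using (_∸_; _^_; _*_)

theorem3p5 : (F : FiniteField) → (p : ℕ) → Prime p →
    FiniteField._≈_ F (natCast F p) (FiniteField.0# F) →
    let q = FiniteField.size F in
    (∀ m → InP F 1 m ⇔ InD (q ∸ 1) m) ×
    (∀ m → InP F 2 m ⇔ (InD (q ^ 2 ∸ 1) m ⊎ InMulD (λ s → s ≡ p) (q ∸ 1) m)) ×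
    (3 ≤ p → ∀ m → InP F 3 m ⇔
    (InD (q ^ 3 ∸ 1) m ⊎ InD (q ^ 2 ∸ 1) m ⊎ InMulD (λ s → s ≡ p) (q ∸ 1) m)) ×
    (p ≡ 2 → ∀ m → InP F 3 m ⇔
    (InD (q ^ 3 ∸ 1) m ⊎ InD (q ^ 2 ∸ 1) m ⊎ InMulD (λ s → s ≡ 2 ⊎ s ≡ 4) (q ∸ 1) m)) ×
    (5 ≤ p → ∀ m → InP F 4 m ⇔
    (InD (q ^ 4 ∸ 1) m ⊎ InD (q ^ 3 ∸ 1) m ⊎ InMulD (λ s → s ≡ p) (q ^ 2 ∸ 1) m)) ×
    ((p ≡ 2 ⊎ p ≡ 3) → ∀ m → InP F 4 m ⇔
    (InD (q ^ 4 ∸ 1) m ⊎ InD (q ^ 3 ∸ 1) m ⊎ InMulD (λ s → s ≡ p) (q ^ 2 ∸ 1) m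
    ⊎ InMulD (λ s → s ≡ p * p) (q ∸ 1) m))
theorem3p5 F p pr p≈0 = P₁ , P₂ , P₃ , P₃′ , P₄ , P₄′
  where open PeriodSets F pr p≈0
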